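{- Let $G=(V,E)$ be a bipartite graph with $n=|V|$, maximum degree $\Delta$, $\wedge=\sum_{u\in V}\binom{d_u}{2}$ wedges, and $B>0$ butterflies. There is an algorithm that uses $\tilde O\left(\frac{\wedge}{B}\left(1+\frac{p_{1w}}{B}\right)\right)$ iterations of WSamp and yields an $(\epsilon,\delta)$-estimator of $B=B(G)$ using time $\tilde O\left(\frac{(\Delta+\log n)\wedge}{B}\left(1+\frac{p_{1w}}{B}\right)\right)$ and space $O(n)$.
   Context: Graphs are finite, simple, bipartite. $\Gamma_v$ is the set of neighbors of $v$, $d_v=|\Gamma_v|$. A wedge is a path of length two. A butterfly is a $2\times2$ biclique. $B(G)$ is the number of butterflies in $G$. $p_{1w}$ is the number of (unordered) pairs of distinct butterflies that share a wedge (exactly three vertices and two edges). One iteration of WSamp: choose a vertex $u\in V$ with probability $\binom{d_u}{2}/\wedge$, choose two distinct vertices $v,w\in\Gamma_u$ uniformly at random, set $\beta=|\Gamma_v\cap\Gamma_w|-1$, and return $\beta\cdot\wedge/4$. Time is measured after an $O(n)$-time precomputation (of $\wedge$ and the prefix sums of the values $\binom{d_v}{2}$); hash operations cost $O(1)$; space is in addition to the stored graph. For $\epsilon,\delta\in[0,1]$, an $(\epsilon,\delta)$-estimator (approximation) of a number $Z$ is a random variable $\hat Z$ with $\Pr[|\hat Z-Z|>\epsilon Z]\le\delta$. $\tilde O(f)$ means $O\left(f\cdot\frac{\log(1/\delta)}{\epsilon^2}\right)$.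
   Formalization: The algorithm is also given an integer M with ρ ≤ M ≤ 2ρ+1, ρ=(∧/B)(1+p_{1w}/B), since no algorithm seeing the graph only through WSamp can meet the iteration bound without it; ε, δ are positive rationals and log(1/δ) is rounded up to at least 1. -}

module Defs where

open import Algebra.Properties.CommutativeMonoid.Sum as Sum using ()
open import Data.Bool.Base using (Bool; true; false; if_then_else_)
import Data.Bool.Properties as Bool
open import Data.Fin.Base using (Fin; toℕ)
import Data.Fin.Properties as Fin
open import Data.Integer.Base using (+_; ∣_∣)
open import Data.List.Base
  using (List; []; _∷_; _++_; map; filter; length; lookup; allFin; cartesianProduct; foldr)
open import Data.List.Membership.Propositional using (_∈_)
import Data.List.Membership.DecPropositional as DecMembership
open import Data.List.Relation.Unary.Unique.Propositional using (Unique)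
open import Data.Nat.Base as ℕ using (ℕ; zero; suc; _+_; _*_; _∸_; _⊔_; _≡ᵇ_; _<ᵇ_)
import Data.Nat.Properties as ℕ
open import Data.Nat.Combinatorics using (_C_)
open import Data.Nat.Logarithm using (⌈log₂_⌉)
open import Data.Nat.ListAction using (sum)
open import Data.Product.Base using (_×_; _,_; proj₁; proj₂)
import Data.Product.Properties as Product
open import Data.Rational.Base as ℚ using (ℚ; 0ℚ; 1ℚ)
import Data.Rational.Properties as ℚ
open import Data.Unit.Base using (⊤; tt)
open import Level using (0ℓ)
open import Relation.Binary.PropositionalEquality using (_≡_; _≢_)
open import Relation.Nullary.Decidable using (does; _×-dec_)
open import Relation.Unary using (Pred; Decidable)

fromℕ : ℕ → ℚ
fromℕ k = + k ℚ./ 1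

-- Totalised: ratio a 0 is 0.
ratio : ℕ → ℕ → ℚ
ratio a zero    = 0ℚ
ratio a (suc b) = + a ℚ./ suc b

-- All (x , y) with x occurring before y; for a duplicate-free list these are
-- its unordered pairs of distinct elements, each listed once.
pairs : {A : Set} → List A → List (A × A)
pairs []       = []
pairs (x ∷ xs) = map (x ,_) xs ++ pairs xs

------------------------------------------------------------------------
-- Graphs

-- A finite simple bipartite graph on Fin n, given by its adjacency lists
-- (in an arbitrary order, which is the order in which programs see them).
record BipartiteGraph (n : ℕ) : Set where
  field
    Γ         : Fin n → List (Fin n)
    Γ-unique  : ∀ v → Unique (Γ v)
    Γ-sym     : ∀ {u v} → u ∈ Γ v → v ∈ Γ u
    side      : Fin n → Bool
    Γ-crosses : ∀ {u v} → u ∈ Γ v → side u ≢ side v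

module _ {n : ℕ} where

  open DecMembership (Fin._≟_ {n}) using (_∈?_)
  open DecMembership (Product.≡-dec (Fin._≟_ {n}) (Fin._≟_ {n})) using ()
    renaming (_∈?_ to _∈ᴱ?_)

  -- ((a , b) , (c , d)) stands for the subgraph with parts {a , b} and {c , d}.
  Square : Set
  Square = (Fin n × Fin n) × (Fin n × Fin n)

  vertices : Square → List (Fin n)
  vertices ((a , b) , (c , d)) = a ∷ b ∷ c ∷ d ∷ []

  edges : Square → List (Fin n × Fin n)
  edges ((a , b) , (c , d)) = (a , c) ∷ (a , d) ∷ (b , c) ∷ (b , d) ∷ []

  SharesWedge : Pred (Square × Square) 0ℓ
  SharesWedge (s , t) =
    length (filter (_∈? vertices t) (vertices s)) ≡ 3 ×
    length (filter (_∈ᴱ? edges t) (edges s)) ≡ 2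

  sharesWedge? : Decidable SharesWedge
  sharesWedge? (s , t) = (_ ℕ.≟ 3) ×-dec (_ ℕ.≟ 2)

  module _ (G : BipartiteGraph n) where

    open BipartiteGraph G

    degree : Fin n → ℕ
    degree v = length (Γ v)

    maxDegree : ℕ
    maxDegree = foldr _⊔_ 0 (map degree (allFin n))

    wedges : ℕ
    wedges = sum (map (λ u → degree u C 2) (allFin n))

    codegree : Fin n → Fin n → ℕ
    codegree v w = length (filter (_∈? Γ w) (Γ v))

    -- Requiring {a , b} to lie on one fixed side makes each 2×2 biclique
    -- appear exactly once; {c , d} is then on the other side.
    IsButterfly : Pred Square 0ℓ
    IsButterfly ((a , b) , (c , d)) =
      side a ≡ false × side b ≡ false ×
      c ∈ Γ a × d ∈ Γ a × c ∈ Γ b × d ∈ Γ b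

    isButterfly? : Decidable IsButterfly
    isButterfly? ((a , b) , (c , d)) =
      (side a Bool.≟ false) ×-dec (side b Bool.≟ false) ×-dec
      (c ∈? Γ a) ×-dec (d ∈? Γ a) ×-dec (c ∈? Γ b) ×-dec (d ∈? Γ b)

    butterflies : List Square
    butterflies =
      filter isButterfly? (cartesianProduct (pairs (allFin n)) (pairs (allFin n)))

    B : ℕ
    B = length butterflies

    p₁w : ℕ
    p₁w = length (filter sharesWedge? (pairs butterflies))

    -- (∧ / B) (1 + p₁w / B)
    spread : ℚ
    spread = ratio wedges B ℚ.* (1ℚ ℚ.+ ratio p₁w B)

-- f · log (1/δ) / ε².  The logarithm is rounded up to an integer and is at
-- least 1; this changes it by at most a factor 2 for δ ≤ 1/2, and gives the
-- usual reading of O(log (1/δ)) when δ is close to 1.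
Õ : (ε δ : ℚ) .{{_ : ℚ.Positive ε}} .{{_ : ℚ.Positive δ}} → ℚ → ℚ
Õ ε δ f = f ℚ.* fromℕ (1 ⊔ ⌈log₂ ∣ ℚ.ceiling 1/δ ∣ ⌉) ℚ.* (1/ε ℚ.* 1/ε)
  where
  1/ε 1/δ : ℚ
  1/ε = (ℚ.1/ ε) {{ℚ.pos⇒nonZero ε}}
  1/δ = (ℚ.1/ δ) {{ℚ.pos⇒nonZero δ}}

------------------------------------------------------------------------
-- Finite probability

data Rand (A : Set) : Set where
  return : A → Rand A
  choose : (k : ℕ) (weight : Fin k → ℚ) → (Fin k → Rand A) → Rand A

infixl 1 _>>=_

_>>=_ : {A A′ : Set} → Rand A → (A → Rand A′) → Rand A′
return a     >>= g = g a
choose k w f >>= g = choose k w (λ i → f i >>= g)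

Pr : {A : Set} {P : Pred A 0ℓ} → Decidable P → Rand A → ℚ
Pr P? (return a)     = if does (P? a) then 1ℚ else 0ℚ
Pr P? (choose k w f) = Sum.sum ℚ.+-0-commutativeMonoid (λ i → w i ℚ.* Pr P? (f i))

data _outcomeOf_ {A : Set} (a : A) : Rand A → Set where
  here   : a outcomeOf return a
  branch : ∀ {k w f} (i : Fin k) → a outcomeOf f i → a outcomeOf choose k w f

uniform : {A : Set} → List A → Rand A
uniform xs = choose (length xs) (λ _ → ratio 1 (length xs)) (λ i → return (lookup xs i))

IsEstimator : (ε δ Z : ℚ) → Rand ℚ → Set
IsEstimator ε δ Z Ẑ = Pr (λ z → ε ℚ.* Z ℚ.<? ℚ.∣ z ℚ.- Z ∣) Ẑ ℚ.≤ δ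

WSamp : ∀ {n} → BipartiteGraph n → Rand ℚ
WSamp {n} G =
  choose n (λ u → ratio (degree G u C 2) (wedges G)) λ u →
  uniform (pairs (Γ u)) >>= λ (v , w) →
  return (ratio ((codegree G v w ∸ 1) * wedges G) 4)
  where open BipartiteGraph G

------------------------------------------------------------------------
-- Randomised RAM programs

-- Programs have random-access memory of natural-number words, initially 0,
-- and a read-only input consisting of rows of words.  `while g upto b run c`
-- runs c as long as g is nonzero, but at most b times (b is evaluated on
-- entry), so every program terminates.

data Op : Set where
  add sub mul div mod lt eq : Op

data Expr : Set where
  lit    : ℕ → Expr
  load   : Expr → Expr
  input  : Expr → Expr → Expr
  binary : Op → Expr → Expr → Expr

infix  5 _≔_
infixr 4 _⨾_

data Cmd (Effect : Set) : Set where
  skip               : Cmd Effect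
  _≔_                : Expr → Expr → Cmd Effect
  _⨾_                : Cmd Effect → Cmd Effect → Cmd Effect
  when_then_else_    : Expr → Cmd Effect → Cmd Effect → Cmd Effect
  while_upto_run_    : Expr → Expr → Cmd Effect → Cmd Effect
  effect             : Effect → Cmd Effect

Input : Set
Input = List (List ℕ)

Memory : Set
Memory = ℕ → ℕ

blank : Memory
blank _ = 0

_[_↦_] : Memory → ℕ → ℕ → Memory
(m [ a ↦ x ]) b = if a ≡ᵇ b then x else m b

nth : {A : Set} → A → List A → ℕ → A
nth z []       _       = z
nth z (x ∷ _)  zero    = x
nth z (_ ∷ xs) (suc i) = nth z xs i

apply : Op → ℕ → ℕ → ℕ
apply add x y       = x + y
apply sub x y       = x ∸ y
apply mul x y       = x * y
apply div x zero    = 0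
apply div x (suc y) = x ℕ./ suc y
apply mod x zero    = 0
apply mod x (suc y) = x ℕ.% suc y
apply lt  x y       = if x <ᵇ y then 1 else 0
apply eq  x y       = if x ≡ᵇ y then 1 else 0

eval : Input → Memory → Expr → ℕ
eval I m (lit k)        = k
eval I m (load e)       = m (eval I m e)
eval I m (input r c)    = nth 0 (nth [] I (eval I m r)) (eval I m c)
eval I m (binary o d e) = apply o (eval I m d) (eval I m e)

size : Expr → ℕ
size (lit _)        = 1
size (load e)       = 1 + size e
size (input r c)    = 1 + size r + size c
size (binary _ d e) = 1 + size d + size e

-- `cells` bounds the addresses written and `word` the values written.
record Usage : Set where
  constructor usage
  field
    time calls cells word : ℕ

open Usage public

_⊕_ : Usage → Usage → Usage
usage t k c w ⊕ usage t′ k′ c′ w′ = usage (t + t′) (k + k′) (c ⊔ c′) (w ⊔ w′)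

steps : ℕ → Usage
steps t = usage t 0 0 0

write : (address value : ℕ) → Usage
write a x = usage 1 0 (suc a) x

Run : Set → Set
Run S = Rand (S × Usage)

charge : {S : Set} → Usage → Run S → Run S
charge u r = r >>= λ (s , v) → return (s , u ⊕ v)

infixl 1 _▹_

_▹_ : {S T : Set} → Run S → (S → Run T) → Run T
r ▹ k = r >>= λ (s , u) → charge u (k s)

-- X is whatever part of the state only effects can access.
module _ {Effect X : Set} (I : Input)
         (perform : Effect → Memory × X → Run (Memory × X)) where

  iterate : Expr → (Memory × X → Run (Memory × X)) → ℕ → Memory × X → Run (Memory × X)
  iterate g body zero    s = return (s , steps 0)
  iterate g body (suc k) s = charge (steps (1 + size g))
    (if eval I (proj₁ s) g ≡ᵇ 0
     then return (s , steps 0)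
     else (body s ▹ iterate g body k))

  exec : Cmd Effect → Memory × X → Run (Memory × X)
  exec skip    s       = return (s , steps 0)
  exec (d ≔ e) (m , x) =
    return ((m [ eval I m d ↦ eval I m e ] , x) ,
            (steps (size d + size e) ⊕ write (eval I m d) (eval I m e)))
  exec (c ⨾ c′) s = exec c s ▹ exec c′
  exec (when g then c else c′) s = charge (steps (1 + size g))
    (if eval I (proj₁ s) g ≡ᵇ 0 then exec c′ s else exec c s)
  exec (while g upto b run c) s = charge (steps (1 + size b))
    (iterate g (exec c) (eval I (proj₁ s) b) s)
  exec (effect f) s = perform f s

-- The only effect of programs with access to the graph: store at a given
-- address a uniformly random number below a given bound (0 if the bound is 0).
data Draw : Set where
  draw_below_ : Expr → Expr → Draw

uniformBelow : ℕ → Rand ℕ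
uniformBelow zero    = return 0
uniformBelow (suc k) = choose (suc k) (λ _ → ratio 1 (suc k)) (λ i → return (toℕ i))

performDraw : Input → Draw → Memory × ⊤ → Run (Memory × ⊤)
performDraw I (draw d below e) (m , _) = uniformBelow (eval I m e) >>= λ x →
  return ((m [ eval I m d ↦ x ] , tt) , (steps (size d + size e) ⊕ write (eval I m d) x))

execDraw : Input → Cmd Draw → Memory → Run Memory
execDraw I c m = exec I (performDraw I) c (m , tt) >>= λ ((m′ , _) , u) → return (m′ , u)

-- The only effect of programs without access to the graph: run a fixed
-- sampling program on its own memory and store, at a given address, the
-- number it leaves in cell 0.
data Call : Set where
  call : Expr → Call

performCall : Input → (Memory → Run Memory) → Call → Memory × Memory → Run (Memory × Memory)
performCall I sampler (call d) (m , bank) = sampler bank >>= λ (bank′ , u) →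
  return ((m [ eval I m d ↦ bank′ 0 ] , bank′) ,
          (u ⊕ (usage (size d) 1 0 0 ⊕ write (eval I m d) (bank′ 0))))

execCall : Input → (Memory → Run Memory) → Cmd Call → Memory × Memory → Run (Memory × Memory)
execCall I sampler = exec I (performCall I sampler)

------------------------------------------------------------------------
-- Algorithms that estimate by iterating WSamp

-- `main` reaches the graph and randomness only by calling `wsamp`, which
-- shares its memory with `setup` and not with `main`.
record Algorithm : Set where
  field
    setup : Cmd Draw
    wsamp : Cmd Draw
    main  : Cmd Call

-- Row 0 holds n; row 1 + v holds the degree and then the neighbours of v.
storedGraph : ∀ {n} → BipartiteGraph n → Input
storedGraph {n} G =
  (n ∷ []) ∷ map (λ v → degree G v ∷ map toℕ (BipartiteGraph.Γ G v)) (allFin n)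

numerator : ℚ → ℕ
numerator q = ∣ ℚ.↥ q ∣

parameters : (n M : ℕ) (ε δ : ℚ) → Input
parameters n M ε δ =
  (n ∷ M ∷ numerator ε ∷ ℚ.↧ₙ ε ∷ numerator δ ∷ ℚ.↧ₙ δ ∷ []) ∷ []

record Outcome : Set where
  constructor outcome
  field
    estimate  : ℚ
    setupCost : Usage
    mainCost  : Usage

open Outcome public

module _ (𝒜 : Algorithm) {n : ℕ} (G : BipartiteGraph n) where

  open Algorithm 𝒜

  prepare : Run Memory
  prepare = execDraw (storedGraph G) setup blank

  sample : Memory → Run Memory
  sample = execDraw (storedGraph G) wsamp

  data Reachable : Memory → Set where
    prepared : ∀ {m u} → (m , u) outcomeOf prepare → Reachable m
    sampled  : ∀ {m m′ u} → Reachable m → (m′ , u) outcomeOf sample m → Reachable m′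

  -- Each call of `wsamp`, whatever happened before it, is one iteration of
  -- WSamp.  WSamp returns multiples of 1/4, and words are natural numbers, so
  -- cell 0 holds the returned value in quarters.
  ImplementsWSamp : Set
  ImplementsWSamp = ∀ {m} → Reachable m → ∀ (x : ℚ) →
    Pr (λ (m′ , _) → ratio (m′ 0) 4 ℚ.≟ x) (sample m) ≡ Pr (ℚ._≟ x) (WSamp G)

  -- The estimate is cell 0 of main divided by cell 1.
  execution : (M : ℕ) (ε δ : ℚ) → Rand Outcome
  execution M ε δ =
    prepare >>= λ (bank , u) →
    execCall (parameters n M ε δ) sample main (blank , bank) >>= λ ((m , _) , v) →
    return (outcome (ratio (m 0) (m 1)) u v)

  estimator : (M : ℕ) (ε δ : ℚ) → Rand ℚ
  estimator M ε δ = execution M ε δ >>= λ o → return (estimate o)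

{-# OPTIONS --safe #-}
-- One iteration of WSamp returns a quarter of ∧ β for a uniformly random wedge,
-- where β counts the other butterflies on it.  If k is the codegree of the ends
-- of a wedge then β = k − 1, and each pair of vertices is the pair of ends of k
-- wedges; hence the sum of β is Σ k (k − 1) = 4 B and that of β² is
-- Σ k (k − 1)² ≤ 4 B + 2 p₁w, the cubic part counting pairs of butterflies that
-- share a wedge.
--
-- A median of log (1/δ) group means would not fit into O(n) words, so the mean
-- is truncated instead.  One pass over the samples accumulates, for every j, the
-- sum S j of the samples truncated at 2 ^ j.  The exponential moments of a
-- truncated sample (with base 1 ± 1/D, so that everything is rational) bound
-- the lower tail of S a and the upper tail of S (3 + a), where 2 ^ a is of the
-- order of M B / ε.  When neither tail occurs, the first level j at which 2 ^ j
-- exceeds a multiple of M S j / (ε N) lies between a and 3 + a, or it is a level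
-- beyond which truncation has no effect; since S is monotone, S j is then
-- accurate as well.  So B need not be known for choosing the level.
module Submission where

open import Defs
import Algebra.Properties.CommutativeMonoid.Sum as Sum
import Algebra.Properties.Semiring.Sum as SemiringSum
open import Algebra.Bundles using (CommutativeRing)
open import Data.Bool.Base using (Bool; true; false; if_then_else_; T)
import Data.Bool.Properties as Bool
open import Data.Empty using (⊥; ⊥-elim)
open import Data.Fin.Base using (Fin; zero; suc; toℕ; fromℕ<)
import Data.Fin.Properties as Fin
open import Data.Integer.Base as ℤ using (-[1+_]; +[1+_]; ∣_∣)
import Data.Integer.Properties as ℤ
open import Data.List.Base
  using (List; []; _∷_; _++_; map; filter; length; lookup; tabulate; allFin; cartesianProduct; concat; concatMap; foldr)
open import Data.List.Membership.Propositional using (_∈_; _∉_)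
import Data.List.Membership.DecPropositional as DecMembership
open import Data.List.Membership.Propositional.Properties
open import Data.List.Properties
  using (map-++; map-cong; map-∘; map-tabulate; length-++; length-map; length-tabulate; tabulate-lookup)
open import Data.List.Relation.Unary.All as All using ([]; _∷_)
open import Data.List.Relation.Unary.AllPairs using ([]; _∷_)
open import Data.List.Relation.Unary.Any using (here; there)
open import Data.List.Relation.Unary.Unique.Propositional using (Unique)
import Data.List.Relation.Unary.Unique.Propositional.Properties as Unique
open import Data.Nat.Base
open import Data.Nat.Combinatorics using (_C_; nCk+nC[k+1]≡[n+1]C[k+1]; nC1≡n)
open import Data.Nat.Coprimality using (1-coprimeTo) renaming (sym to coprime-sym)
open import Data.Nat.DivMod using (m*n/n≡m; m/n*n≤m; m/n≤m; m≡m%n+[m/n]*n; m%n<n)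
open import Data.Nat.Induction using (<-rec)
open import Data.Nat.ListAction using (sum)
open import Data.Nat.ListAction.Properties using (sum-++)
open import Data.Nat.Logarithm
open import Data.Nat.Properties
open import Data.Nat.Tactic.RingSolver using (solve-∀)
open import Data.Product.Base using (Σ-syntax; ∃; _×_; _,_; proj₁; proj₂)
import Data.Product.Properties as Product
open import Data.Rational.Base as ℚ using (ℚ; 0ℚ; 1ℚ; mkℚ; toℚᵘ)
import Data.Rational.Properties as ℚ
import Data.Rational.Solver as ℚSolver
open import Data.Rational.Unnormalised.Base as ℚᵘ using (mkℚᵘ; *≡*; *≤*)
import Data.Rational.Unnormalised.Properties as ℚᵘ
open import Data.Sum.Base using (_⊎_; inj₁; inj₂)
open import Data.Unit.Base using (⊤; tt)
open import Function.Base using (_∘_; id)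
open import Level using (0ℓ)
open import Relation.Binary.Definitions using (DecidableEquality)
open import Relation.Binary.PropositionalEquality hiding (J)
open import Relation.Nullary using (Dec; yes; no; ¬_; does)
open import Relation.Nullary.Decidable using (_×-dec_; _⊎-dec_; dec-true; dec-false; decidable-stable)
open import Relation.Nullary.Negation using (contradiction)
open import Relation.Unary using (Pred; Decidable)

-- Finite sums over lists

-- A sample in quarters has mean 4 B and, by the second moment and the choice of M, mean square at
-- most 4 M B². Cutting it off at θ therefore lowers its mean by at most 4 M B² / θ, which is ε B
-- for θ = 4 M B / ε. Samples bounded by θ allow a Chernoff bound whose exponent is of the order N ε
-- B / θ = N ε² / (4 M), so N of the order M log (1/δ) / ε² suffices, as it would for a median of
-- means. The obstacle is that θ involves the unknown B, while the sum that depends on θ is the only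
-- estimate of B at hand. Concentration is proved at two levels only, so no union bound over all
-- levels enters, which would cost a factor log log n. No sample exceeds n ∧ ≤ n⁴, so there are at
-- most 2 + 4 log n sums. The random draws of the program are coupled, branch by branch, with
-- independent uniform indices of wedges (`drawsFrom`); all probability is computed there, and the
-- deterministic code between the draws is verified on its own.

∑ : {A : Set} → List A → (A → ℕ) → ℕ
∑ xs f = sum (map f xs)

𝟙 : {P : Set} → Dec P → ℕ
𝟙 P? = if does P? then 1 else 0

𝟙-yes : {P : Set} (P? : Dec P) → P → 𝟙 P? ≡ 1
𝟙-yes P? p rewrite dec-true P? p = refl

𝟙-no : {P : Set} (P? : Dec P) → ¬ P → 𝟙 P? ≡ 0
𝟙-no P? ¬p rewrite dec-false P? ¬p = refl

𝟙-×-dec : {P Q : Set} (P? : Dec P) (Q? : Dec Q) → 𝟙 (P? ×-dec Q?) ≡ 𝟙 P? * 𝟙 Q?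
𝟙-×-dec P? Q? with does P? | does Q?
... | false | _     = refl
... | true  | false = refl
... | true  | true  = refl

𝟙-idem : {P : Set} (P? : Dec P) → 𝟙 P? * 𝟙 P? ≡ 𝟙 P?
𝟙-idem P? with does P?
... | false = refl
... | true  = refl

𝟙-⇔ : {P Q : Set} (P? : Dec P) (Q? : Dec Q) → (P → Q) → (Q → P) → 𝟙 P? ≡ 𝟙 Q?
𝟙-⇔ (yes p) Q? f g = sym (𝟙-yes Q? (f p))
𝟙-⇔ (no ¬p) Q? f g = sym (𝟙-no Q? (¬p ∘ g))

module _ {A : Set} where

  ∑-cong : ∀ {f g : A → ℕ} xs → (∀ x → f x ≡ g x) → ∑ xs f ≡ ∑ xs g
  ∑-cong xs f≗g = cong sum (map-cong f≗g xs)

  ∑-mono∈ : ∀ {f g : A → ℕ} xs → (∀ {x} → x ∈ xs → f x ≤ g x) → ∑ xs f ≤ ∑ xs g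
  ∑-mono∈ []       f≤g = z≤n
  ∑-mono∈ (x ∷ xs) f≤g = +-mono-≤ (f≤g (here refl)) (∑-mono∈ xs (f≤g ∘ there))

  ∑-mono : ∀ {f g : A → ℕ} xs → (∀ x → f x ≤ g x) → ∑ xs f ≤ ∑ xs g
  ∑-mono xs f≤g = ∑-mono∈ xs (λ {x} _ → f≤g x)

  ∑-cong∈ : ∀ {f g : A → ℕ} xs → (∀ {x} → x ∈ xs → f x ≡ g x) → ∑ xs f ≡ ∑ xs g
  ∑-cong∈ []       f≗g = refl
  ∑-cong∈ (x ∷ xs) f≗g = cong₂ _+_ (f≗g (here refl)) (∑-cong∈ xs (f≗g ∘ there))

  ∑-++ : ∀ (f : A → ℕ) xs ys → ∑ (xs ++ ys) f ≡ ∑ xs f + ∑ ys f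
  ∑-++ f xs ys = trans (cong sum (map-++ f xs ys)) (sum-++ (map f xs) (map f ys))

  ∑-0 : ∀ (xs : List A) → ∑ xs (λ _ → 0) ≡ 0
  ∑-0 []       = refl
  ∑-0 (x ∷ xs) = ∑-0 xs

  ∑-+ : ∀ (f g : A → ℕ) xs → ∑ xs (λ x → f x + g x) ≡ ∑ xs f + ∑ xs g
  ∑-+ f g []       = refl
  ∑-+ f g (x ∷ xs) rewrite ∑-+ f g xs = lemma (f x) (g x) (∑ xs f) (∑ xs g)
    where
    lemma : ∀ a b c d → a + b + (c + d) ≡ a + c + (b + d)
    lemma = solve-∀

  ∑-*ˡ : ∀ c (f : A → ℕ) xs → ∑ xs (λ x → c * f x) ≡ c * ∑ xs f
  ∑-*ˡ c f []       = sym (*-zeroʳ c)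
  ∑-*ˡ c f (x ∷ xs) rewrite ∑-*ˡ c f xs = sym (*-distribˡ-+ c (f x) (∑ xs f))

  ∑-*ʳ : ∀ c (f : A → ℕ) xs → ∑ xs (λ x → f x * c) ≡ ∑ xs f * c
  ∑-*ʳ c f xs = trans (∑-cong xs (λ x → *-comm (f x) c)) (trans (∑-*ˡ c f xs) (*-comm c (∑ xs f)))

  ∑-const : ∀ c (xs : List A) → ∑ xs (λ _ → c) ≡ length xs * c
  ∑-const c []       = refl
  ∑-const c (x ∷ xs) = cong (c +_) (∑-const c xs)

  ∑-filter : ∀ {P : Pred A 0ℓ} (P? : Decidable P) (f : A → ℕ) xs →
             ∑ (filter P? xs) f ≡ ∑ xs (λ x → 𝟙 (P? x) * f x)
  ∑-filter P? f []       = refl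
  ∑-filter P? f (x ∷ xs) with does (P? x)
  ... | true  = cong₂ _+_ (sym (+-identityʳ (f x))) (∑-filter P? f xs)
  ... | false = ∑-filter P? f xs

  length-filter : ∀ {P : Pred A 0ℓ} (P? : Decidable P) xs →
                  length (filter P? xs) ≡ ∑ xs (𝟙 ∘ P?)
  length-filter P? []       = refl
  length-filter P? (x ∷ xs) with does (P? x)
  ... | true  = cong suc (length-filter P? xs)
  ... | false = length-filter P? xs

module _ {A A′ : Set} where

  ∑-map : ∀ (f : A′ → ℕ) (g : A → A′) xs → ∑ (map g xs) f ≡ ∑ xs (f ∘ g)
  ∑-map f g xs = cong sum (sym (map-∘ xs))

  ∑-concatMap : ∀ (f : A′ → ℕ) (g : A → List A′) xs → ∑ (concatMap g xs) f ≡ ∑ xs (λ x → ∑ (g x) f)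
  ∑-concatMap f g []       = refl
  ∑-concatMap f g (x ∷ xs) =
    trans (∑-++ f (g x) (concatMap g xs)) (cong (∑ (g x) f +_) (∑-concatMap f g xs))

  ∑-swap : ∀ (f : A → A′ → ℕ) xs ys →
           ∑ xs (λ x → ∑ ys (f x)) ≡ ∑ ys (λ y → ∑ xs (λ x → f x y))
  ∑-swap f []       ys = sym (∑-0 ys)
  ∑-swap f (x ∷ xs) ys = trans (cong (∑ ys (f x) +_) (∑-swap f xs ys)) (sym (∑-+ (f x) _ ys))

∑-cartesianProduct : ∀ {A A′ : Set} (f : A × A′ → ℕ) xs ys →
                     ∑ (cartesianProduct xs ys) f ≡ ∑ xs (λ x → ∑ ys (λ y → f (x , y)))
∑-cartesianProduct f []       ys = refl
∑-cartesianProduct f (x ∷ xs) ys =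
  trans (∑-++ f (map (x ,_) ys) (cartesianProduct xs ys))
        (cong₂ _+_ (∑-map f (x ,_) ys) (∑-cartesianProduct f xs ys))

module _ {A : Set} where

  ∑-pairs-filter : ∀ {P : Pred A 0ℓ} (P? : Decidable P) (f : A × A → ℕ) xs →
    ∑ (pairs (filter P? xs)) f ≡
    ∑ (pairs xs) (λ (x , y) → 𝟙 (P? x) * 𝟙 (P? y) * f (x , y))
  ∑-pairs-filter P? f []       = refl
  ∑-pairs-filter P? f (x ∷ xs)
    rewrite ∑-++ (λ (x , y) → 𝟙 (P? x) * 𝟙 (P? y) * f (x , y)) (map (x ,_) xs) (pairs xs)
          | ∑-map (λ (x , y) → 𝟙 (P? x) * 𝟙 (P? y) * f (x , y)) (x ,_) xs
    with does (P? x)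
  ... | false rewrite ∑-0 xs = ∑-pairs-filter P? f xs
  ... | true  =
    trans (∑-++ f (map (x ,_) (filter P? xs)) (pairs (filter P? xs)))
      (cong₂ _+_
        (trans (∑-map f (x ,_) (filter P? xs))
          (trans (∑-filter P? (λ y → f (x , y)) xs)
            (∑-cong xs (λ y → cong (_* f (x , y)) (sym (+-identityʳ (𝟙 (P? y))))))))
        (∑-pairs-filter P? f xs))

  -- For symmetric `f` the sum over unordered pairs does not depend on the order of the list. This
  -- makes `pairs (Γ u)`, which follows the arbitrary order of an adjacency list, comparable with
  -- `pairs` of all vertices.
  ∑-pairs-symmetric : ∀ (f : A → A → ℕ) → (∀ x y → f x y ≡ f y x) → ∀ xs →
    2 * ∑ (pairs xs) (λ (x , y) → f x y) + ∑ xs (λ x → f x x) ≡ ∑ xs (λ x → ∑ xs (f x))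
  ∑-pairs-symmetric f sym-f []       = refl
  ∑-pairs-symmetric f sym-f (x ∷ xs)
    rewrite ∑-++ (λ (x , y) → f x y) (map (x ,_) xs) (pairs xs)
          | ∑-map (λ (x , y) → f x y) (x ,_) xs
          | ∑-+ (λ z → f z x) (λ z → ∑ xs (f z)) xs
          | sym (∑-pairs-symmetric f sym-f xs)
          | ∑-cong xs (λ z → sym-f z x)
    = lemma (∑ xs (f x)) (∑ (pairs xs) (λ (x , y) → f x y)) (f x x) (∑ xs (λ z → f z z))
    where
    lemma : ∀ a b c d → 2 * (a + b) + (c + d) ≡ c + a + (a + (2 * b + d))
    lemma = solve-∀

  module _ (_≟ᴬ_ : DecidableEquality A) where

    -- An inequality, so that the list may have repetitions; `∑-diagonal` applies it to lists of
    -- pairs.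
    f≤∑-𝟙 : ∀ (f : A → ℕ) {y xs} → y ∈ xs → f y ≤ ∑ xs (λ x → 𝟙 (y ≟ᴬ x) * f x)
    f≤∑-𝟙 f {y} (here refl) rewrite 𝟙-yes (y ≟ᴬ y) refl | +-identityʳ (f y) = m≤m+n (f y) _
    f≤∑-𝟙 f (there y∈xs) = m≤n⇒m≤o+n _ (f≤∑-𝟙 f y∈xs)

    ∑-𝟙-∉ : ∀ (f : A → ℕ) {y xs} → y ∉ xs → ∑ xs (λ x → 𝟙 (y ≟ᴬ x) * f x) ≡ 0
    ∑-𝟙-∉ f {y} {[]}     y∉ = refl
    ∑-𝟙-∉ f {y} {x ∷ xs} y∉ rewrite 𝟙-no (y ≟ᴬ x) (y∉ ∘ here) = ∑-𝟙-∉ f (y∉ ∘ there)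

    ∑-𝟙 : ∀ (f : A → ℕ) {y xs} → Unique xs → y ∈ xs → ∑ xs (λ x → 𝟙 (y ≟ᴬ x) * f x) ≡ f y
    ∑-𝟙 f {y} u@(_ ∷ _) (here refl)
      rewrite 𝟙-yes (y ≟ᴬ y) refl | ∑-𝟙-∉ f (Unique.Unique[x∷xs]⇒x∉xs u) =
      trans (+-identityʳ _) (+-identityʳ (f y))
    ∑-𝟙 f {y} {x ∷ xs} (x≢ ∷ u) (there y∈xs)
      rewrite 𝟙-no (y ≟ᴬ x) (λ y≡x → All.lookup x≢ y∈xs (sym y≡x)) = ∑-𝟙 f u y∈xs

-- Pairs

-- The binomial coefficient k over 2, by the recursion of `pairs`: the head of a list forms a pair
-- with every later element.
tri : ℕ → ℕ
tri zero    = 0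
tri (suc k) = k + tri k

tri≡C2 : ∀ k → k C 2 ≡ tri k
tri≡C2 zero    = refl
tri≡C2 (suc k) =
  trans (sym (nCk+nC[k+1]≡[n+1]C[k+1] k 1)) (cong₂ _+_ (nC1≡n k) (tri≡C2 k))

2*tri : ∀ k → 2 * tri k ≡ k * (k ∸ 1)
2*tri zero          = refl
2*tri (suc zero)    = refl
2*tri (suc (suc k)) = trans (*-distribˡ-+ 2 (suc k) (tri (suc k)))
  (trans (cong (2 * suc k +_) (2*tri (suc k))) (lemma k))
  where
  lemma : ∀ k → 2 * suc k + suc k * k ≡ suc (suc k) * suc k
  lemma = solve-∀

tri-≤ : ∀ k → tri k ≤ k * k
tri-≤ k = ≤-trans (m≤n*m (tri k) 2) (≤-trans (≤-reflexive (2*tri k)) (*-monoʳ-≤ k (m∸n≤m k 1)))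

length-pairs : ∀ {A : Set} (xs : List A) → length (pairs xs) ≡ tri (length xs)
length-pairs []       = refl
length-pairs (x ∷ xs) = trans (length-++ (map (x ,_) xs))
  (cong₂ _+_ (length-map (x ,_) xs) (length-pairs xs))

∈-pairs⁻ : ∀ {A : Set} {x y : A} xs → (x , y) ∈ pairs xs → x ∈ xs × y ∈ xs
∈-pairs⁻ (z ∷ zs) p with ∈-++⁻ (map (z ,_) zs) p
... | inj₁ q with ∈-map⁻ (z ,_) q
...   | _ , y∈zs , refl = here refl , there y∈zs
∈-pairs⁻ (z ∷ zs) p | inj₂ q with ∈-pairs⁻ zs q
...   | x∈zs , y∈zs = there x∈zs , there y∈zs

pairs-≢ : ∀ {A : Set} {x y : A} {xs} → Unique xs → (x , y) ∈ pairs xs → x ≢ y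
pairs-≢ {xs = z ∷ zs} (z≢ ∷ u) p with ∈-++⁻ (map (z ,_) zs) p
... | inj₁ q with ∈-map⁻ (z ,_) q
...   | _ , y∈zs , refl = All.lookup z≢ y∈zs
pairs-≢ {xs = z ∷ zs} (z≢ ∷ u) p | inj₂ q = pairs-≢ u q

-- Two-element sets meeting in exactly one element

module Overlap {A : Set} (_≟ᴬ_ : DecidableEquality A) where

  δ e : A → A → ℕ
  δ x y = 𝟙 (x ≟ᴬ y)
  e x y = if does (x ≟ᴬ y) then 0 else 1

  e-≢ : ∀ {x y} → x ≢ y → e x y ≡ 1
  e-≢ {x} {y} x≢y rewrite dec-false (x ≟ᴬ y) x≢y = refl

  e-refl : ∀ x → e x x ≡ 0
  e-refl x rewrite dec-true (x ≟ᴬ x) refl = refl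

  δ-sym : ∀ x y → δ x y ≡ δ y x
  δ-sym x y = 𝟙-⇔ (x ≟ᴬ y) (y ≟ᴬ x) sym sym

  δ+e : ∀ x y → e x y + δ x y * 1 ≡ 1
  δ+e x y with does (x ≟ᴬ y)
  ... | true  = refl
  ... | false = refl

  -- Each summand matches one entry of either pair and requires the other two entries to differ. If
  -- both pairs have distinct entries, at most one summand is 1, so this is the indicator of a
  -- single common element; as a polynomial it can be summed term by term.
  ω : A × A → A × A → ℕ
  ω (c , d) (c′ , d′) = δ c c′ * e d d′ + δ c d′ * e d c′ + δ d c′ * e c d′ + δ d d′ * e c c′

  e-sym : ∀ x y → e x y ≡ e y x
  e-sym x y with x ≟ᴬ y
  ... | yes refl = sym (e-refl x)
  ... | no  x≢y  = sym (e-≢ (x≢y ∘ sym))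

  ω-sym : ∀ P Q → ω P Q ≡ ω Q P
  ω-sym (c , d) (c′ , d′)
    rewrite δ-sym c c′ | δ-sym c d′ | δ-sym d c′ | δ-sym d d′
          | e-sym c c′ | e-sym c d′ | e-sym d c′ | e-sym d d′ =
    lemma (δ c′ c * e d′ d) (δ d′ c * e c′ d) (δ c′ d * e d′ c) (δ d′ d * e c′ c)
    where
    lemma : ∀ a b c d → a + b + c + d ≡ a + c + b + d
    lemma = solve-∀

  ω-refl : ∀ {P} → proj₁ P ≢ proj₂ P → ω P P ≡ 0
  ω-refl {c , d} c≢d
    rewrite 𝟙-no (c ≟ᴬ d) c≢d | 𝟙-no (d ≟ᴬ c) (c≢d ∘ sym) | e-refl c | e-refl d
          | *-zeroʳ (δ c c) | *-zeroʳ (δ d d) = refl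

  _∈₂_ _∉₂_ : A → A × A → Set
  x ∈₂ (c , d) = x ≡ c ⊎ x ≡ d
  x ∉₂ (c , d) = x ≢ c × x ≢ d

  ω-cases : ∀ P Q → proj₁ P ≢ proj₂ P → proj₁ Q ≢ proj₂ Q →
    ω P Q ≡ 0 ⊎
    ω P Q ≡ 1 × (proj₁ P ∈₂ Q × proj₂ P ∉₂ Q ⊎ proj₂ P ∈₂ Q × proj₁ P ∉₂ Q)
  ω-cases (c , d) (c′ , d′) c≢d c′≢d′ with c ≟ᴬ c′ | c ≟ᴬ d′ | d ≟ᴬ c′ | d ≟ᴬ d′
  ... | yes p | yes q | _     | _     = ⊥-elim (c′≢d′ (trans (sym p) q))
  ... | yes p | _     | yes q | _     = ⊥-elim (c≢d (trans p (sym q)))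
  ... | _     | yes p | _     | yes q = ⊥-elim (c≢d (trans p (sym q)))
  ... | _     | _     | yes p | yes q = ⊥-elim (c′≢d′ (trans (sym p) q))
  ... | yes p | no  q | no r  | yes s = inj₁ refl
  ... | yes p | no  q | no r  | no s  = inj₂ (refl , inj₁ (inj₁ p , r , s))
  ... | no p  | yes q | yes r | no s  = inj₁ refl
  ... | no p  | yes q | no r  | no s  = inj₂ (refl , inj₁ (inj₂ q , r , s))
  ... | no p  | no q  | yes r | no s  = inj₂ (refl , inj₂ (inj₁ r , p , q))
  ... | no p  | no q  | no r  | yes s = inj₂ (refl , inj₂ (inj₂ s , p , q))
  ... | no p  | no q  | no r  | no s  = inj₁ refl

  ∑∑e : ∀ {xs} → Unique xs → ∑ xs (λ x → ∑ xs (e x)) + length xs ≡ length xs * length xs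
  ∑∑e {xs} u = begin
    ∑ xs (λ x → ∑ xs (e x)) + length xs
      ≡⟨ cong (∑ xs (λ x → ∑ xs (e x)) +_) (trans (sym (*-identityʳ (length xs))) (sym (∑-const 1 xs))) ⟩
    ∑ xs (λ x → ∑ xs (e x)) + ∑ xs (λ _ → 1)
      ≡⟨ cong (∑ xs (λ x → ∑ xs (e x)) +_) (∑-cong∈ xs (λ x∈ → sym (∑-𝟙 _≟ᴬ_ (λ _ → 1) u x∈))) ⟩
    ∑ xs (λ x → ∑ xs (e x)) + ∑ xs (λ x → ∑ xs (λ y → δ x y * 1))
      ≡⟨ ∑-+ (λ x → ∑ xs (e x)) _ xs ⟨
    ∑ xs (λ x → ∑ xs (e x) + ∑ xs (λ y → δ x y * 1))
      ≡⟨ ∑-cong xs (λ x → trans (sym (∑-+ (e x) _ xs)) (trans (∑-cong xs (δ+e x)) (∑-const 1 xs))) ⟩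
    ∑ xs (λ _ → length xs * 1)
      ≡⟨ ∑-const (length xs * 1) xs ⟩
    length xs * (length xs * 1)
      ≡⟨ cong (length xs *_) (*-identityʳ (length xs)) ⟩
    length xs * length xs ∎
    where open ≡-Reasoning

  Ω : List A → ℕ
  Ω xs = ∑ (pairs xs) (λ P → ∑ (pairs xs) (ω P))

  -- The cubic counts the ordered choices of a shared element and of two further ones. In the
  -- induction, two pairs through the new element `x` overlap in one element when their other ends
  -- differ, which gives `LL`; a pair inside `xs` is met by exactly two pairs through `x`, which
  -- gives `LQ`, counted twice by symmetry.
  Ω-lower : ∀ {xs} → Unique xs → length xs * (length xs ∸ 1) * (length xs ∸ 2) ≤ Ω xs
  Ω-lower {[]}     _ = z≤n
  Ω-lower {x ∷ xs} u@(x≢ ∷ uxs) = begin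
    suc k * k * (k ∸ 1)
      ≤⟨ arith k ⟩
    k * (k ∸ 1) + 2 * (k * (k ∸ 1)) + k * (k ∸ 1) * (k ∸ 2)
      ≤⟨ +-mono-≤ (+-mono-≤ LL (*-monoʳ-≤ 2 LQ)) (Ω-lower uxs) ⟩
    ∑ L (λ P → ∑ L (ω P)) + 2 * ∑ L (λ P → ∑ Q (ω P)) + ∑ Q (λ P → ∑ Q (ω P))
      ≡⟨ split ⟨
    ∑ (L ++ Q) (λ P → ∑ (L ++ Q) (ω P)) ∎
    where
    open ≤-Reasoning
    k = length xs
    L = map (x ,_) xs
    Q = pairs xs

    arith : ∀ k → suc k * k * (k ∸ 1) ≤ k * (k ∸ 1) + 2 * (k * (k ∸ 1)) + k * (k ∸ 1) * (k ∸ 2)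
    arith zero          = z≤n
    arith (suc zero)    = z≤n
    arith (suc (suc k)) = ≤-reflexive (identity k)
      where
      identity : ∀ k → suc (suc (suc k)) * suc (suc k) * suc k ≡
        suc (suc k) * suc k + 2 * (suc (suc k) * suc k) + suc (suc k) * suc k * k
      identity = solve-∀

    lower-LL : ∀ d d′ → e d d′ ≤ ω (x , d) (x , d′)
    lower-LL d d′ rewrite 𝟙-yes (x ≟ᴬ x) refl | +-identityʳ (e d d′) =
      ≤-trans (m≤m+n (e d d′) _) (≤-trans (m≤m+n _ (δ d x * e x d′)) (m≤m+n _ (δ d d′ * e x x)))

    LL : k * (k ∸ 1) ≤ ∑ L (λ P → ∑ L (ω P))
    LL = begin
      k * (k ∸ 1)                                ≡⟨ *-distribˡ-∸ k k 1 ⟩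
      k * k ∸ k * 1                              ≡⟨ cong (k * k ∸_) (*-identityʳ k) ⟩
      k * k ∸ k                                  ≡⟨ cong (_∸ k) (∑∑e uxs) ⟨
      ∑ xs (λ d → ∑ xs (e d)) + k ∸ k            ≡⟨ m+n∸n≡m _ k ⟩
      ∑ xs (λ d → ∑ xs (e d))                    ≤⟨ ∑-mono xs (λ d → ∑-mono xs (lower-LL d)) ⟩
      ∑ xs (λ d → ∑ xs (λ d′ → ω (x , d) (x , d′))) ≡⟨ ∑-cong xs (λ d → sym (∑-map _ (x ,_) xs)) ⟩
      ∑ xs (λ d → ∑ L (ω (x , d)))               ≡⟨ ∑-map _ (x ,_) xs ⟨
      ∑ L (λ P → ∑ L (ω P)) ∎

    lower-LQ : ∀ {c d} → (c , d) ∈ Q → 2 ≤ ∑ xs (λ y → ω (x , y) (c , d))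
    lower-LQ {c} {d} p = begin
      2
        ≡⟨ cong₂ _+_ (∑-𝟙 _≟ᴬ_ (λ _ → 1) uxs c∈) (∑-𝟙 _≟ᴬ_ (λ _ → 1) uxs d∈) ⟨
      ∑ xs (λ y → δ c y * 1) + ∑ xs (λ y → δ d y * 1)
        ≡⟨ ∑-+ (λ y → δ c y * 1) _ xs ⟨
      ∑ xs (λ y → δ c y * 1 + δ d y * 1)
        ≤⟨ ∑-mono xs bound ⟩
      ∑ xs (λ y → ω (x , y) (c , d)) ∎
      where
      c∈ = proj₁ (∈-pairs⁻ xs p)
      d∈ = proj₂ (∈-pairs⁻ xs p)
      bound : ∀ y → δ c y * 1 + δ d y * 1 ≤ ω (x , y) (c , d)
      bound y rewrite e-≢ (All.lookup x≢ c∈) | e-≢ (All.lookup x≢ d∈) | δ-sym c y | δ-sym d y =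
        +-monoˡ-≤ (δ y d * 1) (m≤n+m (δ y c * 1) _)

    LQ : k * (k ∸ 1) ≤ ∑ L (λ P → ∑ Q (ω P))
    LQ = begin
      k * (k ∸ 1)                                ≡⟨ 2*tri k ⟨
      2 * tri k                                  ≡⟨ *-comm 2 (tri k) ⟩
      tri k * 2                                  ≡⟨ cong (_* 2) (length-pairs xs) ⟨
      length Q * 2                               ≡⟨ ∑-const 2 Q ⟨
      ∑ Q (λ _ → 2)                              ≤⟨ ∑-mono∈ Q lower-LQ ⟩
      ∑ Q (λ R → ∑ xs (λ y → ω (x , y) R))       ≡⟨ ∑-swap (λ y R → ω (x , y) R) xs Q ⟨
      ∑ xs (λ y → ∑ Q (ω (x , y)))               ≡⟨ ∑-map _ (x ,_) xs ⟨
      ∑ L (λ P → ∑ Q (ω P)) ∎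

    split : ∑ (L ++ Q) (λ P → ∑ (L ++ Q) (ω P)) ≡
      ∑ L (λ P → ∑ L (ω P)) + 2 * ∑ L (λ P → ∑ Q (ω P)) + ∑ Q (λ P → ∑ Q (ω P))
    split
      rewrite ∑-++ (λ P → ∑ (L ++ Q) (ω P)) L Q
            | ∑-cong L (λ P → ∑-++ (ω P) L Q) | ∑-cong Q (λ P → ∑-++ (ω P) L Q)
            | ∑-+ (λ P → ∑ L (ω P)) (λ P → ∑ Q (ω P)) L
            | ∑-+ (λ P → ∑ L (ω P)) (λ P → ∑ Q (ω P)) Q
            | ∑-swap ω Q L
            | ∑-cong L (λ P → ∑-cong Q (λ R → ω-sym R P)) =
      lemma (∑ L (λ P → ∑ L (ω P))) (∑ L (λ P → ∑ Q (ω P))) (∑ Q (λ P → ∑ Q (ω P)))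
      where
      lemma : ∀ a b c → a + b + (b + c) ≡ a + 2 * b + c
      lemma = solve-∀

-- Moments of the numbers of butterflies containing the wedges

module Moments {n : ℕ} (G : BipartiteGraph n) where

  open BipartiteGraph G
  open DecMembership (Fin._≟_ {n}) using (_∈?_)
  open DecMembership (Product.≡-dec (Fin._≟_ {n}) (Fin._≟_ {n})) using ()
    renaming (_∈?_ to _∈ᴱ?_)
  open Overlap (Fin._≟_ {n})

  private
    V : List (Fin n)
    V = allFin n

    V² : List (Fin n × Fin n)
    V² = pairs V

    _≟²_ : DecidableEquality (Fin n × Fin n)
    _≟²_ = Product.≡-dec Fin._≟_ Fin._≟_

    V²-≢ : ∀ {a b} → (a , b) ∈ V² → a ≢ b
    V²-≢ = pairs-≢ (Unique.allFin⁺ n)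

  adj : Fin n → Fin n → ℕ
  adj u v = 𝟙 (u ∈? Γ v)

  adj-sym : ∀ u v → adj u v ≡ adj v u
  adj-sym u v = 𝟙-⇔ (u ∈? Γ v) (v ∈? Γ u) Γ-sym Γ-sym

  k : Fin n → Fin n → ℕ
  k = codegree G

  -- Sums over adjacency lists become sums over all vertices weighted by indicators, and then the
  -- order of summation can be exchanged.
  ∑-unique : ∀ (f : Fin n → ℕ) {xs} → Unique xs → ∑ xs f ≡ ∑ V (λ x → 𝟙 (x ∈? xs) * f x)
  ∑-unique f {[]}     _ = sym (∑-0 V)
  ∑-unique f {y ∷ ys} u@(_ ∷ uys) = begin
    f y + ∑ ys f
      ≡⟨ cong₂ _+_ (sym (∑-𝟙 Fin._≟_ f (Unique.allFin⁺ n) (∈-allFin y))) (∑-unique f uys) ⟩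
    ∑ V (λ x → 𝟙 (y Fin.≟ x) * f x) + ∑ V (λ x → 𝟙 (x ∈? ys) * f x)
      ≡⟨ ∑-+ (λ x → 𝟙 (y Fin.≟ x) * f x) _ V ⟨
    ∑ V (λ x → 𝟙 (y Fin.≟ x) * f x + 𝟙 (x ∈? ys) * f x)
      ≡⟨ ∑-cong V (λ x → trans (sym (*-distribʳ-+ (f x) (𝟙 (y Fin.≟ x)) _)) (cong (_* f x) (step x))) ⟩
    ∑ V (λ x → 𝟙 (x ∈? (y ∷ ys)) * f x) ∎
    where
    open ≡-Reasoning
    step : ∀ x → 𝟙 (y Fin.≟ x) + 𝟙 (x ∈? ys) ≡ 𝟙 (x ∈? (y ∷ ys))
    step x with y Fin.≟ x
    ... | yes refl = trans (cong suc (𝟙-no (y ∈? ys) (Unique.Unique[x∷xs]⇒x∉xs u)))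
                           (sym (𝟙-yes (y ∈? (y ∷ ys)) (here refl)))
    ... | no y≢x   = 𝟙-⇔ (x ∈? ys) (x ∈? (y ∷ ys)) there λ
      { (here x≡y) → contradiction (sym x≡y) y≢x ; (there x∈) → x∈ }

  ∑-Γ : ∀ v f → ∑ (Γ v) f ≡ ∑ V (λ x → adj x v * f x)
  ∑-Γ v f = ∑-unique f (Γ-unique v)

  k≡∑ : ∀ a b → k a b ≡ ∑ V (λ x → adj x a * adj x b)
  k≡∑ a b = trans (length-filter (_∈? Γ b) (Γ a)) (∑-Γ a _)

  k-sym : ∀ a b → k a b ≡ k b a
  k-sym a b = trans (k≡∑ a b)
    (trans (∑-cong V (λ x → *-comm (adj x a) (adj x b))) (sym (k≡∑ b a)))

  k≤n : ∀ a b → k a b ≤ n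
  k≤n a b = begin
    k a b                                  ≡⟨ k≡∑ a b ⟩
    ∑ V (λ x → adj x a * adj x b)          ≤⟨ ∑-mono V (λ x → *-mono-≤ (𝟙≤1 (x ∈? Γ a)) (𝟙≤1 (x ∈? Γ b))) ⟩
    ∑ V (λ _ → 1)                          ≡⟨ ∑-const 1 V ⟩
    length V * 1                           ≡⟨ trans (*-identityʳ _) (length-allFin n) ⟩
    n ∎
    where
    open ≤-Reasoning
    length-allFin : ∀ n → length (allFin n) ≡ n
    length-allFin n = length-tabulate {n = n} id
    𝟙≤1 : {P : Set} (P? : Dec P) → 𝟙 P? ≤ 1
    𝟙≤1 P? with does P?
    ... | true  = ≤-refl
    ... | false = z≤n

  -- The k a b common neighbours of a and b are the centres of the wedges with
  -- ends a and b.
  ∑-wedges : ∀ (f : Fin n → Fin n → ℕ) → (∀ a b → f a b ≡ f b a) →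
    ∑ V (λ u → ∑ (pairs (Γ u)) (λ (a , b) → f a b)) ≡ ∑ V² (λ (a , b) → k a b * f a b)
  ∑-wedges f f-sym = begin
    ∑ V (λ u → ∑ (pairs (Γ u)) (λ (a , b) → f a b))
      -- `Γ u` and `V` list their pairs in unrelated orders, so both sides are doubled and completed
      -- by the diagonal to full double sums, where the order does not matter.
      ≡⟨ ∑-cong V (λ u → *-cancelˡ-≡ _ _ 2 (+-cancelʳ-≡ (∑ V (λ x → g u x x)) _ _ (local u))) ⟩
    ∑ V (λ u → ∑ V² (λ (a , b) → g u a b))
      ≡⟨ ∑-swap (λ u (a , b) → g u a b) V V² ⟩
    ∑ V² (λ (a , b) → ∑ V (λ u → g u a b))
      ≡⟨ ∑-cong V² (λ (a , b) → trans (∑-*ʳ (f a b) _ V) (cong (_* f a b) (centres a b))) ⟩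
    ∑ V² (λ (a , b) → k a b * f a b) ∎
    where
    open ≡-Reasoning
    g : Fin n → Fin n → Fin n → ℕ
    g u a b = adj a u * adj b u * f a b

    g-sym : ∀ u a b → g u a b ≡ g u b a
    g-sym u a b = cong₂ _*_ (*-comm (adj a u) (adj b u)) (f-sym a b)

    centres : ∀ a b → ∑ V (λ u → adj a u * adj b u) ≡ k a b
    centres a b = trans (∑-cong V (λ u → cong₂ _*_ (adj-sym a u) (adj-sym b u))) (sym (k≡∑ a b))

    local : ∀ u → 2 * ∑ (pairs (Γ u)) (λ (a , b) → f a b) + ∑ V (λ x → g u x x) ≡
                  2 * ∑ V² (λ (a , b) → g u a b) + ∑ V (λ x → g u x x)
    local u = begin
      2 * ∑ (pairs (Γ u)) (λ (a , b) → f a b) + ∑ V (λ x → g u x x)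
        ≡⟨ cong (2 * ∑ (pairs (Γ u)) (λ (a , b) → f a b) +_)
             (trans (∑-cong V (λ x → cong (_* f x x) (𝟙-idem (x ∈? Γ u)))) (sym (∑-Γ u _))) ⟩
      2 * ∑ (pairs (Γ u)) (λ (a , b) → f a b) + ∑ (Γ u) (λ x → f x x)
        ≡⟨ ∑-pairs-symmetric f f-sym (Γ u) ⟩
      ∑ (Γ u) (λ a → ∑ (Γ u) (f a))
        ≡⟨ ∑-Γ u _ ⟩
      ∑ V (λ a → adj a u * ∑ (Γ u) (f a))
        ≡⟨ ∑-cong V (λ a → trans (cong (adj a u *_) (∑-Γ u (f a))) (trans (sym (∑-*ˡ (adj a u) _ V))
             (∑-cong V (λ b → sym (*-assoc (adj a u) (adj b u) (f a b)))))) ⟩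
      ∑ V (λ a → ∑ V (g u a))
        ≡⟨ ∑-pairs-symmetric (g u) (g-sym u) V ⟨
      2 * ∑ V² (λ (a , b) → g u a b) + ∑ V (λ x → g u x x) ∎

  -- Filtered from `V` rather than from `Γ a`, so that its pairs are a sublist of `V²` and
  -- `∑-pairs-filter` applies.
  common : Fin n → Fin n → List (Fin n)
  common a b = filter (λ c → c ∈? Γ a ×-dec c ∈? Γ b) V

  length-common : ∀ a b → length (common a b) ≡ k a b
  length-common a b = trans (length-filter _ V)
    (trans (∑-cong V (λ c → 𝟙-×-dec (c ∈? Γ a) (c ∈? Γ b))) (sym (k≡∑ a b)))

  common-unique : ∀ a b → Unique (common a b)
  common-unique a b = Unique.filter⁺ _ (Unique.allFin⁺ n)

  joined : Fin n × Fin n → Fin n × Fin n → ℕ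
  joined (a , b) (c , d) = adj c a * adj d a * (adj c b * adj d b)

  joined-sym : ∀ P Q → joined P Q ≡ joined Q P
  joined-sym (a , b) (c , d)
    rewrite adj-sym c a | adj-sym d a | adj-sym c b | adj-sym d b =
    lemma (adj a c) (adj a d) (adj b c) (adj b d)
    where
    lemma : ∀ w x y z → w * x * (y * z) ≡ w * y * (x * z)
    lemma = solve-∀

  ∑-joined : ∀ a b (f : Fin n × Fin n → ℕ) →
    ∑ (pairs (common a b)) f ≡ ∑ V² (λ Q → joined (a , b) Q * f Q)
  ∑-joined a b f = trans (∑-pairs-filter _ f V) (∑-cong V² λ { (c , d) → cong (_* f (c , d))
    (trans (cong₂ _*_ (𝟙-×-dec (c ∈? Γ a) (c ∈? Γ b)) (𝟙-×-dec (d ∈? Γ a) (d ∈? Γ b)))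
           (lemma (adj c a) (adj c b) (adj d a) (adj d b))) })
    where
    lemma : ∀ w x y z → w * x * (y * z) ≡ w * y * (x * z)
    lemma = solve-∀

  σ : Bool → Fin n × Fin n → ℕ
  σ s (a , b) = 𝟙 (side a Bool.≟ s) * 𝟙 (side b Bool.≟ s)

  σ-idem : ∀ s P → σ s P * σ s P ≡ σ s P
  σ-idem s (a , b) = trans (lemma (𝟙 (side a Bool.≟ s)) (𝟙 (side b Bool.≟ s)))
    (cong₂ _*_ (𝟙-idem (side a Bool.≟ s)) (𝟙-idem (side b Bool.≟ s)))
    where
    lemma : ∀ x y → x * y * (x * y) ≡ x * x * (y * y)
    lemma = solve-∀

  -- If an edge is missing, both sides vanish; otherwise the four edges force `P` and `Q` onto
  -- opposite sides. This is where bipartiteness lets a butterfly be read from either of its two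
  -- pairs.
  joined-σ : ∀ P Q → σ false P * joined P Q ≡ σ true Q * joined P Q
  joined-σ (a , b) (c , d) with c ∈? Γ a | d ∈? Γ a | c ∈? Γ b | d ∈? Γ b
  ... | no _   | _      | _      | _      = trans (*-zeroʳ (σ false (a , b))) (sym (*-zeroʳ (σ true (c , d))))
  ... | yes _  | no _   | _      | _      = trans (*-zeroʳ (σ false (a , b))) (sym (*-zeroʳ (σ true (c , d))))
  ... | yes _  | yes _  | no _   | _      = trans (*-zeroʳ (σ false (a , b))) (sym (*-zeroʳ (σ true (c , d))))
  ... | yes _  | yes _  | yes _  | no _   = trans (*-zeroʳ (σ false (a , b))) (sym (*-zeroʳ (σ true (c , d))))
  ... | yes ca | yes da | yes cb | yes db =
    cong (_* 1) (cong₂ _*_ (flip (side a) (side c) (Γ-crosses ca)) (flip (side b) (side d) (Γ-crosses db)))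
    where
    flip : ∀ s t → t ≢ s → 𝟙 (s Bool.≟ false) ≡ 𝟙 (t Bool.≟ true)
    flip false false t≢s = contradiction refl t≢s
    flip false true  t≢s = refl
    flip true  false t≢s = refl
    flip true  true  t≢s = contradiction refl t≢s

  -- Two vertices with a common neighbour lie on the same side.
  ∑-by-side : ∀ (f : ℕ → ℕ) → f 0 ≡ 0 →
    ∑ V² (λ (a , b) → f (k a b)) ≡
    ∑ V² (λ P@(a , b) → σ false P * f (k a b)) + ∑ V² (λ P@(a , b) → σ true P * f (k a b))
  ∑-by-side f f0≡0 = trans (∑-cong V² pointwise) (∑-+ (λ P@(a , b) → σ false P * f (k a b)) _ V²)
    where
    no-common : ∀ a b → side a ≢ side b → k a b ≡ 0
    no-common a b a≢b = trans (k≡∑ a b) (trans (∑-cong V zero′) (∑-0 V))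
      where
      three : ∀ {r s t : Bool} → r ≢ s → r ≢ t → s ≡ t
      three {false} {false} {_}     p q = contradiction refl p
      three {false} {true}  {false} p q = contradiction refl q
      three {false} {true}  {true}  p q = refl
      three {true}  {true}  {_}     p q = contradiction refl p
      three {true}  {false} {true}  p q = contradiction refl q
      three {true}  {false} {false} p q = refl
      zero′ : ∀ x → adj x a * adj x b ≡ 0
      zero′ x with x ∈? Γ a | x ∈? Γ b
      ... | no _   | _      = refl
      ... | yes _  | no _   = refl
      ... | yes xa | yes xb = contradiction (three (Γ-crosses xa) (Γ-crosses xb)) a≢b

    pointwise : ∀ P → f (k (proj₁ P) (proj₂ P)) ≡
      σ false P * f (k (proj₁ P) (proj₂ P)) + σ true P * f (k (proj₁ P) (proj₂ P))
    pointwise (a , b) with side a | side b | no-common a b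
    ... | false | false | _  = sym (trans (+-identityʳ _) (+-identityʳ _))
    ... | true  | true  | _  = sym (+-identityʳ _)
    ... | false | true  | k0 = trans (cong f (k0 λ ())) f0≡0
    ... | true  | false | k0 = trans (cong f (k0 λ ())) f0≡0

  isButterfly-𝟙 : ∀ P Q → 𝟙 (isButterfly? G (P , Q)) ≡ σ false P * joined P Q
  isButterfly-𝟙 (a , b) (c , d)
    with does (side a Bool.≟ false) | does (side b Bool.≟ false)
       | does (c ∈? Γ a) | does (d ∈? Γ a) | does (c ∈? Γ b) | does (d ∈? Γ b)
  ... | false | _     | _     | _     | _     | _     = refl
  ... | true  | false | _     | _     | _     | _     = refl
  ... | true  | true  | false | _     | _     | _     = refl
  ... | true  | true  | true  | false | _     | _     = refl
  ... | true  | true  | true  | true  | false | _     = refl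
  ... | true  | true  | true  | true  | true  | false = refl
  ... | true  | true  | true  | true  | true  | true  = refl

  ∑-butterflies : ∀ (f : Square → ℕ) →
    ∑ (butterflies G) f ≡ ∑ V² (λ P → ∑ V² (λ Q → σ false P * joined P Q * f (P , Q)))
  ∑-butterflies f = trans (∑-filter (isButterfly? G) f (cartesianProduct V² V²))
    (trans (∑-cartesianProduct _ V² V²)
           (∑-cong V² (λ P → ∑-cong V² (λ Q → cong (_* f (P , Q)) (isButterfly-𝟙 P Q)))))

  ∑-σ-joined : ∀ s (f : Fin n × Fin n → Fin n × Fin n → ℕ) →
    ∑ V² (λ P → ∑ V² (λ Q → σ s P * joined P Q * f P Q)) ≡
    ∑ V² (λ P@(a , b) → σ s P * ∑ (pairs (common a b)) (f P))
  ∑-σ-joined s f = ∑-cong V² λ P@(a , b) →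
    trans (∑-cong V² (λ Q → *-assoc (σ s P) (joined P Q) (f P Q)))
      (trans (∑-*ˡ (σ s P) _ V²) (cong (σ s P *_) (sym (∑-joined a b (f P)))))

  pairs-common : ∀ a b → ∑ (pairs (common a b)) (λ _ → 1) ≡ tri (k a b)
  pairs-common a b = trans (∑-const 1 (pairs (common a b)))
    (trans (*-identityʳ _) (trans (length-pairs (common a b)) (cong tri (length-common a b))))

  B≡∑false : B G ≡ ∑ V² (λ P@(a , b) → σ false P * tri (k a b))
  B≡∑false = begin
    B G
      ≡⟨ trans (∑-const 1 (butterflies G)) (*-identityʳ _) ⟨
    ∑ (butterflies G) (λ _ → 1)
      ≡⟨ ∑-butterflies (λ _ → 1) ⟩
    ∑ V² (λ P → ∑ V² (λ Q → σ false P * joined P Q * 1))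
      ≡⟨ ∑-σ-joined false (λ _ _ → 1) ⟩
    ∑ V² (λ P@(a , b) → σ false P * ∑ (pairs (common a b)) (λ _ → 1))
      ≡⟨ ∑-cong V² (λ P@(a , b) → cong (σ false P *_) (pairs-common a b)) ⟩
    ∑ V² (λ P@(a , b) → σ false P * tri (k a b)) ∎
    where open ≡-Reasoning

  swap-sides : ∀ (f : Fin n × Fin n → Fin n × Fin n → ℕ) →
    ∑ V² (λ P → ∑ V² (λ Q → σ false P * joined P Q * f P Q)) ≡
    ∑ V² (λ Q → ∑ V² (λ P → σ true Q * joined Q P * f P Q))
  swap-sides f = trans (∑-swap _ V² V²) (∑-cong V² (λ Q → ∑-cong V² (λ P → cong (_* f P Q)
    (trans (joined-σ P Q) (cong (σ true Q *_) (joined-sym P Q))))))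

  -- `IsButterfly` singles out the lower pair of a butterfly. Reading the same butterflies from
  -- their upper pairs gives this second count; the two together account for all pairs of vertices
  -- with common neighbours, hence the factor 4 = 2 · 2 in `∑k[k-1]≡4B`.
  B≡∑true : B G ≡ ∑ V² (λ P@(a , b) → σ true P * tri (k a b))
  B≡∑true = begin
    B G
      ≡⟨ trans (∑-const 1 (butterflies G)) (*-identityʳ _) ⟨
    ∑ (butterflies G) (λ _ → 1)
      ≡⟨ ∑-butterflies (λ _ → 1) ⟩
    ∑ V² (λ P → ∑ V² (λ Q → σ false P * joined P Q * 1))
      ≡⟨ swap-sides (λ _ _ → 1) ⟩
    ∑ V² (λ Q → ∑ V² (λ P → σ true Q * joined Q P * 1))
      ≡⟨ ∑-σ-joined true (λ _ _ → 1) ⟩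
    ∑ V² (λ P@(a , b) → σ true P * ∑ (pairs (common a b)) (λ _ → 1))
      ≡⟨ ∑-cong V² (λ P@(a , b) → cong (σ true P *_) (pairs-common a b)) ⟩
    ∑ V² (λ P@(a , b) → σ true P * tri (k a b)) ∎
    where open ≡-Reasoning

  ∑k[k-1]≡4B : ∑ V² (λ (a , b) → k a b * (k a b ∸ 1)) ≡ 4 * B G
  ∑k[k-1]≡4B = begin
    ∑ V² (λ (a , b) → k a b * (k a b ∸ 1))
      ≡⟨ ∑-cong V² (λ (a , b) → sym (2*tri (k a b))) ⟩
    ∑ V² (λ (a , b) → 2 * tri (k a b))
      ≡⟨ ∑-*ˡ 2 _ V² ⟩
    2 * ∑ V² (λ (a , b) → tri (k a b))
      ≡⟨ cong (2 *_) (∑-by-side tri refl) ⟩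
    2 * (∑ V² (λ P@(a , b) → σ false P * tri (k a b)) + ∑ V² (λ P@(a , b) → σ true P * tri (k a b)))
      ≡⟨ cong₂ (λ x y → 2 * (x + y)) (sym B≡∑false) (sym B≡∑true) ⟩
    2 * (B G + B G)
      ≡⟨ lemma (B G) ⟩
    4 * B G ∎
    where
    open ≡-Reasoning
    lemma : ∀ x → 2 * (x + x) ≡ 4 * x
    lemma = solve-∀

  cubic : ℕ → ℕ
  cubic x = x * (x ∸ 1) * (x ∸ 2)

  cubic≤Ω : ∀ a b → cubic (k a b) ≤ Ω (common a b)
  cubic≤Ω a b = subst (λ x → cubic x ≤ Ω (common a b)) (length-common a b) (Ω-lower (common-unique a b))

  -- Counts the ways in which two butterflies agree on one side and overlap in
  -- one vertex on the other.
  J₁ J₂ J : Square → Square → ℕ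
  J₁ (P , Q) (P′ , Q′) = 𝟙 (P ≟² P′) * ω Q Q′
  J₂ (P , Q) (P′ , Q′) = 𝟙 (Q ≟² Q′) * ω P P′
  J s t = J₁ s t + J₂ s t

  J-sym : ∀ s t → J s t ≡ J t s
  J-sym (P , Q) (P′ , Q′) = cong₂ _+_
    (cong₂ _*_ (𝟙-⇔ (P ≟² P′) (P′ ≟² P) sym sym) (ω-sym Q Q′))
    (cong₂ _*_ (𝟙-⇔ (Q ≟² Q′) (Q′ ≟² Q) sym sym) (ω-sym P P′))

  private
    count : ∀ {A : Set} {P : Pred A 0ℓ} (P? : Decidable P) x y z w →
      length (filter P? (x ∷ y ∷ z ∷ w ∷ [])) ≡ 𝟙 (P? x) + (𝟙 (P? y) + (𝟙 (P? z) + (𝟙 (P? w) + 0)))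
    count P? x y z w = length-filter P? (x ∷ y ∷ z ∷ w ∷ [])

    infix 4 _∉₄_
    _∉₄_ : ∀ {A : Set} → A → A × A × A × A → Set
    x ∉₄ (a , b , c , d) = x ≢ a × x ≢ b × x ≢ c × x ≢ d

    ∉₄⇒∉ : ∀ {A : Set} {x a b c d : A} → x ∉₄ (a , b , c , d) → x ∉ a ∷ b ∷ c ∷ d ∷ []
    ∉₄⇒∉ (p , q , r , s) (here e) = p e
    ∉₄⇒∉ (p , q , r , s) (there (here e)) = q e
    ∉₄⇒∉ (p , q , r , s) (there (there (here e))) = r e
    ∉₄⇒∉ (p , q , r , s) (there (there (there (here e)))) = s e

  Lower Upper : Fin n → Set
  Lower v = side v ≡ false
  Upper v = side v ≡ true

  L≢U : ∀ {x y} → Lower x → Upper y → x ≢ y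
  L≢U lx uy refl with trans (sym lx) uy
  ... | ()

  Valid : Square → Set
  Valid ((a , b) , (c , d)) = (a ≢ b × c ≢ d) × (Lower a × Lower b) × (Upper c × Upper d)

  butterflies-valid : ∀ {s} → s ∈ butterflies G → Valid s
  butterflies-valid {(a , b) , (c , d)} s∈
    with ∈-filter⁻ (isButterfly? G) {xs = cartesianProduct V² V²} s∈
  ... | s∈V⁴ , (la , lb , ca , da , _) with ∈-cartesianProduct⁻ V² V² s∈V⁴
  ...   | P∈ , Q∈ = (V²-≢ P∈ , V²-≢ Q∈) , (la , lb) , (opposite la ca , opposite la da)
    where
    opposite : ∀ {u v} → Lower u → v ∈ Γ u → Upper v
    opposite {u} {v} lu v∈ with side v in eq
    ... | true  = refl
    ... | false = contradiction (trans eq (sym lu)) (Γ-crosses v∈)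

  -- The shared wedge has the common upper vertex as its centre and the two vertices of `P` as its
  -- ends. The remaining vertex of `Q` lies outside the other butterfly, and so do its two edges.
  shares-top : ∀ {P Q Q′} → Valid (P , Q) →
    proj₁ Q ∈₂ Q′ × proj₂ Q ∉₂ Q′ ⊎ proj₂ Q ∈₂ Q′ × proj₁ Q ∉₂ Q′ →
    SharesWedge ((P , Q) , (P , Q′))
  shares-top {a , b} {c , d} {c′ , d′} (_ , (la , lb) , (uc , ud)) (inj₁ (c∈ , d≢c′ , d≢d′)) = vs , es
    where
    t = (a , b) , (c′ , d′)
    inV : c ∈₂ (c′ , d′) → c ∈ vertices t
    inV (inj₁ e) = there (there (here e))
    inV (inj₂ e) = there (there (there (here e)))
    inE : ∀ {x} → x ∈₂ (a , b) → c ∈₂ (c′ , d′) → (x , c) ∈ edges t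
    inE (inj₁ refl) (inj₁ refl) = here refl
    inE (inj₁ refl) (inj₂ refl) = there (here refl)
    inE (inj₂ refl) (inj₁ refl) = there (there (here refl))
    inE (inj₂ refl) (inj₂ refl) = there (there (there (here refl)))
    outE : ∀ x → (x , d) ∉ edges t
    outE x = ∉₄⇒∉ ((λ e → d≢c′ (cong proj₂ e)) , (λ e → d≢d′ (cong proj₂ e))
                 , (λ e → d≢c′ (cong proj₂ e)) , (λ e → d≢d′ (cong proj₂ e)))
    vs : length (filter (_∈? vertices t) (vertices ((a , b) , (c , d)))) ≡ 3
    vs rewrite count (_∈? vertices t) a b c d
             | 𝟙-yes (a ∈? vertices t) (here refl) | 𝟙-yes (b ∈? vertices t) (there (here refl))
             | 𝟙-yes (c ∈? vertices t) (inV c∈)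
             | 𝟙-no (d ∈? vertices t) (∉₄⇒∉ (L≢U la ud ∘ sym , L≢U lb ud ∘ sym , d≢c′ , d≢d′)) = refl
    es : length (filter (_∈ᴱ? edges t) (edges ((a , b) , (c , d)))) ≡ 2
    es rewrite count (_∈ᴱ? edges t) (a , c) (a , d) (b , c) (b , d)
             | 𝟙-yes ((a , c) ∈ᴱ? edges t) (inE (inj₁ refl) c∈) | 𝟙-no ((a , d) ∈ᴱ? edges t) (outE a)
             | 𝟙-yes ((b , c) ∈ᴱ? edges t) (inE (inj₂ refl) c∈) | 𝟙-no ((b , d) ∈ᴱ? edges t) (outE b) = refl
  shares-top {a , b} {c , d} {c′ , d′} (_ , (la , lb) , (uc , ud)) (inj₂ (d∈ , c≢c′ , c≢d′)) = vs , es
    where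
    t = (a , b) , (c′ , d′)
    inV : d ∈₂ (c′ , d′) → d ∈ vertices t
    inV (inj₁ e) = there (there (here e))
    inV (inj₂ e) = there (there (there (here e)))
    inE : ∀ {x} → x ∈₂ (a , b) → d ∈₂ (c′ , d′) → (x , d) ∈ edges t
    inE (inj₁ refl) (inj₁ refl) = here refl
    inE (inj₁ refl) (inj₂ refl) = there (here refl)
    inE (inj₂ refl) (inj₁ refl) = there (there (here refl))
    inE (inj₂ refl) (inj₂ refl) = there (there (there (here refl)))
    outE : ∀ x → (x , c) ∉ edges t
    outE x = ∉₄⇒∉ ((λ e → c≢c′ (cong proj₂ e)) , (λ e → c≢d′ (cong proj₂ e))
                 , (λ e → c≢c′ (cong proj₂ e)) , (λ e → c≢d′ (cong proj₂ e)))
    vs : length (filter (_∈? vertices t) (vertices ((a , b) , (c , d)))) ≡ 3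
    vs rewrite count (_∈? vertices t) a b c d
             | 𝟙-yes (a ∈? vertices t) (here refl) | 𝟙-yes (b ∈? vertices t) (there (here refl))
             | 𝟙-no (c ∈? vertices t) (∉₄⇒∉ (L≢U la uc ∘ sym , L≢U lb uc ∘ sym , c≢c′ , c≢d′))
             | 𝟙-yes (d ∈? vertices t) (inV d∈) = refl
    es : length (filter (_∈ᴱ? edges t) (edges ((a , b) , (c , d)))) ≡ 2
    es rewrite count (_∈ᴱ? edges t) (a , c) (a , d) (b , c) (b , d)
             | 𝟙-no ((a , c) ∈ᴱ? edges t) (outE a) | 𝟙-yes ((a , d) ∈ᴱ? edges t) (inE (inj₁ refl) d∈)
             | 𝟙-no ((b , c) ∈ᴱ? edges t) (outE b) | 𝟙-yes ((b , d) ∈ᴱ? edges t) (inE (inj₂ refl) d∈) = refl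

  -- The mirror image: the wedge is centred at the common lower vertex and its ends are the vertices
  -- of `Q`.
  shares-bottom : ∀ {P P′ Q} → Valid (P , Q) →
    proj₁ P ∈₂ P′ × proj₂ P ∉₂ P′ ⊎ proj₂ P ∈₂ P′ × proj₁ P ∉₂ P′ →
    SharesWedge ((P , Q) , (P′ , Q))
  shares-bottom {a , b} {a′ , b′} {c , d} (_ , (la , lb) , (uc , ud)) (inj₁ (a∈ , b≢a′ , b≢b′)) = vs , es
    where
    t = (a′ , b′) , (c , d)
    inV : a ∈₂ (a′ , b′) → a ∈ vertices t
    inV (inj₁ e) = here e
    inV (inj₂ e) = there (here e)
    inE : ∀ {x} → a ∈₂ (a′ , b′) → x ∈₂ (c , d) → (a , x) ∈ edges t
    inE (inj₁ refl) (inj₁ refl) = here refl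
    inE (inj₁ refl) (inj₂ refl) = there (here refl)
    inE (inj₂ refl) (inj₁ refl) = there (there (here refl))
    inE (inj₂ refl) (inj₂ refl) = there (there (there (here refl)))
    outE : ∀ x → (b , x) ∉ edges t
    outE x = ∉₄⇒∉ ((λ e → b≢a′ (cong proj₁ e)) , (λ e → b≢a′ (cong proj₁ e))
                 , (λ e → b≢b′ (cong proj₁ e)) , (λ e → b≢b′ (cong proj₁ e)))
    vs : length (filter (_∈? vertices t) (vertices ((a , b) , (c , d)))) ≡ 3
    vs rewrite count (_∈? vertices t) a b c d
             | 𝟙-yes (a ∈? vertices t) (inV a∈)
             | 𝟙-no (b ∈? vertices t) (∉₄⇒∉ (b≢a′ , b≢b′ , L≢U lb uc , L≢U lb ud))
             | 𝟙-yes (c ∈? vertices t) (there (there (here refl)))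
             | 𝟙-yes (d ∈? vertices t) (there (there (there (here refl)))) = refl
    es : length (filter (_∈ᴱ? edges t) (edges ((a , b) , (c , d)))) ≡ 2
    es rewrite count (_∈ᴱ? edges t) (a , c) (a , d) (b , c) (b , d)
             | 𝟙-yes ((a , c) ∈ᴱ? edges t) (inE a∈ (inj₁ refl)) | 𝟙-yes ((a , d) ∈ᴱ? edges t) (inE a∈ (inj₂ refl))
             | 𝟙-no ((b , c) ∈ᴱ? edges t) (outE c) | 𝟙-no ((b , d) ∈ᴱ? edges t) (outE d) = refl
  shares-bottom {a , b} {a′ , b′} {c , d} (_ , (la , lb) , (uc , ud)) (inj₂ (b∈ , a≢a′ , a≢b′)) = vs , es
    where
    t = (a′ , b′) , (c , d)
    inV : b ∈₂ (a′ , b′) → b ∈ vertices t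
    inV (inj₁ e) = here e
    inV (inj₂ e) = there (here e)
    inE : ∀ {x} → b ∈₂ (a′ , b′) → x ∈₂ (c , d) → (b , x) ∈ edges t
    inE (inj₁ refl) (inj₁ refl) = here refl
    inE (inj₁ refl) (inj₂ refl) = there (here refl)
    inE (inj₂ refl) (inj₁ refl) = there (there (here refl))
    inE (inj₂ refl) (inj₂ refl) = there (there (there (here refl)))
    outE : ∀ x → (a , x) ∉ edges t
    outE x = ∉₄⇒∉ ((λ e → a≢a′ (cong proj₁ e)) , (λ e → a≢a′ (cong proj₁ e))
                 , (λ e → a≢b′ (cong proj₁ e)) , (λ e → a≢b′ (cong proj₁ e)))
    vs : length (filter (_∈? vertices t) (vertices ((a , b) , (c , d)))) ≡ 3
    vs rewrite count (_∈? vertices t) a b c d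
             | 𝟙-no (a ∈? vertices t) (∉₄⇒∉ (a≢a′ , a≢b′ , L≢U la uc , L≢U la ud))
             | 𝟙-yes (b ∈? vertices t) (inV b∈)
             | 𝟙-yes (c ∈? vertices t) (there (there (here refl)))
             | 𝟙-yes (d ∈? vertices t) (there (there (there (here refl)))) = refl
    es : length (filter (_∈ᴱ? edges t) (edges ((a , b) , (c , d)))) ≡ 2
    es rewrite count (_∈ᴱ? edges t) (a , c) (a , d) (b , c) (b , d)
             | 𝟙-no ((a , c) ∈ᴱ? edges t) (outE c) | 𝟙-no ((a , d) ∈ᴱ? edges t) (outE d)
             | 𝟙-yes ((b , c) ∈ᴱ? edges t) (inE b∈ (inj₁ refl)) | 𝟙-yes ((b , d) ∈ᴱ? edges t) (inE b∈ (inj₂ refl)) = refl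

  -- `J₁` requires equal lower pairs and `J₂` equal upper pairs; when both hold, `ω` of a pair with
  -- itself is 0. So at most one of the two is 1, and then there is a shared wedge.
  J≤sharesWedge : ∀ {s t} → Valid s → Valid t → J s t ≤ 𝟙 (sharesWedge? (s , t))
  J≤sharesWedge {P , Q} {P′ , Q′} vs@((P≢ , Q≢) , _) ((P′≢ , Q′≢) , _) with P ≟² P′ | Q ≟² Q′
  ... | no _     | no _     = z≤n
  ... | yes refl | yes refl rewrite ω-refl {P} P≢ | ω-refl {Q} Q≢ = z≤n
  ... | yes refl | no _ with ω-cases Q Q′ Q≢ Q′≢
  ...   | inj₁ ω≡0 rewrite ω≡0 = z≤n
  ...   | inj₂ (ω≡1 , cases)
    rewrite ω≡1 | 𝟙-yes (sharesWedge? ((P , Q) , (P , Q′))) (shares-top vs cases) = ≤-refl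
  J≤sharesWedge {P , Q} {P′ , Q′} vs@((P≢ , Q≢) , _) ((P′≢ , Q′≢) , _)
      | no _ | yes refl with ω-cases P P′ P≢ P′≢
  ... | inj₁ ω≡0 rewrite ω≡0 = z≤n
  ... | inj₂ (ω≡1 , cases)
    rewrite ω≡1 | 𝟙-yes (sharesWedge? ((P , Q) , (P′ , Q))) (shares-bottom vs cases) = ≤-refl

  J-diagonal : ∀ {s} → s ∈ butterflies G → J s s ≡ 0
  J-diagonal {P , Q} s∈ with butterflies-valid s∈
  ... | (P≢ , Q≢) , _ rewrite ω-refl {P} P≢ | ω-refl {Q} Q≢ | *-zeroʳ (𝟙 (P ≟² P)) = *-zeroʳ (𝟙 (Q ≟² Q))

  ∑∑J≤2p₁w : ∑ (butterflies G) (λ s → ∑ (butterflies G) (J s)) ≤ 2 * p₁w G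
  ∑∑J≤2p₁w = begin
    ∑ bs (λ s → ∑ bs (J s))
      ≡⟨ ∑-pairs-symmetric J J-sym bs ⟨
    2 * ∑ (pairs bs) (λ (s , t) → J s t) + ∑ bs (λ s → J s s)
      ≡⟨ cong (2 * ∑ (pairs bs) (λ (s , t) → J s t) +_) (trans (∑-cong∈ bs J-diagonal) (∑-0 bs)) ⟩
    2 * ∑ (pairs bs) (λ (s , t) → J s t) + 0
      ≡⟨ +-identityʳ _ ⟩
    2 * ∑ (pairs bs) (λ (s , t) → J s t)
      ≤⟨ *-monoʳ-≤ 2 (∑-mono∈ (pairs bs) (λ { {s , t} st∈ → J≤sharesWedge
           (butterflies-valid (proj₁ (∈-pairs⁻ bs st∈))) (butterflies-valid (proj₂ (∈-pairs⁻ bs st∈))) })) ⟩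
    2 * ∑ (pairs bs) (𝟙 ∘ sharesWedge?)
      ≡⟨ cong (2 *_) (length-filter sharesWedge? (pairs bs)) ⟨
    2 * p₁w G ∎
    where
    open ≤-Reasoning
    bs = butterflies G

  ∑-diagonal : ∀ (f : Fin n × Fin n → Fin n × Fin n → ℕ) →
    ∑ V² (λ P → f P P) ≤ ∑ V² (λ P → ∑ V² (λ P′ → 𝟙 (P ≟² P′) * f P P′))
  ∑-diagonal f = ∑-mono∈ V² (λ {P} P∈ → f≤∑-𝟙 _≟²_ (f P) P∈)

  -- For fixed `P` the overlapping pairs of common neighbours are pairs of butterflies that agree on
  -- `P`. The second variable `P′`, tied to `P` by an indicator, gives the right side the shape of a
  -- double sum over butterflies.
  fibre : ∀ s → ∑ V² (λ P@(a , b) → σ s P * cubic (k a b)) ≤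
    ∑ V² (λ P → ∑ V² (λ P′ → 𝟙 (P ≟² P′) *
      ∑ V² (λ Q → σ s P * joined P Q * ∑ V² (λ Q′ → σ s P′ * joined P′ Q′ * ω Q Q′))))
  fibre s = begin
    ∑ V² (λ P@(a , b) → σ s P * cubic (k a b))
      ≤⟨ ∑-mono V² (λ P@(a , b) → *-monoʳ-≤ (σ s P) (cubic≤Ω a b)) ⟩
    ∑ V² (λ P@(a , b) → σ s P * Ω (common a b))
      ≡⟨ ∑-cong V² same ⟩
    ∑ V² (λ P → ∑ V² (λ Q → σ s P * joined P Q * ∑ V² (λ Q′ → σ s P * joined P Q′ * ω Q Q′)))
      ≤⟨ ∑-diagonal (λ P P′ → ∑ V² (λ Q → σ s P * joined P Q * ∑ V² (λ Q′ → σ s P′ * joined P′ Q′ * ω Q Q′))) ⟩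
    ∑ V² (λ P → ∑ V² (λ P′ → 𝟙 (P ≟² P′) *
      ∑ V² (λ Q → σ s P * joined P Q * ∑ V² (λ Q′ → σ s P′ * joined P′ Q′ * ω Q Q′)))) ∎
    where
    open ≤-Reasoning
    inner : ∀ P Q → σ s P * ∑ (pairs (common (proj₁ P) (proj₂ P))) (ω Q) ≡
      ∑ V² (λ Q′ → σ s P * joined P Q′ * ω Q Q′)
    inner P@(a , b) Q = trans (cong (σ s P *_) (∑-joined a b (ω Q)))
      (trans (sym (∑-*ˡ (σ s P) _ V²)) (∑-cong V² (λ Q′ → sym (*-assoc (σ s P) (joined P Q′) (ω Q Q′)))))
    regroup : ∀ x y z → x * x * (y * z) ≡ x * y * (x * z)
    regroup = solve-∀
    same : ∀ P → σ s P * Ω (common (proj₁ P) (proj₂ P)) ≡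
      ∑ V² (λ Q → σ s P * joined P Q * ∑ V² (λ Q′ → σ s P * joined P Q′ * ω Q Q′))
    same P@(a , b) = begin-equality
      σ s P * Ω (common a b)
        -- The indicator is squared to provide one copy for each of the two butterflies.
        ≡⟨ cong₂ _*_ (sym (σ-idem s P)) (∑-joined a b (λ Q → ∑ (pairs (common a b)) (ω Q))) ⟩
      σ s P * σ s P * ∑ V² (λ Q → joined P Q * ∑ (pairs (common a b)) (ω Q))
        ≡⟨ ∑-*ˡ (σ s P * σ s P) _ V² ⟨
      ∑ V² (λ Q → σ s P * σ s P * (joined P Q * ∑ (pairs (common a b)) (ω Q)))
        ≡⟨ ∑-cong V² (λ Q → trans (regroup (σ s P) (joined P Q) _) (cong (σ s P * joined P Q *_) (inner P Q))) ⟩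
      ∑ V² (λ Q → σ s P * joined P Q * ∑ V² (λ Q′ → σ s P * joined P Q′ * ω Q Q′)) ∎

  expand : ∀ (w w′ δ₀ : Fin n × Fin n → Fin n × Fin n → ℕ) (o : Fin n × Fin n → Fin n × Fin n → ℕ) →
    ∑ V² (λ P → ∑ V² (λ P′ → δ₀ P P′ * ∑ V² (λ Q → w P Q * ∑ V² (λ Q′ → w′ P′ Q′ * o Q Q′)))) ≡
    ∑ V² (λ P → ∑ V² (λ Q → w P Q * ∑ V² (λ P′ → ∑ V² (λ Q′ → w′ P′ Q′ * (δ₀ P P′ * o Q Q′)))))
  expand w w′ δ₀ o = ∑-cong V² λ P → begin
    ∑ V² (λ P′ → δ₀ P P′ * ∑ V² (λ Q → w P Q * ∑ V² (λ Q′ → w′ P′ Q′ * o Q Q′)))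
      ≡⟨ ∑-cong V² (λ P′ → sym (∑-*ˡ (δ₀ P P′) _ V²)) ⟩
    ∑ V² (λ P′ → ∑ V² (λ Q → δ₀ P P′ * (w P Q * ∑ V² (λ Q′ → w′ P′ Q′ * o Q Q′))))
      ≡⟨ ∑-swap _ V² V² ⟩
    ∑ V² (λ Q → ∑ V² (λ P′ → δ₀ P P′ * (w P Q * ∑ V² (λ Q′ → w′ P′ Q′ * o Q Q′))))
      ≡⟨ ∑-cong V² (λ Q → trans (∑-cong V² (λ P′ → inner P P′ Q)) (∑-*ˡ (w P Q) _ V²)) ⟩
    ∑ V² (λ Q → w P Q * ∑ V² (λ P′ → ∑ V² (λ Q′ → w′ P′ Q′ * (δ₀ P P′ * o Q Q′)))) ∎
    where
    open ≡-Reasoning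
    commute : ∀ x y z → x * (y * z) ≡ y * (x * z)
    commute = solve-∀
    inner : ∀ P P′ Q → δ₀ P P′ * (w P Q * ∑ V² (λ Q′ → w′ P′ Q′ * o Q Q′)) ≡
      w P Q * ∑ V² (λ Q′ → w′ P′ Q′ * (δ₀ P P′ * o Q Q′))
    inner P P′ Q = trans (commute (δ₀ P P′) (w P Q) _) (cong (w P Q *_)
      (trans (sym (∑-*ˡ (δ₀ P P′) _ V²)) (∑-cong V² (λ Q′ → commute (δ₀ P P′) (w′ P′ Q′) (o Q Q′)))))

  ∑∑-butterflies : ∀ (f : Square → Square → ℕ) →
    ∑ (butterflies G) (λ s → ∑ (butterflies G) (f s)) ≡
    ∑ V² (λ P → ∑ V² (λ Q → σ false P * joined P Q *
      ∑ V² (λ P′ → ∑ V² (λ Q′ → σ false P′ * joined P′ Q′ * f (P , Q) (P′ , Q′)))))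
  ∑∑-butterflies f = trans (∑-butterflies _)
    (∑-cong V² (λ P → ∑-cong V² (λ Q → cong (σ false P * joined P Q *_) (∑-butterflies (f (P , Q))))))

  ∑cubic≤∑∑J : ∑ V² (λ (a , b) → cubic (k a b)) ≤ ∑ (butterflies G) (λ s → ∑ (butterflies G) (J s))
  ∑cubic≤∑∑J = begin
    ∑ V² (λ (a , b) → cubic (k a b))
      ≡⟨ ∑-by-side cubic refl ⟩
    ∑ V² (λ P@(a , b) → σ false P * cubic (k a b)) + ∑ V² (λ P@(a , b) → σ true P * cubic (k a b))
      ≤⟨ +-mono-≤ (≤-trans (fibre false) (≤-reflexive top)) (≤-trans (fibre true) (≤-reflexive bottom)) ⟩
    ∑ bs (λ s → ∑ bs (J₁ s)) + ∑ bs (λ s → ∑ bs (J₂ s))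
      ≡⟨ trans (∑-cong bs (λ s → ∑-+ (J₁ s) (J₂ s) bs)) (∑-+ (λ s → ∑ bs (J₁ s)) _ bs) ⟨
    ∑ bs (λ s → ∑ bs (J s)) ∎
    where
    open ≤-Reasoning
    bs = butterflies G
    δ² = λ P P′ → 𝟙 (P ≟² P′)
    W = λ P Q → σ false P * joined P Q
    W′ = λ P Q → σ true P * joined P Q
    top : ∑ V² (λ P → ∑ V² (λ P′ → δ² P P′ * ∑ V² (λ Q → W P Q * ∑ V² (λ Q′ → W P′ Q′ * ω Q Q′)))) ≡
      ∑ bs (λ s → ∑ bs (J₁ s))
    top = trans (expand W W δ² ω) (sym (∑∑-butterflies J₁))
    bottom : ∑ V² (λ Q → ∑ V² (λ Q′ → δ² Q Q′ * ∑ V² (λ P → W′ Q P * ∑ V² (λ P′ → W′ Q′ P′ * ω P P′)))) ≡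
      ∑ bs (λ s → ∑ bs (J₂ s))
    -- Butterflies are indexed by their lower pair first, so both the inner and the outer sum over
    -- upper pairs have to be turned over by `swap-sides`.
    bottom = begin-equality
      ∑ V² (λ Q → ∑ V² (λ Q′ → δ² Q Q′ * ∑ V² (λ P → W′ Q P * ∑ V² (λ P′ → W′ Q′ P′ * ω P P′))))
        ≡⟨ expand W′ W′ δ² ω ⟩
      ∑ V² (λ Q → ∑ V² (λ P → W′ Q P * ∑ V² (λ Q′ → ∑ V² (λ P′ → W′ Q′ P′ * (δ² Q Q′ * ω P P′)))))
        ≡⟨ ∑-cong V² (λ Q → ∑-cong V² (λ P → cong (W′ Q P *_) (swap-sides (λ P′ Q′ → δ² Q Q′ * ω P P′)))) ⟨
      ∑ V² (λ Q → ∑ V² (λ P → W′ Q P * ∑ V² (λ P′ → ∑ V² (λ Q′ → W P′ Q′ * (δ² Q Q′ * ω P P′)))))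
        ≡⟨ swap-sides (λ P Q → ∑ V² (λ P′ → ∑ V² (λ Q′ → W P′ Q′ * (δ² Q Q′ * ω P P′)))) ⟨
      ∑ V² (λ P → ∑ V² (λ Q → W P Q * ∑ V² (λ P′ → ∑ V² (λ Q′ → W P′ Q′ * (δ² Q Q′ * ω P P′)))))
        ≡⟨ ∑∑-butterflies J₂ ⟨
      ∑ bs (λ s → ∑ bs (J₂ s)) ∎

  wedgeList : List (Fin n × Fin n)
  wedgeList = concatMap (λ u → pairs (Γ u)) V

  β : Fin n × Fin n → ℕ
  β (a , b) = k a b ∸ 1

  length-wedgeList : length wedgeList ≡ wedges G
  length-wedgeList = begin
    length wedgeList
      ≡⟨ trans (∑-const 1 wedgeList) (*-identityʳ _) ⟨
    ∑ wedgeList (λ _ → 1)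
      ≡⟨ ∑-concatMap _ (λ u → pairs (Γ u)) V ⟩
    ∑ V (λ u → ∑ (pairs (Γ u)) (λ _ → 1))
      ≡⟨ ∑-cong V (λ u → trans (∑-const 1 (pairs (Γ u))) (trans (*-identityʳ _)
           (trans (length-pairs (Γ u)) (sym (tri≡C2 (degree G u)))))) ⟩
    wedges G ∎
    where open ≡-Reasoning

  first-moment : ∑ wedgeList β ≡ 4 * B G
  first-moment = trans (∑-concatMap β (λ u → pairs (Γ u)) V)
    (trans (∑-wedges (λ a b → k a b ∸ 1) (λ a b → cong (_∸ 1) (k-sym a b))) ∑k[k-1]≡4B)

  second-moment : ∑ wedgeList (λ w → β w * β w) ≤ 4 * (B G + p₁w G)
  second-moment = begin
    ∑ wedgeList (λ w → β w * β w)
      ≡⟨ ∑-concatMap (λ w → β w * β w) (λ u → pairs (Γ u)) V ⟩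
    ∑ V (λ u → ∑ (pairs (Γ u)) (λ w → β w * β w))
      ≡⟨ ∑-wedges (λ a b → (k a b ∸ 1) * (k a b ∸ 1)) (λ a b → cong (λ x → (x ∸ 1) * (x ∸ 1)) (k-sym a b)) ⟩
    ∑ V² (λ (a , b) → k a b * ((k a b ∸ 1) * (k a b ∸ 1)))
      ≡⟨ ∑-cong V² (λ (a , b) → square (k a b)) ⟩
    ∑ V² (λ (a , b) → k a b * (k a b ∸ 1) + cubic (k a b))
      ≡⟨ ∑-+ (λ (a , b) → k a b * (k a b ∸ 1)) _ V² ⟩
    ∑ V² (λ (a , b) → k a b * (k a b ∸ 1)) + ∑ V² (λ (a , b) → cubic (k a b))
      ≤⟨ +-mono-≤ (≤-reflexive ∑k[k-1]≡4B) (≤-trans ∑cubic≤∑∑J ∑∑J≤2p₁w) ⟩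
    4 * B G + 2 * p₁w G
      -- Rounded up to a multiple of B + p₁w, the combination in which the spread equals ∧ (B + p₁w)
      -- / B².
      ≤⟨ +-monoʳ-≤ (4 * B G) (*-monoˡ-≤ (p₁w G) {2} {4} (s≤s (s≤s z≤n))) ⟩
    4 * B G + 4 * p₁w G
      ≡⟨ *-distribˡ-+ 4 (B G) (p₁w G) ⟨
    4 * (B G + p₁w G) ∎
    where
    open ≤-Reasoning
    square : ∀ x → x * ((x ∸ 1) * (x ∸ 1)) ≡ x * (x ∸ 1) + x * (x ∸ 1) * (x ∸ 2)
    square zero          = refl
    square (suc zero)    = refl
    square (suc (suc x)) = lemma x
      where
      lemma : ∀ x → suc (suc x) * (suc x * suc x) ≡ suc (suc x) * suc x + suc (suc x) * suc x * x
      lemma = solve-∀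

-- Rational arithmetic

-- The fraction in `fromℕ` is normalised by a gcd that does not compute for a variable; this
-- exhibits the normal form, from which its image in the unnormalised rationals can be read.
fromℕ-mkℚ : ∀ k → fromℕ k ≡ mkℚ (ℤ.+ k) 0 (coprime-sym (1-coprimeTo k))
fromℕ-mkℚ k = ℚ.↥p/↧p≡p (mkℚ (ℤ.+ k) 0 (coprime-sym (1-coprimeTo k)))

toℚᵘ-fromℕ : ∀ k → toℚᵘ (fromℕ k) ≡ mkℚᵘ (ℤ.+ k) 0
toℚᵘ-fromℕ k = cong toℚᵘ (fromℕ-mkℚ k)

fromℕ-+ : ∀ a b → fromℕ (a + b) ≡ fromℕ a ℚ.+ fromℕ b
fromℕ-+ a b = ℚ.toℚᵘ-injective (begin
  toℚᵘ (fromℕ (a + b))                  ≡⟨ toℚᵘ-fromℕ (a + b) ⟩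
  mkℚᵘ (ℤ.+ (a + b)) 0                    ≈⟨ *≡* (trans (ℤ.*-identityʳ _) (sym (trans (ℤ.*-identityʳ _) (cong₂ ℤ._+_ (ℤ.*-identityʳ (ℤ.+ a)) (ℤ.*-identityʳ (ℤ.+ b)))))) ⟩
  mkℚᵘ (ℤ.+ a) 0 ℚᵘ.+ mkℚᵘ (ℤ.+ b) 0        ≡⟨ cong₂ ℚᵘ._+_ (toℚᵘ-fromℕ a) (toℚᵘ-fromℕ b) ⟨
  toℚᵘ (fromℕ a) ℚᵘ.+ toℚᵘ (fromℕ b)    ≈⟨ ℚ.toℚᵘ-homo-+ (fromℕ a) (fromℕ b) ⟨
  toℚᵘ (fromℕ a ℚ.+ fromℕ b) ∎)
  where open ℚᵘ.≃-Reasoning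

fromℕ-* : ∀ a b → fromℕ (a * b) ≡ fromℕ a ℚ.* fromℕ b
fromℕ-* a b = ℚ.toℚᵘ-injective (begin
  toℚᵘ (fromℕ (a * b))                  ≡⟨ toℚᵘ-fromℕ (a * b) ⟩
  mkℚᵘ (ℤ.+ (a * b)) 0                    ≈⟨ *≡* (cong (ℤ._* ℤ.+ 1) (ℤ.pos-* a b)) ⟩
  mkℚᵘ (ℤ.+ a) 0 ℚᵘ.* mkℚᵘ (ℤ.+ b) 0        ≡⟨ cong₂ ℚᵘ._*_ (toℚᵘ-fromℕ a) (toℚᵘ-fromℕ b) ⟨
  toℚᵘ (fromℕ a) ℚᵘ.* toℚᵘ (fromℕ b)    ≈⟨ ℚ.toℚᵘ-homo-* (fromℕ a) (fromℕ b) ⟨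
  toℚᵘ (fromℕ a ℚ.* fromℕ b) ∎)
  where open ℚᵘ.≃-Reasoning

fromℕ-mono : ∀ {a b} → a ≤ b → fromℕ a ℚ.≤ fromℕ b
fromℕ-mono {a} {b} a≤b = ℚ.toℚᵘ-cancel-≤
  (subst₂ ℚᵘ._≤_ (sym (toℚᵘ-fromℕ a)) (sym (toℚᵘ-fromℕ b))
    (*≤* (subst₂ ℤ._≤_ (sym (ℤ.*-identityʳ (ℤ.+ a))) (sym (ℤ.*-identityʳ (ℤ.+ b))) (ℤ.+≤+ a≤b))))

fromℕ-cancel : ∀ {a b} → fromℕ a ℚ.≤ fromℕ b → a ≤ b
fromℕ-cancel {a} {b} le with subst₂ ℚᵘ._≤_ (toℚᵘ-fromℕ a) (toℚᵘ-fromℕ b) (ℚ.toℚᵘ-mono-≤ le)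
... | *≤* le′ = ℤ.drop‿+≤+ (subst₂ ℤ._≤_ (ℤ.*-identityʳ (ℤ.+ a)) (ℤ.*-identityʳ (ℤ.+ b)) le′)

0≤fromℕ : ∀ a → 0ℚ ℚ.≤ fromℕ a
0≤fromℕ a = fromℕ-mono {0} {a} z≤n

fromℕ-pos : ∀ a .{{_ : NonZero a}} → ℚ.Positive (fromℕ a)
fromℕ-pos a@(suc _) = subst ℚ.Positive (sym (fromℕ-mkℚ a)) _

ratio-*-fromℕ : ∀ a b .{{_ : NonZero b}} → ratio a b ℚ.* fromℕ b ≡ fromℕ a
ratio-*-fromℕ a (suc b) = ℚ.toℚᵘ-injective (begin
  toℚᵘ (ratio a (suc b) ℚ.* fromℕ (suc b))            ≈⟨ ℚ.toℚᵘ-homo-* (ratio a (suc b)) (fromℕ (suc b)) ⟩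
  toℚᵘ (ratio a (suc b)) ℚᵘ.* toℚᵘ (fromℕ (suc b))    ≈⟨ ℚᵘ.*-cong (ℚ.toℚᵘ-fromℚᵘ (mkℚᵘ (ℤ.+ a) b)) (ℚᵘ.≃-reflexive (toℚᵘ-fromℕ (suc b))) ⟩
  mkℚᵘ (ℤ.+ a) b ℚᵘ.* mkℚᵘ (ℤ.+ suc b) 0                  ≈⟨ *≡* (trans (ℤ.*-identityʳ _) (cong (λ x → ℤ.+ a ℤ.* ℤ.+ x) (sym (*-identityʳ (suc b))))) ⟩
  mkℚᵘ (ℤ.+ a) 0                                        ≡⟨ toℚᵘ-fromℕ a ⟨
  toℚᵘ (fromℕ a) ∎)
  where open ℚᵘ.≃-Reasoning

*-monoˡ-0≤ : ∀ {r p q} → 0ℚ ℚ.≤ r → p ℚ.≤ q → r ℚ.* p ℚ.≤ r ℚ.* q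
*-monoˡ-0≤ {r} 0≤r = ℚ.*-monoˡ-≤-nonNeg r {{ℚ.nonNegative 0≤r}}

*-monoʳ-0≤ : ∀ {r p q} → 0ℚ ℚ.≤ r → p ℚ.≤ q → p ℚ.* r ℚ.≤ q ℚ.* r
*-monoʳ-0≤ {r} 0≤r = ℚ.*-monoʳ-≤-nonNeg r {{ℚ.nonNegative 0≤r}}

0≤* : ∀ {p q} → 0ℚ ℚ.≤ p → 0ℚ ℚ.≤ q → 0ℚ ℚ.≤ p ℚ.* q
0≤* {p} {q} 0≤p 0≤q = subst (ℚ._≤ p ℚ.* q) (ℚ.*-zeroʳ p) (*-monoˡ-0≤ 0≤p 0≤q)

0≤+ : ∀ {p q} → 0ℚ ℚ.≤ p → 0ℚ ℚ.≤ q → 0ℚ ℚ.≤ p ℚ.+ q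
0≤+ = ℚ.+-mono-≤ {0ℚ} {_} {0ℚ}

p≤p+q : ∀ {p q} → 0ℚ ℚ.≤ q → p ℚ.≤ p ℚ.+ q
p≤p+q {p} {q} 0≤q = subst (ℚ._≤ p ℚ.+ q) (ℚ.+-identityʳ p) (ℚ.+-monoʳ-≤ p 0≤q)

q≤p+q : ∀ {p q} → 0ℚ ℚ.≤ p → q ℚ.≤ p ℚ.+ q
q≤p+q {p} {q} 0≤p = subst (ℚ._≤ p ℚ.+ q) (ℚ.+-identityˡ q) (ℚ.+-monoˡ-≤ q 0≤p)

+-cancelʳ-≤ℚ : ∀ {p q} r → p ℚ.+ r ℚ.≤ q ℚ.+ r → p ℚ.≤ q
+-cancelʳ-≤ℚ {p} {q} r le = subst₂ ℚ._≤_ (undo p) (undo q) (ℚ.+-monoˡ-≤ (ℚ.- r) le)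
  where
  undo : ∀ x → x ℚ.+ r ℚ.+ ℚ.- r ≡ x
  undo x = trans (ℚ.+-assoc x r (ℚ.- r)) (trans (cong (x ℚ.+_) (ℚ.+-inverseʳ r)) (ℚ.+-identityʳ x))

*-cancelˡ-fromℕ : ∀ a .{{_ : NonZero a}} {p q} → fromℕ a ℚ.* p ℚ.≤ fromℕ a ℚ.* q → p ℚ.≤ q
*-cancelˡ-fromℕ a = ℚ.*-cancelˡ-≤-pos (fromℕ a) {{fromℕ-pos a}}

*-cancelʳ-fromℕ : ∀ a .{{_ : NonZero a}} {p q} → p ℚ.* fromℕ a ℚ.≤ q ℚ.* fromℕ a → p ℚ.≤ q
*-cancelʳ-fromℕ a = ℚ.*-cancelʳ-≤-pos (fromℕ a) {{fromℕ-pos a}}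

*-cancelʳ-fromℕ-≡ : ∀ a .{{_ : NonZero a}} {p q} → p ℚ.* fromℕ a ≡ q ℚ.* fromℕ a → p ≡ q
*-cancelʳ-fromℕ-≡ a h = ℚ.≤-antisym (*-cancelʳ-fromℕ a (ℚ.≤-reflexive h)) (*-cancelʳ-fromℕ a (ℚ.≤-reflexive (sym h)))

0≤ratio : ∀ a b → 0ℚ ℚ.≤ ratio a b
0≤ratio a zero    = ℚ.≤-refl
0≤ratio a (suc b) = *-cancelʳ-fromℕ (suc b)
  (subst₂ ℚ._≤_ (sym (ℚ.*-zeroˡ (fromℕ (suc b)))) (sym (ratio-*-fromℕ a (suc b))) (0≤fromℕ a))

infixr 8 _^ℚ_
_^ℚ_ : ℚ → ℕ → ℚ
a ^ℚ zero  = 1ℚ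
a ^ℚ suc k = a ℚ.* a ^ℚ k

^ℚ-+ : ∀ a j k → a ^ℚ (j + k) ≡ a ^ℚ j ℚ.* a ^ℚ k
^ℚ-+ a zero    k = sym (ℚ.*-identityˡ _)
^ℚ-+ a (suc j) k = trans (cong (a ℚ.*_) (^ℚ-+ a j k)) (sym (ℚ.*-assoc a _ _))

0≤^ℚ : ∀ {a} k → 0ℚ ℚ.≤ a → 0ℚ ℚ.≤ a ^ℚ k
0≤^ℚ zero    0≤a = fromℕ-mono {0} {1} z≤n
0≤^ℚ (suc k) 0≤a = 0≤* 0≤a (0≤^ℚ k 0≤a)

ratio-^-fromℕ : ∀ x y .{{_ : NonZero y}} j → ratio x y ^ℚ j ℚ.* fromℕ (y ^ j) ≡ fromℕ (x ^ j)
ratio-^-fromℕ x y zero    = refl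
ratio-^-fromℕ x y (suc j) = begin
  ratio x y ℚ.* ratio x y ^ℚ j ℚ.* fromℕ (y * y ^ j)
    ≡⟨ cong (ratio x y ℚ.* ratio x y ^ℚ j ℚ.*_) (fromℕ-* y (y ^ j)) ⟩
  ratio x y ℚ.* ratio x y ^ℚ j ℚ.* (fromℕ y ℚ.* fromℕ (y ^ j))
    ≡⟨ swap (ratio x y) (ratio x y ^ℚ j) (fromℕ y) (fromℕ (y ^ j)) ⟩
  ratio x y ℚ.* fromℕ y ℚ.* (ratio x y ^ℚ j ℚ.* fromℕ (y ^ j))
    ≡⟨ cong₂ ℚ._*_ (ratio-*-fromℕ x y) (ratio-^-fromℕ x y j) ⟩
  fromℕ x ℚ.* fromℕ (x ^ j)
    ≡⟨ fromℕ-* x (x ^ j) ⟨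
  fromℕ (x * x ^ j) ∎
  where
  open ≡-Reasoning
  open ℚSolver.+-*-Solver
  swap : ∀ a b c d → a ℚ.* b ℚ.* (c ℚ.* d) ≡ a ℚ.* c ℚ.* (b ℚ.* d)
  swap = solve 4 (λ a b c d → a :* b :* (c :* d) := a :* c :* (b :* d)) refl

ratio-inverse : ∀ x y .{{_ : NonZero x}} .{{_ : NonZero y}} → ratio x y ℚ.* ratio y x ≡ 1ℚ
ratio-inverse x y = *-cancelʳ-fromℕ-≡ (x * y) {{m*n≢0 x y}} (begin
  ratio x y ℚ.* ratio y x ℚ.* fromℕ (x * y)
    ≡⟨ cong (ratio x y ℚ.* ratio y x ℚ.*_) (fromℕ-* x y) ⟩
  ratio x y ℚ.* ratio y x ℚ.* (fromℕ x ℚ.* fromℕ y)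
    ≡⟨ swap (ratio x y) (ratio y x) (fromℕ x) (fromℕ y) ⟩
  ratio x y ℚ.* fromℕ y ℚ.* (ratio y x ℚ.* fromℕ x)
    ≡⟨ cong₂ ℚ._*_ (ratio-*-fromℕ x y) (ratio-*-fromℕ y x) ⟩
  fromℕ x ℚ.* fromℕ y
    ≡⟨ fromℕ-* x y ⟨
  fromℕ (x * y)
    ≡⟨ ℚ.*-identityˡ _ ⟨
  1ℚ ℚ.* fromℕ (x * y) ∎)
  where
  open ≡-Reasoning
  open ℚSolver.+-*-Solver
  swap : ∀ a b c d → a ℚ.* b ℚ.* (c ℚ.* d) ≡ a ℚ.* d ℚ.* (b ℚ.* c)
  swap = solve 4 (λ a b c d → a :* b :* (c :* d) := a :* d :* (b :* c)) refl

^ℚ-inverse : ∀ {a b} → a ℚ.* b ≡ 1ℚ → ∀ k → a ^ℚ k ℚ.* b ^ℚ k ≡ 1ℚ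
^ℚ-inverse ab zero = refl
^ℚ-inverse {a} {b} ab (suc k) = trans (swap a (a ^ℚ k) b (b ^ℚ k)) (cong₂ ℚ._*_ ab (^ℚ-inverse ab k))
  where
  open ℚSolver.+-*-Solver
  swap : ∀ a b c d → a ℚ.* b ℚ.* (c ℚ.* d) ≡ a ℚ.* c ℚ.* (b ℚ.* d)
  swap = solve 4 (λ a b c d → a :* b :* (c :* d) := a :* c :* (b :* d)) refl

-- Finite sums of rationals

∑ℚ : ∀ {k} → (Fin k → ℚ) → ℚ
∑ℚ = Sum.sum ℚ.+-0-commutativeMonoid

module ℚSum = SemiringSum (CommutativeRing.semiring ℚ.+-*-commutativeRing)

∑ℚ-cong : ∀ {k} {f g : Fin k → ℚ} → (∀ i → f i ≡ g i) → ∑ℚ f ≡ ∑ℚ g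
∑ℚ-cong {zero}  f≗g = refl
∑ℚ-cong {suc k} f≗g = cong₂ ℚ._+_ (f≗g zero) (∑ℚ-cong (f≗g ∘ suc))

∑ℚ-mono : ∀ {k} {f g : Fin k → ℚ} → (∀ i → f i ℚ.≤ g i) → ∑ℚ f ℚ.≤ ∑ℚ g
∑ℚ-mono {zero}  f≤g = ℚ.≤-refl
∑ℚ-mono {suc k} f≤g = ℚ.+-mono-≤ (f≤g zero) (∑ℚ-mono (f≤g ∘ suc))

∑ℚ-*ˡ : ∀ {k} c (f : Fin k → ℚ) → ∑ℚ (λ i → c ℚ.* f i) ≡ c ℚ.* ∑ℚ f
∑ℚ-*ˡ c f = sym (ℚSum.*-distribˡ-sum c f)

∑ℚ-fromℕ : ∀ {k} (f : Fin k → ℕ) → ∑ℚ (λ i → fromℕ (f i)) ≡ fromℕ (∑ (allFin k) f)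
∑ℚ-fromℕ {zero}  f = refl
∑ℚ-fromℕ {suc k} f = trans (cong (fromℕ (f zero) ℚ.+_) (∑ℚ-fromℕ (f ∘ suc)))
  (trans (sym (fromℕ-+ (f zero) _)) (cong (λ xs → fromℕ (f zero + sum xs))
    (trans (map-tabulate id (f ∘ suc)) (sym (map-tabulate suc f)))))

-- Sequences of independent uniform draws

-- The history is an argument so that statements can be proved by induction on the number of draws
-- to come, for an arbitrary past.
drawsFrom : ∀ W → ℕ → List (Fin W) → Rand (List (Fin W))
drawsFrom W zero    h = return h
drawsFrom W (suc N) h = choose W (λ _ → ratio 1 W) (λ i → drawsFrom W N (i ∷ h))

-- `Φ k h` dominates the conditional probability of `P` after the history `h` with `k` draws to
-- come. At the leaves this is Markov's inequality, and the first hypothesis carries it back to the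
-- root.
supermartingale : ∀ {W} {P : Pred (List (Fin W)) 0ℓ} (P? : Decidable P) (Φ : ℕ → List (Fin W) → ℚ) →
  (∀ k h → ∑ℚ (λ i → ratio 1 W ℚ.* Φ k (i ∷ h)) ℚ.≤ Φ (suc k) h) →
  (∀ h → 0ℚ ℚ.≤ Φ 0 h) → (∀ h → P h → 1ℚ ℚ.≤ Φ 0 h) →
  ∀ N h → Pr P? (drawsFrom W N h) ℚ.≤ Φ N h
supermartingale P? Φ step 0≤Φ P⇒Φ zero h with P? h
... | yes p = P⇒Φ h p
... | no _  = 0≤Φ h
supermartingale {W} P? Φ step 0≤Φ P⇒Φ (suc N) h = ℚ.≤-trans
  (∑ℚ-mono (λ i → *-monoˡ-0≤ (0≤ratio 1 W) (supermartingale P? Φ step 0≤Φ P⇒Φ N (i ∷ h)))) (step N h)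

-- Exponential moments of truncated variables

bernoulli : ∀ D m → D ^ m * (D + m) ≤ D * suc D ^ m
bernoulli D zero    = ≤-reflexive (lemma D)
  where
  lemma : ∀ D → 1 * (D + 0) ≡ D * 1
  lemma = solve-∀
bernoulli D (suc m) = begin
  D * D ^ m * (D + suc m)                 ≤⟨ m≤m+n _ (D ^ m * m) ⟩
  D * D ^ m * (D + suc m) + D ^ m * m     ≡⟨ lemma D m (D ^ m) ⟩
  suc D * (D ^ m * (D + m))               ≤⟨ *-monoʳ-≤ (suc D) (bernoulli D m) ⟩
  suc D * (D * suc D ^ m)                 ≡⟨ commute (suc D) D (suc D ^ m) ⟩
  D * (suc D * suc D ^ m) ∎
  where
  open ≤-Reasoning
  lemma : ∀ D m x → D * x * (D + suc m) + x * m ≡ suc D * (x * (D + m))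
  lemma = solve-∀
  commute : ∀ x y z → x * (y * z) ≡ y * (x * z)
  commute = solve-∀

-- With D = E + 1 this is (1 - 1/D)^m ≥ 1 - m/D; the negative term is on the other side to stay
-- within the naturals.
bernoulli-lower : ∀ E m → suc E ^ m * suc E ≤ suc E * E ^ m + m * suc E ^ m
bernoulli-lower E zero    = ≤-reflexive (lemma E)
  where
  lemma : ∀ E → 1 * suc E ≡ suc E * 1 + 0 * 1
  lemma = solve-∀
bernoulli-lower E (suc m) = begin
  suc E * suc E ^ m * suc E
    ≡⟨ *-assoc (suc E) (suc E ^ m) (suc E) ⟩
  suc E * (suc E ^ m * suc E)
    ≤⟨ *-monoʳ-≤ (suc E) (bernoulli-lower E m) ⟩
  suc E * (suc E * E ^ m + m * suc E ^ m)
    ≡⟨ lemma E m (E ^ m) (suc E ^ m) ⟩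
  suc E * (E * E ^ m) + suc E * E ^ m + m * (suc E * suc E ^ m)
    ≤⟨ +-monoˡ-≤ (m * (suc E * suc E ^ m)) (+-monoʳ-≤ (suc E * (E * E ^ m))
         (*-monoʳ-≤ (suc E) (^-monoˡ-≤ m (n≤1+n E)))) ⟩
  suc E * (E * E ^ m) + suc E * suc E ^ m + m * (suc E * suc E ^ m)
    ≡⟨ +-assoc (suc E * (E * E ^ m)) _ _ ⟩
  suc E * (E * E ^ m) + suc m * (suc E * suc E ^ m) ∎
  where
  open ≤-Reasoning
  lemma : ∀ E m x y → suc E * (suc E * x + m * y) ≡ suc E * (E * x) + suc E * x + m * (suc E * y)
  lemma = solve-∀

-- The rational form of exp x ≤ 1 + x + x² for 0 ≤ x ≤ 1, where x = j/D and (1 + 1/D)^j replaces exp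
-- x. In the induction the excess j² is paid for by j ≤ D.
exp-upper : ∀ {D} j → j ≤ D → suc D ^ j * (D * D) ≤ (D * D + j * D + j * j) * D ^ j
exp-upper {D} zero    _   = ≤-reflexive (lemma D)
  where
  lemma : ∀ D → 1 * (D * D) ≡ (D * D + 0 * D + 0 * 0) * 1
  lemma = solve-∀
exp-upper {D} (suc j) j<D = begin
  suc D * suc D ^ j * (D * D)
    ≡⟨ *-assoc (suc D) (suc D ^ j) (D * D) ⟩
  suc D * (suc D ^ j * (D * D))
    ≤⟨ *-monoʳ-≤ (suc D) (exp-upper j (<⇒≤ j<D)) ⟩
  suc D * ((D * D + j * D + j * j) * D ^ j)
    ≡⟨ lemma₁ D j (D ^ j) ⟩
  (D * (D * D + suc j * D + (j * j + j)) + j * j) * D ^ j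
    ≤⟨ *-monoˡ-≤ (D ^ j) (+-monoʳ-≤ (D * (D * D + suc j * D + (j * j + j)))
         (≤-trans (*-monoʳ-≤ j (<⇒≤ j<D)) (m≤m+n (j * D) D))) ⟩
  (D * (D * D + suc j * D + (j * j + j)) + (j * D + D)) * D ^ j
    ≡⟨ lemma₂ D j (D ^ j) ⟩
  (D * D + suc j * D + suc j * suc j) * (D * D ^ j) ∎
  where
  open ≤-Reasoning
  lemma₁ : ∀ D j x → suc D * ((D * D + j * D + j * j) * x) ≡ (D * (D * D + suc j * D + (j * j + j)) + j * j) * x
  lemma₁ = solve-∀
  lemma₂ : ∀ D j x → (D * (D * D + suc j * D + (j * j + j)) + (j * D + D)) * x ≡ (D * D + suc j * D + suc j * suc j) * (D * x)
  lemma₂ = solve-∀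

-- The rational form of exp (-x) ≤ 1 - x + x², where D = E + 1, x = j/D and (1 - 1/D)^j replaces exp
-- (-x). Unlike `exp-upper` it holds for all j.
exp-lower : ∀ E j → E ^ j * (suc E * suc E) + j * suc E * suc E ^ j ≤ (suc E * suc E + j * j) * suc E ^ j
exp-lower E zero    = ≤-reflexive (lemma E)
  where
  lemma : ∀ E → 1 * (suc E * suc E) + 0 * suc E * 1 ≡ (suc E * suc E + 0 * 0) * 1
  lemma = solve-∀
exp-lower E (suc j) = begin
  E * E ^ j * (suc E * suc E) + suc j * suc E * (suc E * suc E ^ j)
    ≡⟨ lemma₁ E j (E ^ j) (suc E ^ j) ⟩
  E * (E ^ j * (suc E * suc E) + j * suc E * suc E ^ j) + (j * suc E + suc E * suc E) * suc E ^ j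
    ≤⟨ +-monoˡ-≤ _ (*-monoʳ-≤ E (exp-lower E j)) ⟩
  E * ((suc E * suc E + j * j) * suc E ^ j) + (j * suc E + suc E * suc E) * suc E ^ j
    ≤⟨ m≤m+n _ ((j * suc E + suc E + j * j) * suc E ^ j) ⟩
  E * ((suc E * suc E + j * j) * suc E ^ j) + (j * suc E + suc E * suc E) * suc E ^ j + (j * suc E + suc E + j * j) * suc E ^ j
    ≡⟨ lemma₂ E j (suc E ^ j) ⟩
  (suc E * suc E + suc j * suc j) * (suc E * suc E ^ j) ∎
  where
  open ≤-Reasoning
  lemma₁ : ∀ E j x y → E * x * (suc E * suc E) + suc j * suc E * (suc E * y) ≡
    E * (x * (suc E * suc E) + j * suc E * y) + (j * suc E + suc E * suc E) * y
  lemma₁ = solve-∀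
  lemma₂ : ∀ E j y → E * ((suc E * suc E + j * j) * y) + (j * suc E + suc E * suc E) * y + (j * suc E + suc E + j * j) * y ≡
    (suc E * suc E + suc j * suc j) * (suc E * y)
  lemma₂ = solve-∀

^-double : ∀ D .{{_ : NonZero D}} → 2 * D ^ D ≤ suc D ^ D
^-double D = *-cancelˡ-≤ D (≤-trans (≤-reflexive (lemma D (D ^ D))) (bernoulli D D))
  where
  lemma : ∀ D x → D * (2 * x) ≡ x * (D + D)
  lemma = solve-∀

^-double-lower : ∀ E → 2 * E ^ suc E ≤ suc E ^ suc E
^-double-lower zero      = z≤n
^-double-lower E@(suc _) = *-cancelˡ-≤ E (begin
  E * (2 * E ^ suc E)              ≤⟨ m≤m+n _ (E ^ suc E) ⟩
  E * (2 * E ^ suc E) + E ^ suc E  ≡⟨ lemma E (E ^ suc E) ⟩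
  E ^ suc E * (E + suc E)          ≤⟨ bernoulli E (suc E) ⟩
  E * suc E ^ suc E ∎)
  where
  open ≤-Reasoning
  lemma : ∀ E x → E * (2 * x) + x ≡ x * (E + suc E)
  lemma = solve-∀

module Chernoff (W : ℕ) .{{_ : NonZero W}} (x y : ℕ) .{{_ : NonZero x}} .{{_ : NonZero y}}
  (Y : Fin W → ℕ) (m : ℕ) where

  base base⁻ : ℚ
  base  = ratio x y
  base⁻ = ratio y x

  -- The exponential potential base^(m k + sum so far) / base^H, where m is an exponent with mean of
  -- base^Y at most base^m. A base above 1 yields the upper tail and a base below 1 the lower tail,
  -- so one module serves both.
  Φ : ℕ → ℕ → List (Fin W) → ℚ
  Φ H k h = base ^ℚ (m * k + ∑ h Y) ℚ.* base⁻ ^ℚ H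

  0≤Φ : ∀ H k h → 0ℚ ℚ.≤ Φ H k h
  0≤Φ H k h = 0≤* (0≤^ℚ (m * k + ∑ h Y) (0≤ratio x y)) (0≤^ℚ H (0≤ratio y x))

  Φ-step : ∑ℚ (λ i → base ^ℚ Y i) ℚ.≤ fromℕ W ℚ.* base ^ℚ m →
    ∀ H k h → ∑ℚ (λ i → ratio 1 W ℚ.* Φ H k (i ∷ h)) ℚ.≤ Φ H (suc k) h
  Φ-step mgf H k h = begin
    ∑ℚ (λ i → ratio 1 W ℚ.* Φ H k (i ∷ h))
      ≡⟨ ∑ℚ-cong (λ i → cong (ratio 1 W ℚ.*_) (split i)) ⟩
    ∑ℚ (λ i → ratio 1 W ℚ.* (Φ H k h ℚ.* base ^ℚ Y i))
      ≡⟨ trans (∑ℚ-*ˡ (ratio 1 W) (λ i → Φ H k h ℚ.* base ^ℚ Y i)) (cong (ratio 1 W ℚ.*_) (∑ℚ-*ˡ (Φ H k h) (λ i → base ^ℚ Y i))) ⟩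
    ratio 1 W ℚ.* (Φ H k h ℚ.* ∑ℚ (λ i → base ^ℚ Y i))
      ≤⟨ *-monoˡ-0≤ (0≤ratio 1 W) (*-monoˡ-0≤ (0≤Φ H k h) mgf) ⟩
    ratio 1 W ℚ.* (Φ H k h ℚ.* (fromℕ W ℚ.* base ^ℚ m))
      ≡⟨ regroup (ratio 1 W) (base ^ℚ (m * k + ∑ h Y)) (base⁻ ^ℚ H) (fromℕ W) (base ^ℚ m) ⟩
    ratio 1 W ℚ.* fromℕ W ℚ.* ((base ^ℚ m ℚ.* base ^ℚ (m * k + ∑ h Y)) ℚ.* base⁻ ^ℚ H)
      ≡⟨ cong₂ (λ u v → u ℚ.* (v ℚ.* base⁻ ^ℚ H)) (ratio-*-fromℕ 1 W) (sym (^ℚ-+ base m _)) ⟩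
    1ℚ ℚ.* (base ^ℚ (m + (m * k + ∑ h Y)) ℚ.* base⁻ ^ℚ H)
      ≡⟨ ℚ.*-identityˡ _ ⟩
    base ^ℚ (m + (m * k + ∑ h Y)) ℚ.* base⁻ ^ℚ H
      ≡⟨ cong (λ e → base ^ℚ e ℚ.* base⁻ ^ℚ H) (arith m k (∑ h Y)) ⟩
    Φ H (suc k) h ∎
    where
    open ℚ.≤-Reasoning
    arith : ∀ m k s → m + (m * k + s) ≡ m * suc k + s
    arith = solve-∀
    arith′ : ∀ m k s y → m * k + (y + s) ≡ m * k + s + y
    arith′ = solve-∀
    open ℚSolver.+-*-Solver
    regroup : ∀ r a c w b → r ℚ.* (a ℚ.* c ℚ.* (w ℚ.* b)) ≡ r ℚ.* w ℚ.* ((b ℚ.* a) ℚ.* c)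
    regroup = solve 5 (λ r a c w b → r :* (a :* c :* (w :* b)) := r :* w :* ((b :* a) :* c)) refl
    swap : ∀ a b c → a ℚ.* b ℚ.* c ≡ a ℚ.* c ℚ.* b
    swap = solve 3 (λ a b c → a :* b :* c := a :* c :* b) refl
    split : ∀ i → Φ H k (i ∷ h) ≡ Φ H k h ℚ.* base ^ℚ Y i
    split i = trans (cong (λ e → base ^ℚ e ℚ.* base⁻ ^ℚ H) (arith′ m k (∑ h Y) (Y i)))
      (trans (cong (ℚ._* base⁻ ^ℚ H) (^ℚ-+ base (m * k + ∑ h Y) (Y i)))
             (swap (base ^ℚ (m * k + ∑ h Y)) (base ^ℚ Y i) (base⁻ ^ℚ H)))

  ^ℚ-excess : ∀ H g → base ^ℚ (H + g) ℚ.* base⁻ ^ℚ H ≡ base ^ℚ g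
  ^ℚ-excess H g = begin
    base ^ℚ (H + g) ℚ.* base⁻ ^ℚ H                ≡⟨ cong (ℚ._* base⁻ ^ℚ H) (^ℚ-+ base H g) ⟩
    base ^ℚ H ℚ.* base ^ℚ g ℚ.* base⁻ ^ℚ H        ≡⟨ swap (base ^ℚ H) (base ^ℚ g) (base⁻ ^ℚ H) ⟩
    base ^ℚ H ℚ.* base⁻ ^ℚ H ℚ.* base ^ℚ g        ≡⟨ cong (ℚ._* base ^ℚ g) (^ℚ-inverse (ratio-inverse x y) H) ⟩
    1ℚ ℚ.* base ^ℚ g                              ≡⟨ ℚ.*-identityˡ _ ⟩
    base ^ℚ g ∎
    where
    open ≡-Reasoning
    open ℚSolver.+-*-Solver
    swap : ∀ a b c → a ℚ.* b ℚ.* c ≡ a ℚ.* c ℚ.* b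
    swap = solve 3 (λ a b c → a :* b :* c := a :* c :* b) refl

  ^ℚ-deficit : ∀ e g → base ^ℚ e ℚ.* base⁻ ^ℚ (e + g) ≡ base⁻ ^ℚ g
  ^ℚ-deficit e g = begin
    base ^ℚ e ℚ.* base⁻ ^ℚ (e + g)                ≡⟨ cong (base ^ℚ e ℚ.*_) (^ℚ-+ base⁻ e g) ⟩
    base ^ℚ e ℚ.* (base⁻ ^ℚ e ℚ.* base⁻ ^ℚ g)     ≡⟨ ℚ.*-assoc (base ^ℚ e) _ _ ⟨
    base ^ℚ e ℚ.* base⁻ ^ℚ e ℚ.* base⁻ ^ℚ g       ≡⟨ cong (ℚ._* base⁻ ^ℚ g) (^ℚ-inverse (ratio-inverse x y) e) ⟩
    1ℚ ℚ.* base⁻ ^ℚ g                             ≡⟨ ℚ.*-identityˡ _ ⟩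
    base⁻ ^ℚ g ∎
    where open ≡-Reasoning

ratio-^-≤ : ∀ x y .{{_ : NonZero y}} j a b → x ^ j * a ≤ b * y ^ j → ratio x y ^ℚ j ℚ.* fromℕ a ℚ.≤ fromℕ b
ratio-^-≤ x y j a b le = *-cancelʳ-fromℕ (y ^ j) {{m^n≢0 y j}} (begin
  ratio x y ^ℚ j ℚ.* fromℕ a ℚ.* fromℕ (y ^ j)    ≡⟨ swap (ratio x y ^ℚ j) (fromℕ a) (fromℕ (y ^ j)) ⟩
  ratio x y ^ℚ j ℚ.* fromℕ (y ^ j) ℚ.* fromℕ a    ≡⟨ cong (ℚ._* fromℕ a) (ratio-^-fromℕ x y j) ⟩
  fromℕ (x ^ j) ℚ.* fromℕ a                       ≡⟨ fromℕ-* (x ^ j) a ⟨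
  fromℕ (x ^ j * a)                               ≤⟨ fromℕ-mono le ⟩
  fromℕ (b * y ^ j)                               ≡⟨ fromℕ-* b (y ^ j) ⟩
  fromℕ b ℚ.* fromℕ (y ^ j) ∎)
  where
  open ℚ.≤-Reasoning
  open ℚSolver.+-*-Solver
  swap : ∀ a b c → a ℚ.* b ℚ.* c ≡ a ℚ.* c ℚ.* b
  swap = solve 3 (λ a b c → a :* b :* c := a :* c :* b) refl

ratio-^-≥ : ∀ x y .{{_ : NonZero y}} j a b → b * y ^ j ≤ x ^ j * a → fromℕ b ℚ.≤ ratio x y ^ℚ j ℚ.* fromℕ a
ratio-^-≥ x y j a b le = *-cancelʳ-fromℕ (y ^ j) {{m^n≢0 y j}} (begin
  fromℕ b ℚ.* fromℕ (y ^ j)                       ≡⟨ fromℕ-* b (y ^ j) ⟨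
  fromℕ (b * y ^ j)                               ≤⟨ fromℕ-mono le ⟩
  fromℕ (x ^ j * a)                               ≡⟨ fromℕ-* (x ^ j) a ⟩
  fromℕ (x ^ j) ℚ.* fromℕ a                       ≡⟨ cong (ℚ._* fromℕ a) (ratio-^-fromℕ x y j) ⟨
  ratio x y ^ℚ j ℚ.* fromℕ (y ^ j) ℚ.* fromℕ a    ≡⟨ swap (ratio x y ^ℚ j) (fromℕ (y ^ j)) (fromℕ a) ⟩
  ratio x y ^ℚ j ℚ.* fromℕ a ℚ.* fromℕ (y ^ j) ∎)
  where
  open ℚ.≤-Reasoning
  open ℚSolver.+-*-Solver
  swap : ∀ a b c → a ℚ.* b ℚ.* c ≡ a ℚ.* c ℚ.* b
  swap = solve 3 (λ a b c → a :* b :* c := a :* c :* b) refl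

^ℚ-antitone : ∀ {a} {j k} → 0ℚ ℚ.≤ a → a ℚ.≤ 1ℚ → j ≤ k → a ^ℚ k ℚ.≤ a ^ℚ j
^ℚ-antitone {a} {zero}  {zero}  0≤a a≤1 _ = ℚ.≤-refl
^ℚ-antitone {a} {zero}  {suc k} 0≤a a≤1 _ = begin
  a ℚ.* a ^ℚ k     ≤⟨ *-monoʳ-0≤ (0≤^ℚ k 0≤a) a≤1 ⟩
  1ℚ ℚ.* a ^ℚ k    ≡⟨ ℚ.*-identityˡ _ ⟩
  a ^ℚ k           ≤⟨ ^ℚ-antitone {j = 0} {k} 0≤a a≤1 z≤n ⟩
  1ℚ ∎
  where open ℚ.≤-Reasoning
^ℚ-antitone {a} {suc j} {suc k} 0≤a a≤1 (s≤s j≤k) = *-monoˡ-0≤ 0≤a (^ℚ-antitone 0≤a a≤1 j≤k)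

^ℚ-monotone : ∀ {a} {j k} → 1ℚ ℚ.≤ a → j ≤ k → a ^ℚ j ℚ.≤ a ^ℚ k
^ℚ-monotone {a} {zero}  {zero}  1≤a _ = ℚ.≤-refl
^ℚ-monotone {a} {zero}  {suc k} 1≤a _ = begin
  1ℚ               ≤⟨ ^ℚ-monotone {j = 0} {k} 1≤a z≤n ⟩
  a ^ℚ k           ≡⟨ ℚ.*-identityˡ _ ⟨
  1ℚ ℚ.* a ^ℚ k    ≤⟨ *-monoʳ-0≤ (0≤^ℚ k (ℚ.≤-trans (fromℕ-mono {0} {1} z≤n) 1≤a)) 1≤a ⟩
  a ℚ.* a ^ℚ k ∎
  where open ℚ.≤-Reasoning
^ℚ-monotone {a} {suc j} {suc k} 1≤a (s≤s j≤k) =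
  *-monoˡ-0≤ (ℚ.≤-trans (fromℕ-mono {0} {1} z≤n) 1≤a) (^ℚ-monotone 1≤a j≤k)

ratio≤1 : ∀ {x y} .{{_ : NonZero y}} → x ≤ y → ratio x y ℚ.≤ 1ℚ
ratio≤1 {x} {y} x≤y = *-cancelʳ-fromℕ y
  (subst₂ ℚ._≤_ (sym (ratio-*-fromℕ x y)) (sym (ℚ.*-identityˡ (fromℕ y))) (fromℕ-mono x≤y))

1≤ratio : ∀ {x y} .{{_ : NonZero y}} → y ≤ x → 1ℚ ℚ.≤ ratio x y
1≤ratio {x} {y} y≤x = *-cancelʳ-fromℕ y
  (subst₂ ℚ._≤_ (sym (ℚ.*-identityˡ (fromℕ y))) (sym (ratio-*-fromℕ x y)) (fromℕ-mono y≤x))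

^ℚ-decay : ∀ {x y} .{{_ : NonZero y}} D → x ≤ y → 2 * x ^ D ≤ y ^ D →
  ∀ T g → D * T ≤ g → fromℕ (2 ^ T) ℚ.* ratio x y ^ℚ g ℚ.≤ 1ℚ
^ℚ-decay {x} {y} D x≤y half T g DT≤g = ℚ.≤-trans
  (*-monoˡ-0≤ (0≤fromℕ (2 ^ T)) (^ℚ-antitone (0≤ratio x y) (ratio≤1 x≤y) DT≤g)) (go T)
  where
  open ℚ.≤-Reasoning
  a = ratio x y
  once : a ^ℚ D ℚ.* fromℕ 2 ℚ.≤ 1ℚ
  once = ratio-^-≤ x y D 2 1 (≤-trans (≤-reflexive (*-comm (x ^ D) 2)) (≤-trans half (≤-reflexive (sym (+-identityʳ (y ^ D))))))
  open ℚSolver.+-*-Solver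
  swap : ∀ a b c d → a ℚ.* b ℚ.* (c ℚ.* d) ≡ c ℚ.* a ℚ.* (b ℚ.* d)
  swap = solve 4 (λ a b c d → a :* b :* (c :* d) := c :* a :* (b :* d)) refl
  go : ∀ T → fromℕ (2 ^ T) ℚ.* a ^ℚ (D * T) ℚ.≤ 1ℚ
  go zero    = ℚ.≤-reflexive (cong (λ e → 1ℚ ℚ.* a ^ℚ e) (*-zeroʳ D))
  go (suc T) = begin
    fromℕ (2 * 2 ^ T) ℚ.* a ^ℚ (D * suc T)
      ≡⟨ cong₂ ℚ._*_ (fromℕ-* 2 (2 ^ T)) (trans (cong (a ^ℚ_) (*-suc D T)) (^ℚ-+ a D (D * T))) ⟩
    fromℕ 2 ℚ.* fromℕ (2 ^ T) ℚ.* (a ^ℚ D ℚ.* a ^ℚ (D * T))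
      ≡⟨ swap (fromℕ 2) (fromℕ (2 ^ T)) (a ^ℚ D) (a ^ℚ (D * T)) ⟩
    a ^ℚ D ℚ.* fromℕ 2 ℚ.* (fromℕ (2 ^ T) ℚ.* a ^ℚ (D * T))
      ≤⟨ *-monoʳ-0≤ (0≤* (0≤fromℕ (2 ^ T)) (0≤^ℚ (D * T) (0≤ratio x y))) once ⟩
    1ℚ ℚ.* (fromℕ (2 ^ T) ℚ.* a ^ℚ (D * T))
      ≡⟨ ℚ.*-identityˡ _ ⟩
    fromℕ (2 ^ T) ℚ.* a ^ℚ (D * T)
      ≤⟨ go T ⟩
    1ℚ ∎

-- Concentration of the truncated sums

module Tails (W : ℕ) .{{_ : NonZero W}} (Z : Fin W → ℕ) (μ s : ℕ)
  (∑Z : ∑ (allFin W) Z ≡ W * μ) (∑Z² : ∑ (allFin W) (λ i → Z i * Z i) ≤ W * s) where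

  -- Scaled by the denominator of ε so that deviations of size ε b are integral; D = q θ then bounds
  -- the scaled sample.
  Y : ℕ → ℕ → Fin W → ℕ
  Y q θ i = q * (Z i ⊓ θ)

  private
    module _ (q θ r : ℕ) (qs≤rθ : q * s ≤ r * θ) where

      -- The hypothesis on θ bounds the mean square of q Z by r D. In the quadratic estimates, which
      -- divide it by D², it contributes r/D, the same as a shift of the mean by r.
      ∑qZ² : ∑ (allFin W) (λ i → q * Z i * (q * Z i)) ≤ W * (r * (q * θ))
      ∑qZ² = begin
        ∑ (allFin W) (λ i → q * Z i * (q * Z i))
          ≡⟨ ∑-cong (allFin W) (λ i → lemma₁ q (Z i)) ⟩
        ∑ (allFin W) (λ i → q * q * (Z i * Z i))
          ≡⟨ ∑-*ˡ (q * q) _ (allFin W) ⟩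
        q * q * ∑ (allFin W) (λ i → Z i * Z i)
          ≤⟨ *-monoʳ-≤ (q * q) ∑Z² ⟩
        q * q * (W * s)
          ≡⟨ lemma₂ q W s ⟩
        q * W * (q * s)
          ≤⟨ *-monoʳ-≤ (q * W) qs≤rθ ⟩
        q * W * (r * θ)
          ≡⟨ lemma₃ q W r θ ⟩
        W * (r * (q * θ)) ∎
        where
        open ≤-Reasoning
        lemma₁ : ∀ q z → q * z * (q * z) ≡ q * q * (z * z)
        lemma₁ = solve-∀
        lemma₂ : ∀ q W s → q * q * (W * s) ≡ q * W * (q * s)
        lemma₂ = solve-∀
        lemma₃ : ∀ q W r θ → q * W * (r * θ) ≡ W * (r * (q * θ))
        lemma₃ = solve-∀

      ∑qZ : ∀ c → ∑ (allFin W) (λ i → q * Z i * c) ≡ W * (q * μ * c)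
      ∑qZ c = trans (∑-*ʳ c _ (allFin W)) (trans (cong (_* c) (trans (∑-*ˡ q Z (allFin W)) (cong (q *_) ∑Z))) (lemma q W μ c))
        where
        lemma : ∀ q W μ c → q * (W * μ) * c ≡ W * (q * μ * c)
        lemma = solve-∀

    ∑-const-allFin : ∀ c → ∑ (allFin W) (λ _ → c) ≡ W * c
    ∑-const-allFin c = trans (∑-const c (allFin W)) (cong (_* c) (length-tabulate {n = W} id))

  mgf-from : ∀ x y .{{_ : NonZero y}} (e : Fin W → ℕ) m D² .{{_ : NonZero D²}} X →
    ∑ℚ (λ i → ratio x y ^ℚ e i ℚ.* fromℕ D²) ℚ.≤ fromℕ W ℚ.* X →
    X ℚ.≤ ratio x y ^ℚ m ℚ.* fromℕ D² →
    ∑ℚ (λ i → ratio x y ^ℚ e i) ℚ.≤ fromℕ W ℚ.* ratio x y ^ℚ m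
  mgf-from x y e m D² X ∑≤ X≤ = *-cancelʳ-fromℕ D² (begin
    ∑ℚ (λ i → ratio x y ^ℚ e i) ℚ.* fromℕ D²
      ≡⟨ ℚSum.*-distribʳ-sum (fromℕ D²) (λ i → ratio x y ^ℚ e i) ⟩
    ∑ℚ (λ i → ratio x y ^ℚ e i ℚ.* fromℕ D²)
      ≤⟨ ∑≤ ⟩
    fromℕ W ℚ.* X
      ≤⟨ *-monoˡ-0≤ (0≤fromℕ W) X≤ ⟩
    fromℕ W ℚ.* (ratio x y ^ℚ m ℚ.* fromℕ D²)
      ≡⟨ ℚ.*-assoc (fromℕ W) (ratio x y ^ℚ m) (fromℕ D²) ⟨
    fromℕ W ℚ.* ratio x y ^ℚ m ℚ.* fromℕ D² ∎)
    where open ℚ.≤-Reasoning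

  -- Averaging 1 + y/D + (y/D)² gives at most 1 + (q μ + r)/D, and Bernoulli's inequality turns this
  -- back into a power of 1 + 1/D.
  mgf-upper : ∀ q θ r .{{_ : NonZero (q * θ)}} → q * s ≤ r * θ →
    ∑ℚ (λ i → ratio (suc (q * θ)) (q * θ) ^ℚ Y q θ i) ℚ.≤
    fromℕ W ℚ.* ratio (suc (q * θ)) (q * θ) ^ℚ (q * μ + r)
  mgf-upper q θ r qs≤rθ = mgf-from (suc D) D (Y q θ) (q * μ + r) (D * D) {{m*n≢0 D D}} (fromℕ (D * (D + (q * μ + r)))) sum-≤
    (ratio-^-≥ (suc D) D (q * μ + r) (D * D) (D * (D + (q * μ + r))) (begin
      D * (D + (q * μ + r)) * D ^ (q * μ + r)     ≡⟨ shuffle₁ D (q * μ + r) (D ^ (q * μ + r)) ⟩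
      D * (D ^ (q * μ + r) * (D + (q * μ + r)))   ≤⟨ *-monoʳ-≤ D (bernoulli D (q * μ + r)) ⟩
      D * (D * suc D ^ (q * μ + r))               ≡⟨ shuffle₂ D (suc D ^ (q * μ + r)) ⟩
      suc D ^ (q * μ + r) * (D * D) ∎))
    where
    open ≤-Reasoning
    D = q * θ
    shuffle₁ : ∀ D m x → D * (D + m) * x ≡ D * (x * (D + m))
    shuffle₁ = solve-∀
    shuffle₂ : ∀ D x → D * (D * x) ≡ x * (D * D)
    shuffle₂ = solve-∀
    shuffle₃ : ∀ W D x r → W * (D * D) + W * (x * D) + W * (r * D) ≡ W * (D * (D + (x + r)))
    shuffle₃ = solve-∀
    nat-≤ : ∑ (allFin W) (λ i → D * D + Y q θ i * D + Y q θ i * Y q θ i) ≤ W * (D * (D + (q * μ + r)))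
    nat-≤ = begin
      ∑ (allFin W) (λ i → D * D + Y q θ i * D + Y q θ i * Y q θ i)
        ≤⟨ ∑-mono (allFin W) (λ i → let Y≤ = *-monoʳ-≤ q (m⊓n≤m (Z i) θ) in
             +-mono-≤ (+-monoʳ-≤ (D * D) (*-monoˡ-≤ D Y≤)) (*-mono-≤ Y≤ Y≤)) ⟩
      ∑ (allFin W) (λ i → D * D + q * Z i * D + q * Z i * (q * Z i))
        ≡⟨ trans (∑-+ (λ i → D * D + q * Z i * D) _ (allFin W)) (cong (_+ _) (∑-+ (λ _ → D * D) _ (allFin W))) ⟩
      ∑ (allFin W) (λ _ → D * D) + ∑ (allFin W) (λ i → q * Z i * D) + ∑ (allFin W) (λ i → q * Z i * (q * Z i))
        ≤⟨ +-mono-≤ (+-mono-≤ (≤-reflexive (∑-const-allFin (D * D))) (≤-reflexive (∑qZ q θ r qs≤rθ D))) (∑qZ² q θ r qs≤rθ) ⟩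
      W * (D * D) + W * (q * μ * D) + W * (r * D)
        ≡⟨ shuffle₃ W D (q * μ) r ⟩
      W * (D * (D + (q * μ + r))) ∎
    sum-≤ : ∑ℚ (λ i → ratio (suc D) D ^ℚ Y q θ i ℚ.* fromℕ (D * D)) ℚ.≤ fromℕ W ℚ.* fromℕ (D * (D + (q * μ + r)))
    sum-≤ = ℚ.≤-trans
      (∑ℚ-mono (λ i → ratio-^-≤ (suc D) D (Y q θ i) (D * D) (D * D + Y q θ i * D + Y q θ i * Y q θ i) (exp-upper (Y q θ i) (*-monoʳ-≤ q (m⊓n≤n (Z i) θ)))))
      (subst₂ ℚ._≤_ (sym (∑ℚ-fromℕ (λ i → D * D + Y q θ i * D + Y q θ i * Y q θ i))) (fromℕ-* W (D * (D + (q * μ + r)))) (fromℕ-mono nat-≤))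

  -- Truncation costs nothing here: beyond θ the quadratic bound increases in Z.
  exp-lower-truncated : ∀ q θ E z → suc E ≡ q * θ →
    E ^ (q * (z ⊓ θ)) * (suc E * suc E) + q * z * suc E * suc E ^ (q * (z ⊓ θ)) ≤
    (suc E * suc E + q * z * (q * z)) * suc E ^ (q * (z ⊓ θ))
  exp-lower-truncated q θ E z D≡ with ≤-total z θ
  ... | inj₁ z≤θ rewrite m≤n⇒m⊓n≡m z≤θ = exp-lower E (q * z)
  ... | inj₂ θ≤z rewrite m≥n⇒m⊓n≡n θ≤z | sym D≡ = begin
    E ^ suc E * (suc E * suc E) + q * z * suc E * suc E ^ suc E
      ≤⟨ +-mono-≤ (cancelled) (*-monoˡ-≤ (suc E ^ suc E) (*-monoʳ-≤ (q * z) D≤qz)) ⟩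
    suc E * suc E * suc E ^ suc E + q * z * (q * z) * suc E ^ suc E
      ≡⟨ *-distribʳ-+ (suc E ^ suc E) (suc E * suc E) _ ⟨
    (suc E * suc E + q * z * (q * z)) * suc E ^ suc E ∎
    where
    open ≤-Reasoning
    D≤qz : suc E ≤ q * z
    D≤qz = ≤-trans (≤-reflexive D≡) (*-monoʳ-≤ q θ≤z)
    cancelled : E ^ suc E * (suc E * suc E) ≤ suc E * suc E * suc E ^ suc E
    cancelled = ≤-trans (*-monoˡ-≤ (suc E * suc E) (^-monoˡ-≤ (suc E) (n≤1+n E))) (≤-reflexive (*-comm (suc E ^ suc E) _))

  -- Averaging 1 - y/D + (y/D)² with y = q Z gives at most 1 - (q μ - r)/D = 1 - m/D, hence at most
  -- (1 - 1/D)^m. The linear term uses the untruncated Z, so r accounts for the loss by truncation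
  -- too.
  mgf-lower : ∀ q θ r E m → suc E ≡ q * θ → q * s ≤ r * θ → m + r ≡ q * μ →
    ∑ℚ (λ i → ratio E (suc E) ^ℚ Y q θ i) ℚ.≤ fromℕ W ℚ.* ratio E (suc E) ^ℚ m
  mgf-lower q θ r E m D≡ qs≤rθ m+r≡ = mgf-from E D (Y q θ) m (D * D) (a ^ℚ m ℚ.* fromℕ (D * D)) sum-≤ ℚ.≤-refl
    where
    D = suc E
    a = ratio E D
    pointwise : ∀ i → a ^ℚ Y q θ i ℚ.* fromℕ (D * D) ℚ.+ fromℕ (q * Z i * D) ℚ.≤ fromℕ (D * D + q * Z i * (q * Z i))
    pointwise i = *-cancelʳ-fromℕ (D ^ Y q θ i) {{m^n≢0 D (Y q θ i)}} (begin
      (a ^ℚ j ℚ.* fromℕ (D * D) ℚ.+ fromℕ (q * Z i * D)) ℚ.* fromℕ (D ^ j)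
        ≡⟨ swap (a ^ℚ j) (fromℕ (D * D)) (fromℕ (q * Z i * D)) (fromℕ (D ^ j)) ⟩
      a ^ℚ j ℚ.* fromℕ (D ^ j) ℚ.* fromℕ (D * D) ℚ.+ fromℕ (q * Z i * D) ℚ.* fromℕ (D ^ j)
        ≡⟨ cong₂ ℚ._+_ (cong (ℚ._* fromℕ (D * D)) (ratio-^-fromℕ E D j)) (sym (fromℕ-* (q * Z i * D) (D ^ j))) ⟩
      fromℕ (E ^ j) ℚ.* fromℕ (D * D) ℚ.+ fromℕ (q * Z i * D * D ^ j)
        ≡⟨ cong (ℚ._+ fromℕ (q * Z i * D * D ^ j)) (fromℕ-* (E ^ j) (D * D)) ⟨
      fromℕ (E ^ j * (D * D)) ℚ.+ fromℕ (q * Z i * D * D ^ j)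
        ≡⟨ fromℕ-+ (E ^ j * (D * D)) _ ⟨
      fromℕ (E ^ j * (D * D) + q * Z i * D * D ^ j)
        ≤⟨ fromℕ-mono (exp-lower-truncated q θ E (Z i) D≡) ⟩
      fromℕ ((D * D + q * Z i * (q * Z i)) * D ^ j)
        ≡⟨ fromℕ-* (D * D + q * Z i * (q * Z i)) (D ^ j) ⟩
      fromℕ (D * D + q * Z i * (q * Z i)) ℚ.* fromℕ (D ^ j) ∎)
      where
      open ℚ.≤-Reasoning
      j = Y q θ i
      open ℚSolver.+-*-Solver
      swap : ∀ a b c d → (a ℚ.* b ℚ.+ c) ℚ.* d ≡ a ℚ.* d ℚ.* b ℚ.+ c ℚ.* d
      swap = solve 4 (λ a b c d → (a :* b :+ c) :* d := a :* d :* b :+ c :* d) refl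
    bern : fromℕ D ℚ.≤ a ^ℚ m ℚ.* fromℕ D ℚ.+ fromℕ m
    bern = *-cancelʳ-fromℕ (D ^ m) {{m^n≢0 D m}} (begin
      fromℕ D ℚ.* fromℕ (D ^ m)                            ≡⟨ trans (sym (fromℕ-* D (D ^ m))) (cong fromℕ (*-comm D (D ^ m))) ⟩
      fromℕ (D ^ m * D)                                    ≤⟨ fromℕ-mono (bernoulli-lower E m) ⟩
      fromℕ (D * E ^ m + m * D ^ m)                        ≡⟨ fromℕ-+ (D * E ^ m) (m * D ^ m) ⟩
      fromℕ (D * E ^ m) ℚ.+ fromℕ (m * D ^ m)              ≡⟨ cong₂ ℚ._+_ (trans (fromℕ-* D (E ^ m)) (cong (fromℕ D ℚ.*_) (sym (ratio-^-fromℕ E D m)))) (fromℕ-* m (D ^ m)) ⟩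
      fromℕ D ℚ.* (a ^ℚ m ℚ.* fromℕ (D ^ m)) ℚ.+ fromℕ m ℚ.* fromℕ (D ^ m)
                                                           ≡⟨ swap (fromℕ D) (a ^ℚ m) (fromℕ (D ^ m)) (fromℕ m) ⟩
      (a ^ℚ m ℚ.* fromℕ D ℚ.+ fromℕ m) ℚ.* fromℕ (D ^ m) ∎)
      where
      open ℚ.≤-Reasoning
      open ℚSolver.+-*-Solver
      swap : ∀ a b c d → a ℚ.* (b ℚ.* c) ℚ.+ d ℚ.* c ≡ (b ℚ.* a ℚ.+ d) ℚ.* c
      swap = solve 4 (λ a b c d → a :* (b :* c) :+ d :* c := (b :* a :+ d) :* c) refl
    nat-≤ : ∑ (allFin W) (λ i → D * D + q * Z i * (q * Z i)) ≤ W * (D * D) + W * (r * D)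
    nat-≤ = ≤-trans (≤-reflexive (∑-+ (λ _ → D * D) _ (allFin W)))
      (+-mono-≤ (≤-reflexive (∑-const-allFin (D * D)))
                (≤-trans (∑qZ² q θ r qs≤rθ) (≤-reflexive (cong (λ d → W * (r * d)) (sym D≡)))))
    sum-≤ : ∑ℚ (λ i → a ^ℚ Y q θ i ℚ.* fromℕ (D * D)) ℚ.≤ fromℕ W ℚ.* (a ^ℚ m ℚ.* fromℕ (D * D))
    sum-≤ = +-cancelʳ-≤ℚ (fromℕ (W * (q * μ * D))) (begin
      ∑ℚ (λ i → a ^ℚ Y q θ i ℚ.* fromℕ (D * D)) ℚ.+ fromℕ (W * (q * μ * D))
        ≡⟨ cong (λ z → ∑ℚ (λ i → a ^ℚ Y q θ i ℚ.* fromℕ (D * D)) ℚ.+ fromℕ z) (∑qZ q θ r qs≤rθ D) ⟨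
      ∑ℚ (λ i → a ^ℚ Y q θ i ℚ.* fromℕ (D * D)) ℚ.+ fromℕ (∑ (allFin W) (λ i → q * Z i * D))
        ≡⟨ cong (∑ℚ (λ i → a ^ℚ Y q θ i ℚ.* fromℕ (D * D)) ℚ.+_) (∑ℚ-fromℕ (λ i → q * Z i * D)) ⟨
      ∑ℚ (λ i → a ^ℚ Y q θ i ℚ.* fromℕ (D * D)) ℚ.+ ∑ℚ (λ i → fromℕ (q * Z i * D))
        ≡⟨ ℚSum.∑-distrib-+ (λ i → a ^ℚ Y q θ i ℚ.* fromℕ (D * D)) (λ i → fromℕ (q * Z i * D)) ⟨
      ∑ℚ (λ i → a ^ℚ Y q θ i ℚ.* fromℕ (D * D) ℚ.+ fromℕ (q * Z i * D))
        ≤⟨ ∑ℚ-mono pointwise ⟩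
      ∑ℚ (λ i → fromℕ (D * D + q * Z i * (q * Z i)))
        ≡⟨ ∑ℚ-fromℕ (λ i → D * D + q * Z i * (q * Z i)) ⟩
      fromℕ (∑ (allFin W) (λ i → D * D + q * Z i * (q * Z i)))
        ≤⟨ fromℕ-mono nat-≤ ⟩
      fromℕ (W * (D * D) + W * (r * D))
        ≡⟨ trans (fromℕ-+ (W * (D * D)) _) (cong (ℚ._+ fromℕ (W * (r * D))) (trans (fromℕ-* W (D * D)) (cong (fromℕ W ℚ.*_) (fromℕ-* D D)))) ⟩
      fromℕ W ℚ.* (fromℕ D ℚ.* fromℕ D) ℚ.+ fromℕ (W * (r * D))
        ≤⟨ ℚ.+-monoˡ-≤ (fromℕ (W * (r * D))) (*-monoˡ-0≤ (0≤fromℕ W) (*-monoʳ-0≤ (0≤fromℕ D) bern)) ⟩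
      fromℕ W ℚ.* ((a ^ℚ m ℚ.* fromℕ D ℚ.+ fromℕ m) ℚ.* fromℕ D) ℚ.+ fromℕ (W * (r * D))
        ≡⟨ regroup (fromℕ W) (a ^ℚ m) (fromℕ D) (fromℕ m) (fromℕ (W * (r * D))) ⟩
      fromℕ W ℚ.* (a ^ℚ m ℚ.* (fromℕ D ℚ.* fromℕ D)) ℚ.+ (fromℕ W ℚ.* (fromℕ m ℚ.* fromℕ D) ℚ.+ fromℕ (W * (r * D)))
        ≡⟨ cong₂ (λ u v → fromℕ W ℚ.* (a ^ℚ m ℚ.* u) ℚ.+ v) (sym (fromℕ-* D D)) collect ⟩
      fromℕ W ℚ.* (a ^ℚ m ℚ.* fromℕ (D * D)) ℚ.+ fromℕ (W * (q * μ * D)) ∎)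
      where
      open ℚ.≤-Reasoning
      distribute : ∀ W m D r → W * (m * D) + W * (r * D) ≡ W * ((m + r) * D)
      distribute = solve-∀
      collect : fromℕ W ℚ.* (fromℕ m ℚ.* fromℕ D) ℚ.+ fromℕ (W * (r * D)) ≡ fromℕ (W * (q * μ * D))
      collect = trans (cong (ℚ._+ fromℕ (W * (r * D))) (trans (cong (fromℕ W ℚ.*_) (sym (fromℕ-* m D))) (sym (fromℕ-* W (m * D)))))
        (trans (sym (fromℕ-+ (W * (m * D)) (W * (r * D)))) (cong fromℕ (trans (distribute W m D r) (cong (λ z → W * (z * D)) m+r≡))))
      open ℚSolver.+-*-Solver
      regroup : ∀ w a d m x → w ℚ.* ((a ℚ.* d ℚ.+ m) ℚ.* d) ℚ.+ x ≡ w ℚ.* (a ℚ.* (d ℚ.* d)) ℚ.+ (w ℚ.* (m ℚ.* d) ℚ.+ x)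
      regroup = solve 5 (λ w a d m x → w :* ((a :* d :+ m) :* d) :+ x := w :* (a :* (d :* d)) :+ (w :* (m :* d) :+ x)) refl

  truncated : ℕ → List (Fin W) → ℕ
  truncated θ h = ∑ h (λ i → Z i ⊓ θ)

  -- The thresholds θ, θ′ for the lower and the upper tail may differ.
  tails : ∀ q r N T θ θ′ .{{_ : NonZero q}} → 2 ≤ θ → 2 ≤ θ′ → 2 * r ≤ q * μ →
    q * s ≤ r * θ → q * s ≤ r * θ′ → q * θ * T ≤ N * r → q * θ′ * T ≤ N * r →
    {P : Pred (List (Fin W)) 0ℓ} (P? : Decidable P) →
    (∀ h → P h → q * truncated θ h + 2 * (N * r) ≤ N * (q * μ) ⊎ N * (q * μ) + 2 * (N * r) ≤ q * truncated θ′ h) →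
    fromℕ (2 ^ T) ℚ.* Pr P? (drawsFrom W N []) ℚ.≤ fromℕ 2
  tails q r N T θ θ′ 2≤θ 2≤θ′ 2r≤qμ low up lowT upT {P} P? split = go (q * θ) refl D≥2
    where
    D≥2 : 2 ≤ q * θ
    D≥2 = ≤-trans 2≤θ (m≤n*m θ q)
    go : ∀ D → D ≡ q * θ → 2 ≤ D → fromℕ (2 ^ T) ℚ.* Pr P? (drawsFrom W N []) ℚ.≤ fromℕ 2
    -- D = q θ is at least 2, so E = D - 1 is positive and the base E/D has an inverse.
    go (suc E@(suc _)) D≡ _ = begin
      fromℕ (2 ^ T) ℚ.* Pr P? (drawsFrom W N [])
        ≤⟨ *-monoˡ-0≤ (0≤fromℕ (2 ^ T)) (supermartingale P? Φ step 0≤Φ P⇒1≤Φ N []) ⟩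
      fromℕ (2 ^ T) ℚ.* (L.Φ H N [] ℚ.+ U.Φ H′ N [])
        ≡⟨ ℚ.*-distribˡ-+ (fromℕ (2 ^ T)) (L.Φ H N []) (U.Φ H′ N []) ⟩
      fromℕ (2 ^ T) ℚ.* L.Φ H N [] ℚ.+ fromℕ (2 ^ T) ℚ.* U.Φ H′ N []
        ≤⟨ ℚ.+-mono-≤ lower-end upper-end ⟩
      1ℚ ℚ.+ 1ℚ ∎
      where
      open ℚ.≤-Reasoning
      D′ = q * θ′
      instance
        D′≢0 : NonZero D′
        D′≢0 = >-nonZero (≤-trans (s≤s z≤n) (≤-trans 2≤θ′ (m≤n*m θ′ q)))
      m = q * μ ∸ r
      m+r : m + r ≡ q * μ
      m+r = m∸n+n≡m (≤-trans (m≤n*m r 2) 2r≤qμ)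
      m′ = q * μ + r
      module L = Chernoff W E (suc E) (Y q θ) m
      module U = Chernoff W (suc D′) D′ (Y q θ′) m′
      -- The margin 2 N r is split: one N r is absorbed by the exponents m = q μ - r and m′ = q μ +
      -- r of the moment bounds, the other remains in H and H′. The potentials then start at (1 ∓
      -- 1/D)^(N r) or its inverse, which halves every D steps and so is at most 2^-T.
      H′ = m′ * N + N * r
      H = m * N ∸ N * r
      -- The union bound over the two tails: a sum of supermartingales is one.
      Φ : ℕ → List (Fin W) → ℚ
      Φ k h = L.Φ H k h ℚ.+ U.Φ H′ k h
      0≤Φ : ∀ h → 0ℚ ℚ.≤ Φ 0 h
      0≤Φ h = 0≤+ (L.0≤Φ H 0 h) (U.0≤Φ H′ 0 h)
      step : ∀ k h → ∑ℚ (λ i → ratio 1 W ℚ.* Φ k (i ∷ h)) ℚ.≤ Φ (suc k) h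
      step k h = ℚ.≤-trans
        (ℚ.≤-reflexive (trans (∑ℚ-cong (λ i → ℚ.*-distribˡ-+ (ratio 1 W) (L.Φ H k (i ∷ h)) (U.Φ H′ k (i ∷ h))))
          (ℚSum.∑-distrib-+ (λ i → ratio 1 W ℚ.* L.Φ H k (i ∷ h)) (λ i → ratio 1 W ℚ.* U.Φ H′ k (i ∷ h)))))
        (ℚ.+-mono-≤ (L.Φ-step (mgf-lower q θ r E m D≡ low m+r) H k h) (U.Φ-step (mgf-upper q θ′ r up) H′ k h))
      ∑Y : ∀ θ h → ∑ h (Y q θ) ≡ q * truncated θ h
      ∑Y θ h = ∑-*ˡ q _ h
      E≤ : ratio E (suc E) ℚ.≤ 1ℚ
      E≤ = ratio≤1 (n≤1+n E)
      final : ∀ {a b} → a ℚ.* b ≡ 1ℚ → 0ℚ ℚ.≤ b → ∀ {e H} → a ^ℚ H ℚ.≤ a ^ℚ e → 1ℚ ℚ.≤ a ^ℚ e ℚ.* b ^ℚ H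
      final {a} {b} ab 0≤b {e} {H} le = subst (ℚ._≤ a ^ℚ e ℚ.* b ^ℚ H) (^ℚ-inverse ab H) (*-monoʳ-0≤ (0≤^ℚ H 0≤b) le)
      shift : ∀ x y z → x + 2 * z ≤ y → x ≤ y ∸ z ∸ z
      shift x y z le = m+n≤o⇒m≤o∸n x (m+n≤o⇒m≤o∸n (x + z) (≤-trans (≤-reflexive (lemma x z)) le))
        where
        lemma : ∀ x z → x + z + z ≡ x + 2 * z
        lemma = solve-∀
      mN : m * N ≡ N * (q * μ) ∸ N * r
      mN = trans (*-comm m N) (*-distribˡ-∸ N (q * μ) r)
      P⇒1≤Φ : ∀ h → P h → 1ℚ ℚ.≤ Φ 0 h
      P⇒1≤Φ h ph with split h ph
      ... | inj₁ S≤ = ℚ.≤-trans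
        (final {L.base} {L.base⁻} (ratio-inverse E (suc E)) (0≤ratio (suc E) E) {m * 0 + ∑ h (Y q θ)} {H}
          (^ℚ-antitone (0≤ratio E (suc E)) E≤ (begin-≤ h S≤)))
        (p≤p+q (U.0≤Φ H′ 0 h))
        where
        begin-≤ : ∀ h → q * truncated θ h + 2 * (N * r) ≤ N * (q * μ) → m * 0 + ∑ h (Y q θ) ≤ H
        begin-≤ h S≤ = ≤-trans (≤-reflexive (cong₂ _+_ (*-zeroʳ m) (∑Y θ h)))
          (≤-trans (shift _ _ (N * r) S≤) (≤-reflexive (cong (_∸ N * r) (sym mN))))
      ... | inj₂ S≥ = ℚ.≤-trans
        (final {U.base} {U.base⁻} (ratio-inverse (suc D′) D′) (0≤ratio D′ (suc D′)) {m′ * 0 + ∑ h (Y q θ′)} {H′}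
          (^ℚ-monotone (1≤ratio (n≤1+n D′)) (≤-trans (≤-reflexive (lemma (q * μ) r N))
            (≤-trans S≥ (≤-reflexive (sym (cong₂ _+_ (*-zeroʳ m′) (∑Y θ′ h))))))))
        (q≤p+q (L.0≤Φ H 0 h))
        where
        lemma : ∀ x r N → (x + r) * N + N * r ≡ N * x + 2 * (N * r)
        lemma = solve-∀
      Nr≤mN : N * r ≤ m * N
      Nr≤mN = ≤-trans (*-monoʳ-≤ N (+-cancelʳ-≤ r r m (≤-trans (≤-reflexive (lemma r)) (≤-trans 2r≤qμ (≤-reflexive (sym m+r))))))
        (≤-reflexive (*-comm N m))
        where
        lemma : ∀ r → r + r ≡ 2 * r
        lemma = solve-∀
      lower-end : fromℕ (2 ^ T) ℚ.* L.Φ H N [] ℚ.≤ 1ℚ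
      lower-end = subst (λ z → fromℕ (2 ^ T) ℚ.* z ℚ.≤ 1ℚ)
        (sym (trans (cong (λ e → L.base ^ℚ e ℚ.* L.base⁻ ^ℚ H) (trans (+-identityʳ (m * N)) (sym (m∸n+n≡m Nr≤mN))))
          (L.^ℚ-excess H (N * r))))
        (^ℚ-decay (suc E) (n≤1+n E) (^-double-lower E) T (N * r) (subst (λ d → d * T ≤ N * r) (sym D≡) lowT))
      upper-end : fromℕ (2 ^ T) ℚ.* U.Φ H′ N [] ℚ.≤ 1ℚ
      upper-end = subst (λ z → fromℕ (2 ^ T) ℚ.* z ℚ.≤ 1ℚ)
        (sym (trans (cong (λ e → U.base ^ℚ e ℚ.* U.base⁻ ^ℚ H′) (+-identityʳ (m′ * N)))
          (U.^ℚ-deficit (m′ * N) (N * r))))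
        (^ℚ-decay D′ (n≤1+n D′) (^-double D′) T (N * r) upT)
    go (suc zero) D≡ (s≤s ())

-- Choice of the truncation level

n<2^n : ∀ n → n < 2 ^ n
n<2^n zero    = s≤s z≤n
n<2^n (suc n) = begin-strict
  suc n               ≤⟨ n<2^n n ⟩
  2 ^ n               <⟨ m<m+n (2 ^ n) (m^n>0 2 n) ⟩
  2 ^ n + 2 ^ n       ≡⟨ cong (λ x → 2 ^ n + x) (+-identityʳ (2 ^ n)) ⟨
  2 ^ suc n ∎
  where open ≤-Reasoning

dyadic-between : ∀ p X → 0 < p → p ≤ X → ∃ λ a → X ≤ p * 2 ^ a × p * 2 ^ a < 2 * X
dyadic-between p X 0<p p≤X = go X (≤-trans (<⇒≤ (n<2^n X)) (m≤n*m (2 ^ X) p {{>-nonZero 0<p}}))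
  where
  X<2X : X < 2 * X
  X<2X = ≤-trans (m<m+n X (≤-trans 0<p p≤X)) (≤-reflexive (cong (λ x → X + x) (sym (+-identityʳ X))))
  go : ∀ k → X ≤ p * 2 ^ k → ∃ λ a → X ≤ p * 2 ^ a × p * 2 ^ a < 2 * X
  go zero    le = 0 , le , ≤-trans (s≤s (≤-trans (≤-reflexive (*-identityʳ p)) p≤X)) X<2X
  go (suc k) le with X ≤? p * 2 ^ k
  ... | yes le′ = go k le′
  ... | no  nle = suc k , le , ≤-trans (s≤s (≤-reflexive (lemma p (2 ^ k)))) (*-monoʳ-< 2 (≰⇒> nle))
    where
    lemma : ∀ p x → p * (2 * x) ≡ 2 * (p * x)
    lemma = solve-∀

-- Truncation is concave in θ and vanishes at θ = 0, so z ⊓ θ divided by θ decreases.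
⊓-slope : ∀ z {θ θ′} → θ ≤ θ′ → (z ⊓ θ′) * θ ≤ (z ⊓ θ) * θ′
⊓-slope z {θ} {θ′} θ≤θ′ with ≤-total z θ
... | inj₁ z≤θ rewrite m≤n⇒m⊓n≡m z≤θ | m≤n⇒m⊓n≡m (≤-trans z≤θ θ≤θ′) = *-monoʳ-≤ z θ≤θ′
... | inj₂ θ≤z rewrite m≥n⇒m⊓n≡n θ≤z = ≤-trans (*-monoˡ-≤ θ (m⊓n≤n z θ′)) (≤-reflexive (*-comm θ′ θ))

-- With S near 4 N B the threshold for 2^j is near 16 M B / ε. Where S is off by at most half of
-- that, between 2 N B and 6 N B, the threshold lies between 8 and 24 times M B / ε. The levels of
-- the tails are placed around this range: 2^a < 8 M B / ε and 2^(3 + a) ≥ 32 M B / ε. This is the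
-- origin of the factor 4 here and of the 3.
record Selects (M N p q L : ℕ) (S : ℕ → ℕ) (J : ℕ) : Set where
  field
    J≤L      : J ≤ L
    continue : ∀ {j} → j < J → 2 ^ j * (N * p) < 4 * (M * (q * S j))
    halt     : J < L → 4 * (M * (q * S J)) ≤ 2 ^ J * (N * p)

module _ {M N p q L : ℕ} {S : ℕ → ℕ} {J : ℕ} (sel : Selects M N p q L S J)
  (mono : ∀ {i j} → i ≤ j → S i ≤ S j)
  (slope : ∀ {i j} → i ≤ j → S j * 2 ^ i ≤ S i * 2 ^ j)
  (saturated : ∀ {j} → L ≤ j → S j ≡ S L)
  (b a : ℕ) (0<N : 0 < N) (p≤q : p ≤ q)
  (a-lower : 4 * (M * (q * b)) ≤ p * 2 ^ a) (a-upper : p * 2 ^ a < 2 * (4 * (M * (q * b))))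
  (S-lower : N * (q * (4 * b)) < q * S a + 2 * (N * (p * b)))
  (S-upper : q * S (3 + a) < N * (q * (4 * b)) + 2 * (N * (p * b)))
  where

  open Selects sel
  open ≤-Reasoning

  private
    Npb≤Nqb : N * (p * b) ≤ N * (q * b)
    Npb≤Nqb = *-monoʳ-≤ N (*-monoˡ-≤ b p≤q)

    J≤3+a : J ≤ 3 + a
    J≤3+a = ≮⇒≥ λ lt → <-irrefl refl (begin-strict
      2 ^ (3 + a) * (N * p)
        <⟨ continue lt ⟩
      4 * (M * (q * S (3 + a)))
        ≤⟨ *-monoʳ-≤ 4 (*-monoʳ-≤ M (<⇒≤ S-upper)) ⟩
      4 * (M * (N * (q * (4 * b)) + 2 * (N * (p * b))))
        ≤⟨ *-monoʳ-≤ 4 (*-monoʳ-≤ M (+-monoʳ-≤ (N * (q * (4 * b))) (*-monoʳ-≤ 2 Npb≤Nqb))) ⟩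
      4 * (M * (N * (q * (4 * b)) + 2 * (N * (q * b))))
        ≡⟨ lemma₁ M N q b ⟩
      24 * (N * (M * (q * b)))
        ≤⟨ *-monoˡ-≤ (N * (M * (q * b))) {24} {32} (m≤m+n 24 8) ⟩
      32 * (N * (M * (q * b)))
        ≡⟨ lemma₂ M N q b ⟩
      8 * (N * (4 * (M * (q * b))))
        ≤⟨ *-monoʳ-≤ 8 (*-monoʳ-≤ N a-lower) ⟩
      8 * (N * (p * 2 ^ a))
        ≡⟨ lemma₃ N p (2 ^ a) ⟩
      2 ^ (3 + a) * (N * p) ∎)
      where
      lemma₁ : ∀ M N q b → 4 * (M * (N * (q * (4 * b)) + 2 * (N * (q * b)))) ≡ 24 * (N * (M * (q * b)))
      lemma₁ = solve-∀
      lemma₂ : ∀ M N q b → 32 * (N * (M * (q * b))) ≡ 8 * (N * (4 * (M * (q * b))))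
      lemma₂ = solve-∀
      lemma₃ : ∀ N p x → 8 * (N * (p * x)) ≡ 2 * (2 * (2 * x)) * (N * p)
      lemma₃ = solve-∀

    -- Stopping below both a and L would make S a too small.
    J≮a∧L : J < a → J < L → ⊥
    J≮a∧L J<a J<L = <-irrefl refl (begin-strict
      2 ^ J * (N * (2 * (4 * (M * (q * b)))))
        ≡⟨ lemma₁ (2 ^ J) M N q b ⟩
      2 ^ J * (4 * M) * (2 * (N * (q * b)))
        ≤⟨ *-monoʳ-≤ (2 ^ J * (4 * M)) 2Nqb≤qSa ⟩
      2 ^ J * (4 * M) * (q * S a)
        ≡⟨ lemma₂ (2 ^ J) M q (S a) ⟩
      4 * (M * q) * (S a * 2 ^ J)
        -- Concavity transfers the bound from level a, where the tail is controlled, to level J,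
        -- where nothing is known.
        ≤⟨ *-monoʳ-≤ (4 * (M * q)) (slope (<⇒≤ J<a)) ⟩
      4 * (M * q) * (S J * 2 ^ a)
        ≡⟨ lemma₃ M q (S J) (2 ^ a) ⟩
      4 * (M * (q * S J)) * 2 ^ a
        ≤⟨ *-monoˡ-≤ (2 ^ a) (halt J<L) ⟩
      2 ^ J * (N * p) * 2 ^ a
        ≡⟨ lemma₄ (2 ^ J) N p (2 ^ a) ⟩
      2 ^ J * (N * (p * 2 ^ a))
        <⟨ *-monoʳ-< (2 ^ J) {{m^n≢0 2 J}} (*-monoʳ-< N {{>-nonZero 0<N}} a-upper) ⟩
      2 ^ J * (N * (2 * (4 * (M * (q * b))))) ∎)
      where
      lemma₁ : ∀ x M N q b → x * (N * (2 * (4 * (M * (q * b))))) ≡ x * (4 * M) * (2 * (N * (q * b)))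
      lemma₁ = solve-∀
      lemma₂ : ∀ x M q s → x * (4 * M) * (q * s) ≡ 4 * (M * q) * (s * x)
      lemma₂ = solve-∀
      lemma₃ : ∀ M q s x → 4 * (M * q) * (s * x) ≡ 4 * (M * (q * s)) * x
      lemma₃ = solve-∀
      lemma₄ : ∀ x N p y → x * (N * p) * y ≡ x * (N * (p * y))
      lemma₄ = solve-∀
      lemma₅ : ∀ N q b → 2 * (N * (q * b)) + 2 * (N * (q * b)) ≡ N * (q * (4 * b))
      lemma₅ = solve-∀
      2Nqb≤qSa : 2 * (N * (q * b)) ≤ q * S a
      2Nqb≤qSa = +-cancelʳ-≤ (2 * (N * (q * b))) _ _ (begin
        2 * (N * (q * b)) + 2 * (N * (q * b))   ≡⟨ lemma₅ N q b ⟩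
        N * (q * (4 * b))                       ≤⟨ <⇒≤ S-lower ⟩
        q * S a + 2 * (N * (p * b))             ≤⟨ +-monoʳ-≤ (q * S a) (*-monoʳ-≤ 2 Npb≤Nqb) ⟩
        q * S a + 2 * (N * (q * b)) ∎)

    Sa≤SJ : S a ≤ S J
    Sa≤SJ with ≤-total a J
    ... | inj₁ a≤J = mono a≤J
    ... | inj₂ J≤a with m≤n⇒m<n∨m≡n J≤a
    ...   | inj₂ refl = ≤-refl
    ...   | inj₁ J<a with m≤n⇒m<n∨m≡n J≤L
    ...     | inj₁ J<L  = ⊥-elim (J≮a∧L J<a J<L)
    ...     | inj₂ refl = ≤-reflexive (saturated J≤a)

  selected-lower : N * (q * (4 * b)) ≤ q * S J + 2 * (N * (p * b))
  selected-lower = ≤-trans (<⇒≤ S-lower) (+-monoˡ-≤ (2 * (N * (p * b))) (*-monoʳ-≤ q Sa≤SJ))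

  selected-upper : q * S J ≤ N * (q * (4 * b)) + 2 * (N * (p * b))
  selected-upper = ≤-trans (*-monoʳ-≤ q (mono J≤3+a)) (<⇒≤ S-upper)

-- The deviation 2 N p b against the mean 4 N q b is a relative error of ε/2, so the bounds leave a
-- factor 2 of slack. The divisor 4 N converts a sum of quarters into a mean.
accurate : ∀ p q b N s .{{_ : NonZero q}} .{{_ : NonZero N}} →
  N * (q * (4 * b)) ≤ q * s + 2 * (N * (p * b)) →
  q * s ≤ N * (q * (4 * b)) + 2 * (N * (p * b)) →
  ¬ (ratio p q ℚ.* fromℕ b ℚ.< ℚ.∣ ratio s (4 * N) ℚ.- fromℕ b ∣)
accurate p q b N s lower upper bad = ℚ.<-irrefl refl (ℚ.<-≤-trans bad close)
  where
  z = ratio s (4 * N)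
  εb = ratio p q ℚ.* fromℕ b
  instance
    4N≢0 : NonZero (4 * N)
    4N≢0 = m*n≢0 4 N
    Q≢0 : NonZero (q * (4 * N))
    Q≢0 = m*n≢0 q (4 * N)
  Q = fromℕ (q * (4 * N))
  open ℚSolver.+-*-Solver
  zQ : z ℚ.* Q ≡ fromℕ (q * s)
  zQ = trans (cong (z ℚ.*_) (fromℕ-* q (4 * N)))
    (trans (solve 3 (λ z q n → z :* (q :* n) := q :* (z :* n)) refl z (fromℕ q) (fromℕ (4 * N)))
      (trans (cong (fromℕ q ℚ.*_) (ratio-*-fromℕ s (4 * N))) (sym (fromℕ-* q s))))
  εQ : εb ℚ.* Q ≡ fromℕ (p * (b * (4 * N)))
  εQ = trans (cong (εb ℚ.*_) (fromℕ-* q (4 * N)))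
    (trans (solve 4 (λ e b q n → e :* b :* (q :* n) := e :* q :* (b :* n)) refl (ratio p q) (fromℕ b) (fromℕ q) (fromℕ (4 * N)))
      (trans (cong₂ ℚ._*_ (ratio-*-fromℕ p q) (sym (fromℕ-* b (4 * N)))) (sym (fromℕ-* p (b * (4 * N))))))
  bQ : fromℕ b ℚ.* Q ≡ fromℕ (b * (q * (4 * N)))
  bQ = sym (fromℕ-* b (q * (4 * N)))
  arith₁ : ∀ N q b p → N * (q * (4 * b)) + 2 * (N * (p * b)) + 2 * (N * (p * b)) ≡ b * (q * (4 * N)) + p * (b * (4 * N))
  arith₁ = solve-∀
  arith₂ : ∀ N q b → N * (q * (4 * b)) ≡ b * (q * (4 * N))
  arith₂ = solve-∀
  arith₃ : ∀ N p b s → s + 2 * (N * (p * b)) + 2 * (N * (p * b)) ≡ s + p * (b * (4 * N))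
  arith₃ = solve-∀
  z≤ : z ℚ.≤ fromℕ b ℚ.+ εb
  z≤ = *-cancelʳ-fromℕ (q * (4 * N)) (subst₂ ℚ._≤_ (sym zQ)
    (trans (fromℕ-+ (b * (q * (4 * N))) (p * (b * (4 * N)))) (sym (trans (ℚ.*-distribʳ-+ Q (fromℕ b) εb) (cong₂ ℚ._+_ bQ εQ))))
    (fromℕ-mono (≤-trans upper (≤-trans (m≤m+n _ (2 * (N * (p * b)))) (≤-reflexive (arith₁ N q b p))))))
  b≤ : fromℕ b ℚ.≤ z ℚ.+ εb
  b≤ = *-cancelʳ-fromℕ (q * (4 * N)) (subst₂ ℚ._≤_ (sym bQ)
    (trans (fromℕ-+ (q * s) (p * (b * (4 * N)))) (sym (trans (ℚ.*-distribʳ-+ Q z εb) (cong₂ ℚ._+_ zQ εQ))))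
    (fromℕ-mono (≤-trans (≤-reflexive (sym (arith₂ N q b)))
      (≤-trans lower (≤-trans (m≤m+n _ (2 * (N * (p * b)))) (≤-reflexive (arith₃ N p b (q * s))))))))
  close : ℚ.∣ z ℚ.- fromℕ b ∣ ℚ.≤ εb
  close with ℚ.∣p∣≡p∨∣p∣≡-p (z ℚ.- fromℕ b)
  ... | inj₁ h = ℚ.≤-trans (ℚ.≤-reflexive h) (+-cancelʳ-≤ℚ (fromℕ b) (subst₂ ℚ._≤_
    (solve 2 (λ z b → z := z :- b :+ b) refl z (fromℕ b)) (ℚ.+-comm (fromℕ b) εb) z≤))
  ... | inj₂ h = ℚ.≤-trans (ℚ.≤-reflexive h) (+-cancelʳ-≤ℚ z (subst₂ ℚ._≤_
    (solve 2 (λ z b → b := (:- (z :- b)) :+ z) refl z (fromℕ b)) (ℚ.+-comm z εb) b≤))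

module Levels {W : ℕ} (Z : Fin W → ℕ) where

  level : List (Fin W) → ℕ → ℕ
  level h j = ∑ h (λ i → Z i ⊓ 2 ^ j)

  level-mono : ∀ h {i j} → i ≤ j → level h i ≤ level h j
  level-mono h i≤j = ∑-mono h (λ w → ⊓-monoʳ-≤ (Z w) (^-monoʳ-≤ 2 i≤j))

  level-slope : ∀ h {i j} → i ≤ j → level h j * 2 ^ i ≤ level h i * 2 ^ j
  level-slope h {i} {j} i≤j = subst₂ _≤_ (∑-*ʳ (2 ^ i) _ h) (∑-*ʳ (2 ^ j) _ h)
    (∑-mono h (λ w → ⊓-slope (Z w) (^-monoʳ-≤ 2 i≤j)))

  level-saturated : ∀ h L → (∀ i → Z i ≤ 2 ^ L) → ∀ {j} → L ≤ j → level h j ≡ level h L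
  level-saturated h L Z≤ L≤j = ∑-cong h (λ w → trans
    (m≤n⇒m⊓n≡m (≤-trans (Z≤ w) (^-monoʳ-≤ 2 L≤j))) (sym (m≤n⇒m⊓n≡m (Z≤ w))))

  level-≤ : ∀ h j V → (∀ i → Z i ≤ V) → level h j ≤ length h * V
  level-≤ h j V Z≤ = ≤-trans (∑-mono h (λ i → ≤-trans (m⊓n≤m (Z i) (2 ^ j)) (Z≤ i))) (≤-reflexive (∑-const V h))

-- Couplings of random trees that draw the same numbers

data Lift {A A′ : Set} (R : A → A′ → Set) : Rand A → Rand A′ → Set where
  return : ∀ {a a′} → R a a′ → Lift R (return a) (return a′)
  choose : ∀ {k w f f′} → (∀ i → 0ℚ ℚ.≤ w i) → (∀ i → Lift R (f i) (f′ i)) →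
           Lift R (choose k w f) (choose k w f′)

module _ {A A′ : Set} {R : A → A′ → Set} where

  Lift-map : ∀ {S : A → A′ → Set} {r r′} → (∀ {a a′} → R a a′ → S a a′) → Lift R r r′ → Lift S r r′
  Lift-map f (return x)   = return (f x)
  Lift-map f (choose 0≤w fs) = choose 0≤w (λ i → Lift-map f (fs i))

  Lift->>= : ∀ {K K′ : Set} {S : K → K′ → Set} {r r′ g g′} → Lift R r r′ →
    (∀ {a a′} → R a a′ → Lift S (g a) (g′ a′)) → Lift S (r >>= g) (r′ >>= g′)
  Lift->>= (return x)   h = h x
  Lift->>= (choose 0≤w fs) h = choose 0≤w (λ i → Lift->>= (fs i) h)

  Lift->>=-return : ∀ {K : Set} {S : K → A′ → Set} (g : A → K) {r r′} → Lift R r r′ →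
    (∀ {a a′} → R a a′ → S (g a) a′) → Lift S (r >>= λ a → return (g a)) r′
  Lift->>=-return g (return x)      h = return (h x)
  Lift->>=-return g (choose 0≤w fs) h = choose 0≤w (λ i → Lift->>=-return g (fs i) h)

  Lift-outcome : ∀ {r r′ a} → Lift R r r′ → a outcomeOf r → ∃ λ a′ → R a a′
  Lift-outcome (return x)   here         = _ , x
  Lift-outcome (choose _ fs) (branch i o) = Lift-outcome (fs i) o

  Lift-Pr-≤ : ∀ {P : Pred A 0ℓ} {P′ : Pred A′ 0ℓ} (P? : Decidable P) (P′? : Decidable P′) →
    (∀ {a a′} → R a a′ → P a → P′ a′) → ∀ {r r′} → Lift R r r′ → Pr P? r ℚ.≤ Pr P′? r′
  Lift-Pr-≤ P? P′? P⇒P′ (return {a} {a′} x) with P? a | P′? a′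
  ... | yes p | yes _  = ℚ.≤-refl
  ... | yes p | no ¬p′ = contradiction (P⇒P′ x p) ¬p′
  ... | no _  | yes _  = fromℕ-mono {0} {1} z≤n
  ... | no _  | no _   = ℚ.≤-refl
  Lift-Pr-≤ P? P′? P⇒P′ (choose 0≤w fs) = ∑ℚ-mono (λ i → *-monoˡ-0≤ (0≤w i) (Lift-Pr-≤ P? P′? P⇒P′ (fs i)))

  Lift-Pr-≡ : ∀ {P : Pred A 0ℓ} {P′ : Pred A′ 0ℓ} (P? : Decidable P) (P′? : Decidable P′) →
    (∀ {a a′} → R a a′ → does (P? a) ≡ does (P′? a′)) → ∀ {r r′} → Lift R r r′ → Pr P? r ≡ Pr P′? r′
  Lift-Pr-≡ P? P′? P≡P′ (return x) rewrite P≡P′ x = refl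
  Lift-Pr-≡ P? P′? P≡P′ (choose {w = w} 0≤w fs) = ∑ℚ-cong (λ i → cong (w i ℚ.*_) (Lift-Pr-≡ P? P′? P≡P′ (fs i)))

>>=-return-outcome : ∀ {A A′ : Set} {g : A → A′} {r a} → a outcomeOf (r >>= λ x → return (g x)) →
  ∃ λ x → x outcomeOf r × a ≡ g x
>>=-return-outcome {r = return x} here = x , here , refl
>>=-return-outcome {r = choose k w f} (branch i o) with >>=-return-outcome {r = f i} o
... | x , o′ , e = x , branch i o′ , e

Pr-map : ∀ {A A′ : Set} {P : Pred A′ 0ℓ} (P? : Decidable P) (g : A → A′) r →
  Pr P? (r >>= λ x → return (g x)) ≡ Pr (P? ∘ g) r
Pr-map P? g (return x)     = refl
Pr-map P? g (choose k w f) = ∑ℚ-cong (λ i → cong (w i ℚ.*_) (Pr-map P? g (f i)))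

return-outcome : ∀ {A : Set} {r : Rand A} {a b} → r ≡ return b → a outcomeOf r → a ≡ b
return-outcome refl here = refl

-- A program logic that bounds the resources

record Fits (K V t c : ℕ) (u : Usage) : Set where
  constructor fits
  field
    time≤  : time u ≤ t
    calls≡ : calls u ≡ c
    cells≤ : cells u ≤ K
    word≤  : word u ≤ V

Fits-⊕ : ∀ {K V t c t′ c′ u u′} → Fits K V t c u → Fits K V t′ c′ u′ → Fits K V (t + t′) (c + c′) (u ⊕ u′)
Fits-⊕ {u = usage _ _ _ _} {u′ = usage _ _ _ _} (fits a b c d) (fits a′ b′ c′ d′) =
  fits (+-mono-≤ a a′) (cong₂ _+_ b b′) (⊔-lub c c′) (⊔-lub d d′)

Fits-mono : ∀ {K V t t′ c u} → t ≤ t′ → Fits K V t c u → Fits K V t′ c u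
Fits-mono t≤ (fits a b c d) = fits (≤-trans a t≤) b c d

Fits-steps : ∀ {K V t} → Fits K V t 0 (steps t)
Fits-steps = fits ≤-refl refl z≤n z≤n

module Logic {Effect X : Set} (I : Input) (perform : Effect → Memory × X → Run (Memory × X)) (K V : ℕ) where

  private
    ⟦_⟧ : Expr → Memory → ℕ
    ⟦ e ⟧ m = eval I m e

    run : Cmd Effect → Memory × X → Run (Memory × X)
    run = exec I perform

  -- Code without effects reduces to a single leaf, so its postcondition involves no probability.
  -- Randomness enters only through `draw` and `call`, which are treated by `Lift`.
  record Det (r : Run (Memory × X)) (x : X) (t : ℕ) (Q : Memory → Set) : Set where
    constructor det
    field
      {memory} : Memory
      {used}   : Usage
      runs     : r ≡ return ((memory , x) , used)
      costs    : Fits K V t 0 used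
      post     : Q memory

  Det-weaken : ∀ {r x t t′ Q Q′} → t ≤ t′ → (∀ {m} → Q m → Q′ m) → Det r x t Q → Det r x t′ Q′
  Det-weaken t≤ f (det e c q) = det e (Fits-mono t≤ c) (f q)

  Det-charge : ∀ {r x t Q} k → Det r x t Q → Det (charge (steps k) r) x (k + t) Q
  Det-charge k (det refl c q) = det refl (Fits-⊕ Fits-steps c) q

  Det-▹ : ∀ {r k x t t′ Q} → Det r x t (λ m → Det (k (m , x)) x t′ Q) → Det (r ▹ k) x (t + t′) Q
  Det-▹ {k = k} (det {m} refl c (det {m′} {u′} e c′ q)) =
    det (cong (charge _) e) (Fits-⊕ c c′) q

  Det-Lift : ∀ {A : Set} {S : (Memory × X) × Usage → A → Set} {r x t Q u a} → Det r x t Q →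
    (∀ {m v} → Q m → Fits K V t 0 v → S ((m , x) , u ⊕ v) a) → Lift S (charge u r) (return a)
  Det-Lift (det refl c q) f = return (f q c)

  -- A record rather than a synonym: command and memory stay visible to unification instead of being
  -- unfolded into an execution.
  record Triple (c : Cmd Effect) (m : Memory) (x : X) (t : ℕ) (Q : Memory → Set) : Set where
    constructor triple
    field
      holds : Det (run c (m , x)) x t Q

  open Triple public

  weaken : ∀ {c m x t t′ Q Q′} → t ≤ t′ → (∀ {m} → Q m → Q′ m) → Triple c m x t Q → Triple c m x t′ Q′
  weaken t≤ f (triple h) = triple (Det-weaken t≤ f h)

  assign : ∀ {d e m x Q a w} → ⟦ d ⟧ m ≡ a → ⟦ e ⟧ m ≡ w → a < K → w ≤ V → Q (m [ a ↦ w ]) →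
    Triple (d ≔ e) m x (size d + size e + 1) Q
  assign refl refl d< e≤ q = triple (det refl (fits ≤-refl refl d< e≤) q)

  infixr 4 _⨾!_

  _⨾!_ : ∀ {c c′ m x t t′ Q R} → Triple c m x t Q → (∀ {m′} → Q m′ → Triple c′ m′ x t′ R) →
    Triple (c ⨾ c′) m x (t + t′) R
  _⨾!_ {c} {c′} (triple (det e u q)) k = triple (Det-▹ {k = run c′} (det e u (holds (k q))))

  -- The memory stays an explicit update, so that c's loads from it compute.
  assign⨾ : ∀ {d e c m x t Q a w} → ⟦ d ⟧ m ≡ a → ⟦ e ⟧ m ≡ w → a < K → w ≤ V →
    Triple c (m [ a ↦ w ]) x t Q →
    Triple ((d ≔ e) ⨾ c) m x (size d + size e + 1 + t) Q
  assign⨾ {c = c} refl refl d< e≤ (triple k) = triple (Det-▹ {k = run c} (det refl (fits ≤-refl refl d< e≤) k))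

  when! : ∀ {g c c′ m x t Q} → (⟦ g ⟧ m ≢ 0 → Triple c m x t Q) →
    (⟦ g ⟧ m ≡ 0 → Triple c′ m x t Q) →
    Triple (when g then c else c′) m x (1 + size g + t) Q
  when! {g} {c} {c′} {m} {x} {t} {Q} yes! no! = triple (split (⟦ g ⟧ m) refl)
    where
    split : ∀ b → ⟦ g ⟧ m ≡ b →
      Det (charge (steps (1 + size g)) (if b ≡ᵇ 0 then run c′ (m , x) else run c (m , x))) x (1 + size g + t) Q
    split zero    e = Det-charge (1 + size g) (holds (no! e))
    split (suc _) e = Det-charge (1 + size g) (holds (yes! (λ e′ → contradiction (trans (sym e) e′) λ ())))

  -- k bounds the number of iterations left.
  iterate! : ∀ {g c x t} (Inv : ℕ → Memory → Set) →
    (∀ {k m} → Inv k m → ⟦ g ⟧ m ≢ 0 → ∃ λ k′ → k ≡ suc k′ × Triple c m x t (Inv k′)) →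
    ∀ b k {m} → k ≤ b → Inv k m →
    Det (iterate I perform g (run c) b (m , x)) x (k * (1 + size g + t) + (1 + size g))
        (λ m′ → (∃ λ k′ → Inv k′ m′) × ⟦ g ⟧ m′ ≡ 0)
  iterate! {g} {c} {x} Inv step zero zero {m} z≤n inv = det refl (fits z≤n refl z≤n z≤n) ((zero , inv) , guard)
    where
    guard : ⟦ g ⟧ m ≡ 0
    guard with ⟦ g ⟧ m in e
    ... | zero  = refl
    ... | suc _ with step inv (λ e′ → contradiction (trans (sym e) e′) λ ())
    ...   | _ , () , _
  iterate! {g} {c} {x} {t} Inv step (suc b) k {m} k≤ inv with ⟦ g ⟧ m in e
  ... | zero  = Det-weaken
        (≤-trans (≤-reflexive (+-identityʳ _)) (m≤n+m (1 + size g) (k * (1 + size g + t)))) id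
        (Det-charge (1 + size g) (det refl Fits-steps ((k , inv) , e)))
  ... | suc _ with step inv (λ e′ → contradiction (trans (sym e) e′) λ ())
  ...   | k′ , refl , body = Det-weaken
        (≤-reflexive (lemma (size g) t (k′ * (1 + size g + t)))) id
        (Det-charge (1 + size g) (Det-▹ {k = iterate I perform g (run c) b} (Det-weaken ≤-refl
          (iterate! {g} {c} Inv step b k′ (s≤s⁻¹ k≤)) (holds body))))
    where
    lemma : ∀ s t r → 1 + s + (t + (r + (1 + s))) ≡ 1 + s + t + r + (1 + s)
    lemma = solve-∀

  -- For loops that end by their guard. The cost is governed by the measure `k` and not by the
  -- syntactic bound `b`, which may be far larger: the binary search is bounded by n but charged
  -- ⌈log₂ n⌉ rounds.
  while! : ∀ {g b c m x t} (Inv : ℕ → Memory → Set) →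
    (∀ {k m} → Inv k m → ⟦ g ⟧ m ≢ 0 → ∃ λ k′ → k ≡ suc k′ × Triple c m x t (Inv k′)) →
    ∀ k → k ≤ ⟦ b ⟧ m → Inv k m →
    Triple (while g upto b run c) m x (1 + size b + (k * (1 + size g + t) + (1 + size g)))
        (λ m′ → (∃ λ k′ → Inv k′ m′) × ⟦ g ⟧ m′ ≡ 0)
  while! {g} {b} {c} {m} Inv step k k≤ inv =
    triple (Det-charge (1 + size b) (iterate! {g} {c} Inv step (⟦ b ⟧ m) k k≤ inv))

  -- k is the number of iterations left.
  repeat! : ∀ {g c x t} (Inv : ℕ → Memory → Set) →
    (∀ {k m} → Inv (suc k) m → ⟦ g ⟧ m ≢ 0 → Triple c m x t (Inv k)) →
    ∀ k {m} → Inv k m →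
    Det (iterate I perform g (run c) k (m , x)) x (k * (1 + size g + t))
        (λ m′ → ∃ λ k′ → Inv k′ m′ × (k′ ≡ 0 ⊎ ⟦ g ⟧ m′ ≡ 0))
  repeat! Inv step zero inv = det refl Fits-steps (zero , inv , inj₁ refl)
  repeat! {g} {c} {x} {t} Inv step (suc k) {m} inv with ⟦ g ⟧ m in e
  ... | zero  = Det-weaken
        (≤-trans (≤-reflexive (+-identityʳ _)) (≤-trans (m≤m+n (1 + size g) t) (m≤m+n _ (k * (1 + size g + t))))) id
        (Det-charge (1 + size g) (det refl Fits-steps (suc k , inv , inj₂ e)))
  ... | suc _ = Det-weaken
        (≤-reflexive (sym (+-assoc (1 + size g) t (k * (1 + size g + t))))) id
        (Det-charge (1 + size g) (Det-▹ {k = iterate I perform g (run c) k} (Det-weaken ≤-refl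
          (repeat! {g} {c} Inv step k) (holds (step inv (λ e′ → contradiction (trans (sym e) e′) λ ()))))))

  -- For loops that may also be stopped by their bound; the postcondition tells which of the two
  -- happened.
  upto! : ∀ {g b c m x t} (Inv : ℕ → Memory → Set) →
    (∀ {k m} → Inv (suc k) m → ⟦ g ⟧ m ≢ 0 → Triple c m x t (Inv k)) →
    ∀ {k} → ⟦ b ⟧ m ≡ k → Inv k m →
    Triple (while g upto b run c) m x (1 + size b + k * (1 + size g + t))
        (λ m′ → ∃ λ k′ → Inv k′ m′ × (k′ ≡ 0 ⊎ ⟦ g ⟧ m′ ≡ 0))
  upto! {g} {b} {c} {m} Inv step refl inv =
    triple (Det-charge (1 + size b) (repeat! {g} {c} Inv step (⟦ b ⟧ m) inv))

  for! : ∀ {b c m x t} (Inv : ℕ → Memory → Set) →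
    (∀ {k m} → Inv (suc k) m → Triple c m x t (Inv k)) →
    ∀ {k} → ⟦ b ⟧ m ≡ k → Inv k m →
    Triple (while lit 1 upto b run c) m x (1 + size b + k * (2 + t)) (Inv 0)
  for! {b} {c} Inv step e inv = weaken ≤-refl done
    (upto! {lit 1} {b} {c} Inv (λ i _ → step i) e inv)
    where
    done : ∀ {m′} → (∃ λ k′ → Inv k′ m′ × (k′ ≡ 0 ⊎ 1 ≡ 0)) → Inv 0 m′
    done (_ , i , inj₁ refl) = i
    done (_ , i , inj₂ ())

-- Memory updates and loop guards

[↦]-same : ∀ m a x → (m [ a ↦ x ]) a ≡ x
[↦]-same m a x rewrite dec-true (a ≟ a) refl = refl

[↦]-other : ∀ m {a b} x → a ≢ b → (m [ a ↦ x ]) b ≡ m b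
[↦]-other m {a} {b} x a≢b rewrite dec-false (a ≟ b) a≢b = refl

guard-true : ∀ {a b} → (if a <ᵇ b then 1 else 0) ≢ 0 → a < b
guard-true {a} {b} g with a <ᵇ b in e
... | true  = <ᵇ⇒< a b (subst T (sym e) tt)
... | false = contradiction refl g

guard-false : ∀ {a b} → (if a <ᵇ b then 1 else 0) ≡ 0 → b ≤ a
guard-false {a} {b} g with a <ᵇ b in e
... | false = ≮⇒≥ (λ a<b → subst T e (<⇒<ᵇ a<b))
... | true  = contradiction g λ ()

-- Lists and logarithms

nth-tabulate : ∀ {A : Set} (z : A) {n} (f : Fin n → A) v → nth z (tabulate f) (toℕ v) ≡ f v
nth-tabulate z f zero    = refl
nth-tabulate z f (suc v) = nth-tabulate z (f ∘ suc) v

nth-map-allFin : ∀ {A : Set} (z : A) {n} (f : Fin n → A) v → nth z (map f (allFin n)) (toℕ v) ≡ f v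
nth-map-allFin z f v = trans (cong (λ xs → nth z xs (toℕ v)) (map-tabulate id f)) (nth-tabulate z f v)

nth-map-lookup : ∀ {A A′ : Set} (z : A′) (f : A → A′) xs (i : Fin (length xs)) →
  nth z (map f xs) (toℕ i) ≡ f (lookup xs i)
nth-map-lookup z f (x ∷ xs) zero    = refl
nth-map-lookup z f (x ∷ xs) (suc i) = nth-map-lookup z f xs i

nth-++ˡ : ∀ {A : Set} (z : A) xs ys {i} → i < length xs → nth z (xs ++ ys) i ≡ nth z xs i
nth-++ˡ z (x ∷ xs) ys {zero}  _         = refl
nth-++ˡ z (x ∷ xs) ys {suc i} (s≤s i<) = nth-++ˡ z xs ys i<

nth-++ʳ : ∀ {A : Set} (z : A) xs ys i → nth z (xs ++ ys) (length xs + i) ≡ nth z ys i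
nth-++ʳ z []       ys i = refl
nth-++ʳ z (x ∷ xs) ys i = nth-++ʳ z xs ys i

nth-map : ∀ {A A′ : Set} (z : A) (z′ : A′) (f : A → A′) xs {i} → i < length xs →
  nth z′ (map f xs) i ≡ f (nth z xs i)
nth-map z z′ f (x ∷ xs) {zero}  _        = refl
nth-map z z′ f (x ∷ xs) {suc i} (s≤s i<) = nth-map z z′ f xs i<

pairs-map : ∀ {A A′ : Set} (f : A → A′) xs → pairs (map f xs) ≡ map (λ (a , b) → f a , f b) (pairs xs)
pairs-map f []       = refl
pairs-map f (x ∷ xs) = trans (cong₂ _++_ (trans (sym (map-∘ xs)) (map-∘ xs)) (pairs-map f xs))
  (sym (map-++ _ (map (x ,_) xs) (pairs xs)))

concatMap-map : ∀ {A K D : Set} (f : A → List K) (g : K → D) xs →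
  concat (map (λ x → map g (f x)) xs) ≡ map g (concatMap f xs)
concatMap-map f g []       = refl
concatMap-map f g (x ∷ xs) = trans (cong (map g (f x) ++_) (concatMap-map f g xs)) (sym (map-++ g (f x) (concatMap f xs)))

-- The position in the concatenation at which the j-th list begins. For the lists of wedges at each
-- vertex these are the prefix sums that the setup tabulates.
offset : ∀ {A : Set} → List (List A) → ℕ → ℕ
offset []         _       = 0
offset (xs ∷ xss) zero    = 0
offset (xs ∷ xss) (suc j) = length xs + offset xss j

module _ {A : Set} where

  offset-0 : ∀ (xss : List (List A)) → offset xss 0 ≡ 0
  offset-0 []         = refl
  offset-0 (xs ∷ xss) = refl

  offset-suc : ∀ (xss : List (List A)) j → offset xss (suc j) ≡ offset xss j + length (nth [] xss j)
  offset-suc []         j       = refl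
  offset-suc (xs ∷ xss) zero    = trans (cong (length xs +_) (offset-0 xss)) (+-identityʳ _)
  offset-suc (xs ∷ xss) (suc j) = trans (cong (length xs +_) (offset-suc xss j)) (sym (+-assoc (length xs) _ _))

  offset-all : ∀ (xss : List (List A)) → offset xss (length xss) ≡ length (concat xss)
  offset-all []         = refl
  offset-all (xs ∷ xss) = trans (cong (length xs +_) (offset-all xss)) (sym (length-++ xs))

  offset-≤ : ∀ (xss : List (List A)) j → offset xss j ≤ length (concat xss)
  offset-≤ []         j       = z≤n
  offset-≤ (xs ∷ xss) zero    = z≤n
  offset-≤ (xs ∷ xss) (suc j) = ≤-trans (+-monoʳ-≤ (length xs) (offset-≤ xss j)) (≤-reflexive (sym (length-++ xs)))

  nth-concat : ∀ (z : A) xss j {i} → i < length (nth [] xss j) →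
    nth z (concat xss) (offset xss j + i) ≡ nth z (nth [] xss j) i
  nth-concat z (xs ∷ xss) zero    i< = nth-++ˡ z xs (concat xss) i<
  nth-concat z (xs ∷ xss) (suc j) {i} i< = trans
    (cong (nth z (xs ++ concat xss)) (+-assoc (length xs) (offset xss j) i))
    (trans (nth-++ʳ z xs (concat xss) (offset xss j + i)) (nth-concat z xss j i<))

n≤2^⌈log₂n⌉ : ∀ n → n ≤ 2 ^ ⌈log₂ n ⌉
n≤2^⌈log₂n⌉ = <-rec (λ n → n ≤ 2 ^ ⌈log₂ n ⌉) go
  where
  open ≤-Reasoning
  go : ∀ n → (∀ {m} → m < n → m ≤ 2 ^ ⌈log₂ m ⌉) → n ≤ 2 ^ ⌈log₂ n ⌉
  go 0 _ = z≤n
  go 1 _ = s≤s z≤n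
  go n@(suc (suc k)) rec = begin
    n                                ≡⟨ ⌊n/2⌋+⌈n/2⌉≡n n ⟨
    ⌊ n /2⌋ + ⌈ n /2⌉                ≤⟨ +-monoˡ-≤ ⌈ n /2⌉ (⌊n/2⌋≤⌈n/2⌉ n) ⟩
    ⌈ n /2⌉ + ⌈ n /2⌉                ≤⟨ +-mono-≤ half half ⟩
    2 ^ l + 2 ^ l                    ≡⟨ cong (λ x → 2 ^ l + x) (+-identityʳ (2 ^ l)) ⟨
    2 ^ suc l                        ≡⟨ cong (2 ^_) (trans (+-comm 1 l) (m∸n+n≡m (⌈log₂⌉-mono-≤ {2} {n} (s≤s (s≤s z≤n))))) ⟩
    2 ^ ⌈log₂ n ⌉ ∎
    where
    l = ⌈log₂ n ⌉ ∸ 1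
    half : ⌈ n /2⌉ ≤ 2 ^ l
    half = subst (λ x → ⌈ n /2⌉ ≤ 2 ^ x) (⌈log₂⌈n/2⌉⌉≡⌈log₂n⌉∸1 n) (rec (⌈n/2⌉<n k))

-- Programs

infixl 6 _∔_ _∸ᴱ_
infixl 7 _×ᴱ_ _÷ᴱ_
infix  4 _<ᴱ_

_∔_ _∸ᴱ_ _×ᴱ_ _÷ᴱ_ _<ᴱ_ : Expr → Expr → Expr
_∔_  = binary add
_∸ᴱ_ = binary sub
_×ᴱ_ = binary mul
_÷ᴱ_ = binary div
_<ᴱ_ = binary lt

reg : ℕ → Expr
reg k = load (lit k)

nᴱ : Expr
nᴱ = input (lit 0) (lit 0)

degreeᴱ : Expr → Expr
degreeᴱ v = input (lit 1 ∔ v) (lit 0)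

neighbourᴱ : Expr → Expr → Expr
neighbourᴱ v j = input (lit 1 ∔ v) (lit 1 ∔ j)

-- Cells 0 to 15 are registers, cell 16 + j holds the number of wedges centred
-- at vertices below j, and cell 17 + n + x is a mark at the vertex x.
wedgesBelowᴱ markᴱ : Expr → Expr
wedgesBelowᴱ j = load (lit 16 ∔ j)
markᴱ x = lit 17 ∔ (nᴱ ∔ x)

-- Cell 16 is never written: its initial 0 is the empty prefix sum.
setupᶜ : Cmd Draw
setupᶜ = while lit 1 upto nᴱ run
  ( lit 17 ∔ reg 1 ≔ wedgesBelowᴱ (reg 1) ∔ degreeᴱ (reg 1) ×ᴱ (degreeᴱ (reg 1) ∸ᴱ lit 1) ÷ᴱ lit 2
  ⨾ lit 1 ≔ reg 1 ∔ lit 1)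

-- Binary search in the prefix sums for the centre of the drawn wedge, with the interval in
-- registers 2 and 3. It is the source of the log n in the cost of a sample.
searchᶜ : Cmd Draw
searchᶜ = while reg 2 ∔ lit 1 <ᴱ reg 3 upto nᴱ run
  ( lit 4 ≔ (reg 2 ∔ reg 3) ÷ᴱ lit 2
  ⨾ when reg 1 <ᴱ wedgesBelowᴱ (reg 4) then (lit 3 ≔ reg 4) else (lit 2 ≔ reg 4))

-- `pairs` lists pairs in blocks by first component, of lengths d - 1, d - 2 and so on. Subtracting
-- block lengths decodes an index in O(d) steps: register 4 ends as the first position and register
-- 1 as the place within the block.
locateᶜ : Cmd Draw
locateᶜ = while reg 3 <ᴱ reg 1 ∔ lit 1 upto degreeᴱ (reg 2) run
  ( lit 1 ≔ reg 1 ∸ᴱ reg 3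
  ⨾ lit 4 ≔ reg 4 ∔ lit 1
  ⨾ lit 3 ≔ reg 3 ∸ᴱ lit 1)

fillᶜ : ℕ → ℕ → Cmd Draw
fillᶜ r c =
    lit 4 ≔ lit 0
  ⨾ while lit 1 upto degreeᴱ (reg r) run
      ( markᴱ (neighbourᴱ (reg r) (reg 4)) ≔ lit c
      ⨾ lit 4 ≔ reg 4 ∔ lit 1)

countᶜ : Cmd Draw
countᶜ =
    lit 7 ≔ lit 0
  ⨾ lit 4 ≔ lit 0
  ⨾ while lit 1 upto degreeᴱ (reg 5) run
      ( lit 7 ≔ reg 7 ∔ load (markᴱ (neighbourᴱ (reg 5) (reg 4)))
      ⨾ lit 4 ≔ reg 4 ∔ lit 1)

-- The marks on the first neighbourhood are cleared, those on the second set, and the first is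
-- counted. Stale marks of earlier samples elsewhere are never read, so the marks need not be reset
-- in O(n) time.
intersectᶜ wedgeᶜ : Cmd Draw
intersectᶜ =
    lit 5 ≔ neighbourᴱ (reg 2) (reg 4)
  ⨾ lit 6 ≔ neighbourᴱ (reg 2) (reg 4 ∔ lit 1 ∔ reg 1)
  ⨾ fillᶜ 5 0
  ⨾ fillᶜ 6 1
  ⨾ countᶜ
  ⨾ lit 0 ≔ (reg 7 ∸ᴱ lit 1) ×ᴱ wedgesBelowᴱ nᴱ
wedgeᶜ =
    lit 2 ≔ lit 0
  ⨾ lit 3 ≔ nᴱ
  ⨾ searchᶜ
  ⨾ lit 1 ≔ reg 1 ∸ᴱ wedgesBelowᴱ (reg 2)
  ⨾ lit 4 ≔ lit 0
  ⨾ lit 3 ≔ degreeᴱ (reg 2) ∸ᴱ lit 1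
  ⨾ locateᶜ
  ⨾ intersectᶜ

wsampᶜ : Cmd Draw
wsampᶜ = effect (draw lit 1 below wedgesBelowᴱ nᴱ) ⨾ wedgeᶜ

-- Correctness of the sampler

≤! : ∀ {a b} → {_ : T (a ≤ᵇ b)} → a ≤ b
≤! {a} {b} {p} = ≤ᵇ⇒≤ a b p

-- Exact step counts are rounded up to multiples of 100; the comparison of the numerals is decided
-- by computation.
linear : ∀ {a b k D} → {_ : T (a ≤ᵇ 100)} → {_ : T (b ≤ᵇ 100)} → k ≤ D → a + k * b ≤ 100 + D * 100
linear {a} {b} {k} {D} {p} {q} k≤D = +-mono-≤ (≤ᵇ⇒≤ a 100 p) (*-mono-≤ k≤D (≤ᵇ⇒≤ b 100 q))

linear′ : ∀ {a b c k D} → {_ : T (a + c ≤ᵇ 100)} → {_ : T (b ≤ᵇ 100)} → k ≤ D → a + (k * b + c) ≤ 100 + D * 100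
linear′ {a} {b} {c} {k} {D} {p} {q} k≤D = ≤-trans (≤-reflexive (lemma a b c k)) (linear {a + c} {b} {k} {D} {p} {q} k≤D)
  where
  lemma : ∀ a b c k → a + (k * b + c) ≡ a + c + k * b
  lemma = solve-∀

halve : ∀ x → x / 2 * 2 ≤ x × x < x / 2 * 2 + 2
halve x = m/n*n≤m x 2 , ≤-trans (s≤s (≤-reflexive (m≡m%n+[m/n]*n x 2)))
  (≤-trans (+-monoˡ-≤ (x / 2 * 2) (m%n<n x 2)) (≤-reflexive (+-comm 2 (x / 2 * 2))))

module Sampler {n : ℕ} (G : BipartiteGraph n) (K V D : ℕ)
  (K≥ : 17 + (n + n) ≤ K) (n≤V : n ≤ V) (nW≤V : n * length (Moments.wedgeList G) ≤ V)
  (W≤V : length (Moments.wedgeList G) ≤ V) (1≤V : 1 ≤ V)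
  (degree≤D : ∀ v → degree G v ≤ D) (degree≤n : ∀ v → degree G v ≤ n) where

  open BipartiteGraph G
  open Moments G
  open Logic (storedGraph G) (performDraw (storedGraph G)) K V
  open DecMembership (Fin._≟_ {n}) using (_∈?_)

  row : Fin n → List ℕ
  row v = map toℕ (Γ v)

  -- Their concatenation is the image of `wedgeList`, so the number drawn is an index into it: a
  -- block selects the centre, the place in the block selects the pair.
  xss : List (List (ℕ × ℕ))
  xss = map (λ v → pairs (row v)) (allFin n)

  W : ℕ
  W = length wedgeList

  rows : Input
  rows = map (λ v → degree G v ∷ row v) (allFin n)

  row-at : ∀ v → nth [] rows (toℕ v) ≡ degree G v ∷ row v
  row-at v = nth-map-allFin [] _ v

  degree-at : ∀ {a} v → a ≡ toℕ v → nth 0 (nth [] rows a) 0 ≡ degree G v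
  degree-at v refl = cong (λ r → nth 0 r 0) (row-at v)

  neighbour-at : ∀ {a} v j → a ≡ toℕ v → nth 0 (nth [] rows a) (suc j) ≡ nth 0 (row v) j
  neighbour-at v j refl = cong (λ r → nth 0 r (suc j)) (row-at v)

  concat-xss : concat xss ≡ map (λ (a , b) → toℕ a , toℕ b) wedgeList
  concat-xss = trans (cong concat (map-cong′ (λ v → pairs-map toℕ (Γ v)))) (concatMap-map (λ v → pairs (Γ v)) _ (allFin n))
    where
    map-cong′ : ∀ {f g : Fin n → List (ℕ × ℕ)} → (∀ v → f v ≡ g v) → map f (allFin n) ≡ map g (allFin n)
    map-cong′ h = map-cong h (allFin n)

  length-concat-xss : length (concat xss) ≡ W
  length-concat-xss = trans (cong length concat-xss) (length-map _ wedgeList)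

  length-row : ∀ v → length (row v) ≡ degree G v
  length-row v = length-map toℕ (Γ v)

  offset-next : ∀ v → offset xss (suc (toℕ v)) ≡ offset xss (toℕ v) + tri (degree G v)
  offset-next v = trans (offset-suc xss (toℕ v)) (cong (offset xss (toℕ v) +_)
    (trans (cong length (nth-map-allFin [] (λ v → pairs (row v)) v))
      (trans (length-pairs (row v)) (cong tri (length-row v)))))

  offset-n : offset xss n ≡ W
  offset-n = trans (cong (offset xss) (sym (trans (length-map _ (allFin n)) (length-tabulate {n = n} id))))
    (trans (offset-all xss) length-concat-xss)

  offset≤W : ∀ j → offset xss j ≤ W
  offset≤W j = ≤-trans (offset-≤ xss j) (≤-reflexive length-concat-xss)

  offset≤V : ∀ j → offset xss j ≤ V
  offset≤V j = ≤-trans (offset≤W j) W≤V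

  Prepared : Memory → Set
  Prepared m = ∀ j → j ≤ n → m (16 + j) ≡ offset xss j

  literal< : ∀ {a} → {_ : T (a ≤ᵇ 16)} → a < K
  literal< {a} {p} = ≤-trans (s≤s (≤ᵇ⇒≤ a 16 p)) (≤-trans (m≤m+n 17 (n + n)) K≥)

  record SetupInv (k : ℕ) (m : Memory) : Set where
    field
      remaining : m 1 + k ≡ n
      filled    : ∀ j → j ≤ m 1 → m (16 + j) ≡ offset xss j

  setup-correct : Triple setupᶜ blank tt (4 + n * 100) Prepared
  setup-correct = weaken (+-mono-≤ {4} ≤-refl (*-monoʳ-≤ n ≤!)) done
    (for! {nᴱ} SetupInv body refl record { remaining = refl ; filled = λ { zero z≤n → sym (offset-0 xss) } })
    where
    done : ∀ {m} → SetupInv 0 m → Prepared m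
    done {m} inv j j≤n = SetupInv.filled inv j (≤-trans j≤n (≤-reflexive (trans (sym (SetupInv.remaining inv)) (+-identityʳ (m 1)))))
    body : ∀ {k m} → SetupInv (suc k) m → Triple _ m tt _ (SetupInv k)
    body {k} {m} inv = assign⨾ refl value (≤-trans (+-monoʳ-≤ 18 (<⇒≤pred i<n)) bound) (offset≤V (suc (m 1)))
      (assign refl refl literal< (≤-trans (≤-reflexive (+-comm (m 1) 1)) (≤-trans i<n n≤V)) record
        { remaining = trans (+-assoc (m 1) 1 k) remaining
        ; filled = filled′ })
      where
      open SetupInv inv
      i<n : m 1 < n
      i<n = ≤-trans (m<m+n (m 1) {suc k} z<s) (≤-reflexive remaining)
      bound : 18 + pred n ≤ K
      bound = ≤-trans (≤-reflexive (cong (17 +_) (suc-pred n {{>-nonZero (≤-trans (s≤s z≤n) i<n)}}))) (≤-trans (+-monoʳ-≤ 17 (m≤m+n n n)) K≥)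
      v : Fin n
      v = fromℕ< i<n
      v≡ : m 1 ≡ toℕ v
      v≡ = sym (Fin.toℕ-fromℕ< i<n)
      d : ℕ
      d = nth 0 (nth [] rows (m 1)) 0
      half-square : ∀ d → (d * (d ∸ 1)) / 2 ≡ tri d
      half-square d = trans (cong (_/ 2) (trans (sym (2*tri d)) (*-comm 2 (tri d)))) (m*n/n≡m (tri d) 2)
      value : m (16 + m 1) + (d * (d ∸ 1)) / 2 ≡ offset xss (suc (m 1))
      value = trans (cong₂ _+_ (filled (m 1) ≤-refl) (trans (half-square d) (cong tri (degree-at v v≡))))
        (trans (cong (λ x → offset xss x + tri (degree G v)) v≡) (trans (sym (offset-next v)) (cong (offset xss ∘ suc) (sym v≡))))
      m′ = m [ 17 + m 1 ↦ offset xss (suc (m 1)) ]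
      filled′ : ∀ j → j ≤ m 1 + 1 → m′ (16 + j) ≡ offset xss j
      filled′ j j≤ with m≤n⇒m<n∨m≡n (≤-trans j≤ (≤-reflexive (+-comm (m 1) 1)))
      ... | inj₁ (s≤s j≤i) = trans ([↦]-other m {17 + m 1} _ (λ e → <⇒≢ (s≤s j≤i) (sym (+-cancelˡ-≡ 16 _ _ (trans (+-suc 16 (m 1)) e))))) (filled j j≤i)
      ... | inj₂ refl = [↦]-same m (17 + m 1) _

  -- The measure is in `gap`: an interval of length at most 2^k takes at most k halvings, and a
  -- length of 1 falsifies the guard.
  record SearchInv (r k : ℕ) (m : Memory) : Set where
    field
      table : Prepared m
      drawn    : m 1 ≡ r
      proper   : m 2 < m 3
      hi≤n     : m 3 ≤ n
      below    : offset xss (m 2) ≤ r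
      above    : r < offset xss (m 3)
      gap      : m 3 ≤ m 2 + 2 ^ k

  Found : ℕ → Memory → Set
  Found r m = Prepared m × m 1 ≡ r × Σ[ v ∈ Fin n ] m 2 ≡ toℕ v × ∃ λ i → i < tri (degree G v) × r ≡ offset xss (toℕ v) + i

  search-correct : ∀ {m} r → Prepared m → m 1 ≡ r → m 2 ≡ 0 → m 3 ≡ n → r < W →
    Triple searchᶜ m tt (100 + ⌈log₂ n ⌉ * 100) (Found r)
  search-correct {m} r prep r≡ lo≡ hi≡ r<W = weaken (linear′ {4} {30} {8} {⌈log₂ n ⌉} {⌈log₂ n ⌉} ≤-refl) done
    (while! (SearchInv r) body ⌈log₂ n ⌉ (log≤n n) record
      { table = prep
      ; drawn    = r≡
      ; proper   = subst₂ _<_ (sym lo≡) (sym hi≡) 0<n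
      ; hi≤n     = ≤-reflexive hi≡
      ; below    = subst (λ x → offset xss x ≤ r) (sym lo≡) (≤-trans (≤-reflexive (offset-0 xss)) z≤n)
      ; above    = subst (λ x → r < offset xss x) (sym hi≡) (subst (r <_) (sym offset-n) r<W)
      ; gap      = subst₂ (λ lo hi → hi ≤ lo + 2 ^ ⌈log₂ n ⌉) (sym lo≡) (sym hi≡) (n≤2^⌈log₂n⌉ n)
      })
    where
    log≤n : ∀ n → ⌈log₂ n ⌉ ≤ n
    log≤n n = ≤-trans (⌈log₂⌉-mono-≤ (<⇒≤ (n<2^n n))) (≤-reflexive (⌈log₂2^n⌉≡n n))
    0<n : 0 < n
    0<n = n≢0⇒n>0 λ n≡0 → contradiction (subst (r <_) (trans (sym offset-n) (trans (cong (offset xss) n≡0) (offset-0 xss))) r<W) λ ()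
    body : ∀ {k m} → SearchInv r k m → (if m 2 + 1 <ᵇ m 3 then 1 else 0) ≢ 0 →
      ∃ λ k′ → k ≡ suc k′ × Triple _ m tt _ (SearchInv r k′)
    body {zero} {m} inv g = contradiction (≤-trans (guard-true g) (SearchInv.gap inv)) (<-irrefl refl)
    body {suc k} {m} inv g = k , refl ,
      assign⨾ refl refl literal< (≤-trans mid≤n n≤V)
        (when!
          (λ g′ → assign refl refl literal< (≤-trans mid≤n n≤V) record
            { table = table ; drawn = drawn ; proper = lo<mid ; hi≤n = mid≤n ; below = below
            ; above = subst₂ _<_ drawn (table mid mid≤n) (guard-true g′)
            ; gap = *-cancelʳ-≤ mid (m 2 + 2 ^ k) 2 (begin
                mid * 2                       ≤⟨ proj₁ (halve (m 2 + m 3)) ⟩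
                m 2 + m 3                     ≤⟨ +-monoʳ-≤ (m 2) gap ⟩
                m 2 + (m 2 + 2 * 2 ^ k)       ≡⟨ lemma₁ (m 2) (2 ^ k) ⟩
                (m 2 + 2 ^ k) * 2 ∎) })
          (λ g′ → assign refl refl literal< (≤-trans mid≤n n≤V) record
            { table = table ; drawn = drawn ; proper = mid<hi ; hi≤n = hi≤n
            ; below = subst₂ _≤_ (table mid mid≤n) drawn (guard-false {m 1} g′)
            ; above = above
            -- Rounding the midpoint down may cost 1; both sides are even, so a strict bound with 2
            -- to spare still gives the weak one.
            ; gap = *-cancelʳ-≤ (m 3) (mid + 2 ^ k) 2 (≤-pred-even (m 3) (mid + 2 ^ k) (begin-strict
                m 3 * 2                       ≡⟨ lemma₂ (m 3) ⟩
                m 3 + m 3                     ≤⟨ +-monoʳ-≤ (m 3) gap ⟩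
                m 3 + (m 2 + 2 * 2 ^ k)       ≡⟨ lemma₃ (m 3) (m 2) (2 ^ k) ⟩
                m 2 + m 3 + 2 * 2 ^ k         <⟨ +-monoˡ-< (2 * 2 ^ k) (proj₂ (halve (m 2 + m 3))) ⟩
                mid * 2 + 2 + 2 * 2 ^ k       ≡⟨ lemma₄ mid (2 ^ k) ⟩
                (mid + 2 ^ k) * 2 + 2 ∎)) }))
      where
      open SearchInv inv
      open ≤-Reasoning
      mid : ℕ
      mid = (m 2 + m 3) / 2
      lemma₁ : ∀ a b → a + (a + 2 * b) ≡ (a + b) * 2
      lemma₁ = solve-∀
      lemma₂ : ∀ a → a * 2 ≡ a + a
      lemma₂ = solve-∀
      lemma₃ : ∀ a b c → a + (b + 2 * c) ≡ b + a + 2 * c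
      lemma₃ = solve-∀
      lemma₄ : ∀ a b → a * 2 + 2 + 2 * b ≡ (a + b) * 2 + 2
      lemma₄ = solve-∀
      ≤-pred-even : ∀ a b → a * 2 < b * 2 + 2 → a * 2 ≤ b * 2
      ≤-pred-even a b a<b = *-monoˡ-≤ 2 (s≤s⁻¹ (*-cancelʳ-< 2 a (suc b) (≤-trans a<b (≤-reflexive (+-comm (b * 2) 2)))))
      lo+2≤hi : m 2 + 1 < m 3
      lo+2≤hi = guard-true g
      mid<hi : mid < m 3
      mid<hi = *-cancelʳ-< 2 mid (m 3) (begin-strict
        mid * 2          ≤⟨ proj₁ (halve (m 2 + m 3)) ⟩
        m 2 + m 3        <⟨ +-monoˡ-< (m 3) proper ⟩
        m 3 + m 3        ≡⟨ lemma₂ (m 3) ⟨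
        m 3 * 2 ∎)
      lo<mid : m 2 < mid
      lo<mid = *-cancelʳ-< 2 (m 2) mid (+-cancelʳ-< 2 (m 2 * 2) (mid * 2) (begin-strict
        m 2 * 2 + 2                ≡⟨ lemma₅ (m 2) ⟩
        m 2 + suc (m 2 + 1)        ≤⟨ +-monoʳ-≤ (m 2) lo+2≤hi ⟩
        m 2 + m 3                  <⟨ proj₂ (halve (m 2 + m 3)) ⟩
        mid * 2 + 2 ∎))
        where
        lemma₅ : ∀ a → a * 2 + 2 ≡ a + suc (a + 1)
        lemma₅ = solve-∀
      mid≤n : mid ≤ n
      mid≤n = ≤-trans (<⇒≤ mid<hi) hi≤n
    done : ∀ {m} → (∃ λ k → SearchInv r k m) × (if m 2 + 1 <ᵇ m 3 then 1 else 0) ≡ 0 → Found r m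
    done {m} ((k , inv) , g) = table , drawn , v , sym (Fin.toℕ-fromℕ< lo<n) , r ∸ offset xss (toℕ v) ,
      +-cancelˡ-< (offset xss (toℕ v)) _ _ (≤-trans (s≤s (≤-reflexive (m+[n∸m]≡n below′))) above′) , sym (m+[n∸m]≡n below′)
      where
      open SearchInv inv
      lo<n : m 2 < n
      lo<n = ≤-trans proper hi≤n
      v : Fin n
      v = fromℕ< lo<n
      at-v : m 2 ≡ toℕ v
      at-v = sym (Fin.toℕ-fromℕ< lo<n)
      next : m 3 ≡ suc (m 2)
      next = ≤-antisym (≤-trans (guard-false {m 2 + 1} g) (≤-reflexive (+-comm (m 2) 1))) proper
      below′ : offset xss (toℕ v) ≤ r
      below′ = subst (λ x → offset xss x ≤ r) at-v below
      above′ : r < offset xss (toℕ v) + tri (degree G v)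
      above′ = subst (r <_) (trans (cong (offset xss) (trans next (cong suc at-v))) (offset-next v)) above

  -- `suffix` is the row from position `m 4` on. Passing over its head discards the block of k ∸ 1
  -- pairs that begin with it, the length that register 3 holds.
  record LocateInv (v : Fin n) (r k : ℕ) (m : Memory) : Set where
    field
      table : Prepared m
      centre   : m 2 ≡ toℕ v
      suffix   : List ℕ
      left     : length suffix ≡ k
      consumed : m 4 + k ≡ degree G v
      reads    : ∀ j → nth 0 (row v) (m 4 + j) ≡ nth 0 suffix j
      index<   : m 1 < tri k
      index    : nth (0 , 0) (pairs (row v)) r ≡ nth (0 , 0) (pairs suffix) (m 1)
      others   : m 3 ≡ k ∸ 1

  Located : Fin n → ℕ → Memory → Set
  Located v r m = Prepared m × m 2 ≡ toℕ v ×
    nth (0 , 0) (pairs (row v)) r ≡ (nth 0 (row v) (m 4) , nth 0 (row v) (m 4 + 1 + m 1))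

  tri≤W : ∀ {v k} → k ≤ degree G v → tri k ≤ W
  tri≤W {v} {k} k≤ = ≤-trans (tri-mono k≤) (≤-trans (m≤n+m _ (offset xss (toℕ v))) (≤-trans (≤-reflexive (sym (offset-next v))) (offset≤W (suc (toℕ v)))))
    where
    tri-mono : ∀ {a b} → a ≤ b → tri a ≤ tri b
    tri-mono z≤n       = z≤n
    tri-mono (s≤s a≤b) = +-mono-≤ a≤b (tri-mono a≤b)

  locate-correct : ∀ {m} v r → Prepared m → m 2 ≡ toℕ v → m 4 ≡ 0 → m 1 ≡ r → r < tri (degree G v) → m 3 ≡ degree G v ∸ 1 →
    Triple locateᶜ m tt (100 + D * 100) (Located v r)
  locate-correct {m} v r prep c≡ i≡ r≡ r< o≡ = weaken (linear′ {7} {27} {8} {degree G v} (degree≤D v)) done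
    (while! (LocateInv v r) body (degree G v) (≤-reflexive (sym (degree-at v c≡))) record
      { table = prep ; centre = c≡ ; suffix = row v ; left = length-row v
      ; consumed = cong (_+ degree G v) i≡
      ; reads = λ j → cong (λ i → nth 0 (row v) (i + j)) i≡
      ; index< = subst (_< tri (degree G v)) (sym r≡) r<
      ; index = cong (nth (0 , 0) (pairs (row v))) (sym r≡)
      ; others = o≡ })
    where
    body : ∀ {k m} → LocateInv v r k m → (if m 3 <ᵇ m 1 + 1 then 1 else 0) ≢ 0 →
      ∃ λ k′ → k ≡ suc k′ × Triple _ m tt _ (LocateInv v r k′)
    body {zero} inv g = contradiction (LocateInv.index< inv) λ ()
    body {suc k} {m} record { table = table ; centre = centre ; suffix = y ∷ ys ; left = left ; consumed = consumed
                            ; reads = reads ; index< = index< ; index = index ; others = others } g = k , refl ,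
      assign⨾ refl refl literal< (≤-trans (m∸n≤m (m 1) (m 3)) (≤-trans (<⇒≤ index<) tri≤V))
        (assign⨾ refl refl literal< (≤-trans (≤-reflexive (+-comm (m 4) 1)) (≤-trans (m<m+n (m 4) {suc k} z<s) (≤-trans (≤-reflexive consumed) (≤-trans (degree≤n v) n≤V))))
          (assign refl refl literal< (≤-trans (m∸n≤m (m 3) 1) (≤-trans (≤-reflexive others) (≤-trans (n≤1+n k) (≤-trans (m≤n+m (suc k) (m 4)) (≤-trans (≤-reflexive consumed) (≤-trans (degree≤n v) n≤V)))))) record
            { table = table
            ; centre = centre
            ; suffix = ys
            ; left = suc-injective left
            ; consumed = trans (+-assoc (m 4) 1 k) consumed
            ; reads = λ j → trans (cong (nth 0 (row v)) (+-assoc (m 4) 1 j)) (reads (suc j))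
            ; index< = +-cancelˡ-< k _ _ (≤-trans (s≤s (≤-reflexive k+)) index<)
            ; index = trans index (trans (cong (nth (0 , 0) (pairs (y ∷ ys))) (sym (trans (cong (_+ (m 1 ∸ m 3)) (trans (length-map (y ,_) ys) (suc-injective left))) k+)))
                (nth-++ʳ (0 , 0) (map (y ,_) ys) (pairs ys) (m 1 ∸ m 3)))
            ; others = cong (_∸ 1) others
            }))
      where
      k≤m1 : k ≤ m 1
      k≤m1 = s≤s⁻¹ (≤-trans (≤-reflexive (cong suc (sym others))) (≤-trans (guard-true g) (≤-reflexive (+-comm (m 1) 1))))
      k+ : k + (m 1 ∸ m 3) ≡ m 1
      k+ = trans (cong (λ x → k + (m 1 ∸ x)) others) (m+[n∸m]≡n k≤m1)
      tri≤V : tri (suc k) ≤ V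
      tri≤V = ≤-trans (tri≤W {v} {suc k} (≤-trans (m≤n+m (suc k) (m 4)) (≤-reflexive consumed))) W≤V
    done : ∀ {m} → (∃ λ k → LocateInv v r k m) × (if m 3 <ᵇ m 1 + 1 then 1 else 0) ≡ 0 → Located v r m
    done {m} ((zero , inv) , g) = contradiction (LocateInv.index< inv) λ ()
    done {m} ((suc k , record { table = table ; centre = centre ; suffix = y ∷ ys ; left = left
                            ; reads = reads ; index = index ; others = others }) , g) = table , centre ,
      trans index (trans (nth-++ˡ (0 , 0) (map (y ,_) ys) (pairs ys) (subst (m 1 <_) (sym (length-map (y ,_) ys)) m1<))
        (trans (nth-map 0 (0 , 0) (y ,_) ys m1<)
          (cong₂ _,_ (sym (trans (cong (nth 0 (row v)) (sym (+-identityʳ (m 4)))) (reads 0)))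
            (sym (trans (cong (nth 0 (row v)) (+-assoc (m 4) 1 (m 1))) (reads (suc (m 1))))))))
      where
      m1< : m 1 < length ys
      m1< = ≤-trans (≤-trans (≤-reflexive (+-comm 1 (m 1))) (guard-false {m 3} g)) (≤-reflexive (trans others (sym (suc-injective left))))

  -- Addresses up to 16 + n are the registers and the prefix sums; register 4 is the counter of the
  -- loop.
  Keeps : Memory → Memory → Set
  Keeps m m′ = ∀ a → a ≤ 16 + n → a ≢ 4 → m′ a ≡ m a

  mark : Memory → ℕ → ℕ
  mark m x = m (17 + (n + x))

  <n : ∀ {v x} → x ∈ row v → x < n
  <n x∈ with ∈-map⁻ toℕ x∈
  ... | u , _ , refl = Fin.toℕ<n u

  mark< : ∀ {v x} → x ∈ row v → 17 + (n + x) < K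
  mark< x∈ = ≤-trans (≤-reflexive (sym (+-suc 17 _))) (≤-trans (+-monoʳ-≤ 17 (≤-trans (≤-reflexive (sym (+-suc n _))) (+-monoʳ-≤ n (<n x∈)))) K≥)

  record FillInv (m₀ : Memory) (v : Fin n) (c k : ℕ) (m : Memory) : Set where
    field
      suffix    : List ℕ
      left      : length suffix ≡ k
      consumed  : m 4 + k ≡ degree G v
      reads     : ∀ j → nth 0 (row v) (m 4 + j) ≡ nth 0 suffix j
      suffix⊆   : ∀ {x} → x ∈ suffix → x ∈ row v
      keeps     : Keeps m₀ m
      marked    : ∀ {x} → x ∈ row v → mark m x ≡ c ⊎ x ∈ suffix
      untouched : ∀ {x} → x ∉ row v → mark m x ≡ mark m₀ x

  fill-correct : ∀ {m} r c v → m r ≡ toℕ v → r ≢ 4 → r ≤ 16 → c ≤ 1 →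
    Triple (fillᶜ r c) m tt (200 + D * 100)
      (λ m′ → Keeps m m′ × (∀ {x} → x ∈ row v → mark m′ x ≡ c) × (∀ {x} → x ∉ row v → mark m′ x ≡ mark m x))
  fill-correct {m₀} r c v r≡ r≢4 r≤16 c≤1 = weaken (+-mono-≤ (≤! {3} {100}) (linear {7} {25} {degree G v} (degree≤D v))) done
    (assign⨾ refl refl literal< z≤n (for! (FillInv m₀ v c) body (degree-at v (trans ([↦]-other m₀ 0 (r≢4 ∘ sym)) r≡)) record
      { suffix = row v ; left = length-row v ; consumed = refl ; reads = λ j → refl ; suffix⊆ = id
      ; keeps = λ a _ a≢4 → [↦]-other m₀ 0 (a≢4 ∘ sym)
      ; marked = inj₂ ; untouched = λ _ → refl }))
    where
    body : ∀ {k m} → FillInv m₀ v c (suc k) m → Triple _ m tt _ (FillInv m₀ v c k)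
    body {k} {m} record { suffix = y ∷ ys ; left = left ; consumed = consumed ; reads = reads ; suffix⊆ = suffix⊆
                        ; keeps = keeps ; marked = marked ; untouched = untouched } =
      assign⨾ (cong (λ x → 17 + (n + x)) (trans (neighbour-at v (m 4) (trans (keeps r (≤-trans r≤16 (m≤m+n 16 n)) r≢4) r≡))
                 (trans (cong (nth 0 (row v)) (sym (+-identityʳ (m 4)))) (reads 0)))) refl
        (mark< {v} (suffix⊆ (here refl))) (≤-trans c≤1 1≤V)
        (assign refl refl literal< (≤-trans (≤-reflexive (+-comm (m 4) 1)) (≤-trans (m<m+n (m 4) {suc k} z<s) (≤-trans (≤-reflexive consumed) (≤-trans (degree≤n v) n≤V)))) record
          { suffix = ys
          ; left = suc-injective left
          ; consumed = trans (+-assoc (m 4) 1 k) consumed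
          ; reads = λ j → trans (cong (nth 0 (row v)) (+-assoc (m 4) 1 j)) (reads (suc j))
          ; suffix⊆ = suffix⊆ ∘ there
          ; keeps = λ a a≤ a≢4 → trans ([↦]-other m₁ _ (a≢4 ∘ sym))
              (trans ([↦]-other m c (λ e → <⇒≢ (s≤s (≤-trans a≤ (+-monoʳ-≤ 16 (m≤m+n n y)))) (sym e))) (keeps a a≤ a≢4))
          ; marked = λ {x} x∈ → marked′ x∈ (x ≟ y)
          ; untouched = λ {x} x∉ → trans ([↦]-other m c (λ e → x∉ (subst (_∈ row v) (+-cancelˡ-≡ n _ _ (+-cancelˡ-≡ 17 _ _ e)) (suffix⊆ (here refl))))) (untouched x∉)
          })
      where
      m₁ = m [ 17 + (n + y) ↦ c ]
      marked′ : ∀ {x} → x ∈ row v → Dec (x ≡ y) → mark m₁ x ≡ c ⊎ x ∈ ys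
      marked′ x∈ (yes refl) = inj₁ ([↦]-same m (17 + (n + y)) c)
      marked′ {x} x∈ (no x≢y) with marked x∈
      ... | inj₁ e = inj₁ (trans ([↦]-other m c (λ e → x≢y (sym (+-cancelˡ-≡ n _ _ (+-cancelˡ-≡ 17 _ _ e))))) e)
      ... | inj₂ (here e) = contradiction e x≢y
      ... | inj₂ (there x∈ys) = inj₂ x∈ys
    done : ∀ {m′} → FillInv m₀ v c 0 m′ → Keeps m₀ m′ × (∀ {x} → x ∈ row v → mark m′ x ≡ c) × (∀ {x} → x ∉ row v → mark m′ x ≡ mark m₀ x)
    done {m′} record { suffix = [] ; keeps = keeps ; marked = marked ; untouched = untouched } =
      keeps , (λ x∈ → marked′ (marked x∈)) , untouched
      where
      marked′ : ∀ {x} → mark m′ x ≡ c ⊎ x ∈ [] → mark m′ x ≡ c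
      marked′ (inj₁ e) = e

  record CountInv (m₀ : Memory) (v : Fin n) (total k : ℕ) (m : Memory) : Set where
    field
      suffix    : List ℕ
      left      : length suffix ≡ k
      consumed  : m 4 + k ≡ degree G v
      reads     : ∀ j → nth 0 (row v) (m 4 + j) ≡ nth 0 suffix j
      table  : Prepared m
      source    : m 5 ≡ toℕ v
      marks     : ∀ x → mark m x ≡ mark m₀ x
      partial   : m 7 + ∑ suffix (mark m₀) ≡ total

  count-correct : ∀ {m} v → m 5 ≡ toℕ v → Prepared m → ∑ (row v) (mark m) ≤ V →
    Triple countᶜ m tt (200 + D * 100) (λ m′ → Prepared m′ × m′ 7 ≡ ∑ (row v) (mark m))
  count-correct {m₀} v r≡ prep total≤V = weaken (+-mono-≤ (≤! {3} {50}) (+-mono-≤ (≤! {3} {50}) (linear {7} {29} {degree G v} (degree≤D v)))) done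
    (assign⨾ refl refl literal< z≤n (assign⨾ refl refl literal< z≤n (for! (CountInv m₀ v (∑ (row v) (mark m₀))) body (degree-at v r≡) record
      { suffix = row v ; left = length-row v ; consumed = refl ; reads = λ j → refl
      ; table = prep ; source = r≡ ; marks = λ _ → refl ; partial = refl })))
    where
    total = ∑ (row v) (mark m₀)
    body : ∀ {k m} → CountInv m₀ v total (suc k) m → Triple _ m tt _ (CountInv m₀ v total k)
    body {k} {m} record { suffix = y ∷ ys ; left = left ; consumed = consumed ; reads = reads
                        ; table = table ; source = source ; marks = marks ; partial = partial } =
      assign⨾ refl value literal< (≤-trans (m≤m+n _ (∑ ys (mark m₀))) (≤-trans (≤-reflexive partial′) total≤V))
        (assign refl refl literal< (≤-trans (≤-reflexive (+-comm (m 4) 1)) (≤-trans (m<m+n (m 4) {suc k} z<s) (≤-trans (≤-reflexive consumed) (≤-trans (degree≤n v) n≤V)))) record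
          { suffix = ys
          ; left = suc-injective left
          ; consumed = trans (+-assoc (m 4) 1 k) consumed
          ; reads = λ j → trans (cong (nth 0 (row v)) (+-assoc (m 4) 1 j)) (reads (suc j))
          ; table = table
          ; source = source
          ; marks = marks
          ; partial = partial′
          })
      where
      value : m 7 + m (17 + (n + nth 0 (nth [] rows (m 5)) (suc (m 4)))) ≡ m 7 + mark m₀ y
      value = cong (m 7 +_) (trans (cong (mark m) (trans (neighbour-at v (m 4) source)
        (trans (cong (nth 0 (row v)) (sym (+-identityʳ (m 4)))) (reads 0)))) (marks y))
      partial′ : m 7 + mark m₀ y + ∑ ys (mark m₀) ≡ total
      partial′ = trans (+-assoc (m 7) (mark m₀ y) _) partial
    done : ∀ {m′} → CountInv m₀ v total 0 m′ → Prepared m′ × m′ 7 ≡ total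
    done {m′} record { suffix = [] ; table = table ; partial = partial } = table , trans (sym (+-identityʳ (m′ 7))) partial

-- Distribution of the sampler

∑ᴸ : {A : Set} → List A → (A → ℚ) → ℚ
∑ᴸ xs f = foldr (λ x s → f x ℚ.+ s) 0ℚ xs

∑ᴸ-lookup : ∀ {A : Set} xs (f : A → ℚ) → ∑ℚ (λ i → f (lookup xs i)) ≡ ∑ᴸ xs f
∑ᴸ-lookup []       f = refl
∑ᴸ-lookup (x ∷ xs) f = cong (f x ℚ.+_) (∑ᴸ-lookup xs f)

∑ᴸ-++ : ∀ {A : Set} xs ys (f : A → ℚ) → ∑ᴸ (xs ++ ys) f ≡ ∑ᴸ xs f ℚ.+ ∑ᴸ ys f
∑ᴸ-++ []       ys f = sym (ℚ.+-identityˡ _)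
∑ᴸ-++ (x ∷ xs) ys f = trans (cong (f x ℚ.+_) (∑ᴸ-++ xs ys f)) (sym (ℚ.+-assoc (f x) _ _))

∑ᴸ-concatMap : ∀ {A A′ : Set} (g : A → List A′) xs (f : A′ → ℚ) → ∑ᴸ (concatMap g xs) f ≡ ∑ᴸ xs (λ x → ∑ᴸ (g x) f)
∑ᴸ-concatMap g []       f = refl
∑ᴸ-concatMap g (x ∷ xs) f = trans (∑ᴸ-++ (g x) (concatMap g xs) f) (cong (∑ᴸ (g x) f ℚ.+_) (∑ᴸ-concatMap g xs f))

∑ᴸ-tabulate : ∀ {A : Set} {k} (g : Fin k → A) (f : A → ℚ) → ∑ᴸ (tabulate g) f ≡ ∑ℚ (f ∘ g)
∑ᴸ-tabulate {k = zero}  g f = refl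
∑ᴸ-tabulate {k = suc k} g f = cong (f (g zero) ℚ.+_) (∑ᴸ-tabulate (g ∘ suc) f)

ratio-*-ratio : ∀ a b .{{_ : NonZero a}} .{{_ : NonZero b}} → ratio a b ℚ.* ratio 1 a ≡ ratio 1 b
ratio-*-ratio a b = *-cancelʳ-fromℕ-≡ b (*-cancelʳ-fromℕ-≡ a (begin
  ratio a b ℚ.* ratio 1 a ℚ.* fromℕ b ℚ.* fromℕ a         ≡⟨ swap (ratio a b) (ratio 1 a) (fromℕ b) (fromℕ a) ⟩
  ratio a b ℚ.* fromℕ b ℚ.* (ratio 1 a ℚ.* fromℕ a)       ≡⟨ cong₂ ℚ._*_ (ratio-*-fromℕ a b) (ratio-*-fromℕ 1 a) ⟩
  fromℕ a ℚ.* fromℕ 1                                     ≡⟨ ℚ.*-comm (fromℕ a) (fromℕ 1) ⟩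
  fromℕ 1 ℚ.* fromℕ a                                     ≡⟨ cong (ℚ._* fromℕ a) (ratio-*-fromℕ 1 b) ⟨
  ratio 1 b ℚ.* fromℕ b ℚ.* fromℕ a ∎))
  where
  open ≡-Reasoning
  open ℚSolver.+-*-Solver
  swap : ∀ x y z w → x ℚ.* y ℚ.* z ℚ.* w ≡ x ℚ.* z ℚ.* (y ℚ.* w)
  swap = solve 4 (λ x y z w → x :* y :* z :* w := x :* z :* (y :* w)) refl

-- For a deterministic continuation: the tree on the left goes on where the one on the right has
-- already returned.
Lift-extend : ∀ {A A′ K : Set} {R : A → A′ → Set} {S : K → A′ → Set} {g : A → Rand K} {r r′} → Lift R r r′ →
  (∀ {a a′} → R a a′ → Lift S (g a) (return a′)) → Lift S (r >>= g) r′
Lift-extend (return x)        h = h x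
Lift-extend (choose 0≤w fs) h = choose 0≤w (λ i → Lift-extend (fs i) h)

uniformFin : ∀ W → Rand (Fin W)
uniformFin W = choose W (λ _ → ratio 1 W) return

uniformBelow-Lift : ∀ W .{{_ : NonZero W}} {k} → k ≡ W → Lift (λ x i → x ≡ toℕ i) (uniformBelow k) (uniformFin W)
uniformBelow-Lift (suc W) refl = choose (λ _ → 0≤ratio 1 (suc W)) (λ i → return refl)

-- All that the analysis of the main program needs of the sampler: the setup is deterministic, and
-- each sample is coupled with a uniform index `i` whose value is `Z i`, whatever samples came
-- before.
record Implementation (I : Input) {W : ℕ} (Z : Fin W → ℕ) (K V τ₀ τ : ℕ) : Set₁ where
  field
    Ready       : Memory → Set
    {initial}   : Memory
    {used}      : Usage
    setup-runs  : execDraw I setupᶜ blank ≡ return (initial , used)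
    setup-ready : Ready initial
    setup-fits  : Fits K V τ₀ 0 used
    sample-runs : ∀ {m} → Ready m →
      Lift (λ (m′ , u) i → Ready m′ × m′ 0 ≡ Z i × Fits K V τ 0 u) (execDraw I wsampᶜ m) (uniformFin W)

module WSampCorrect {n : ℕ} (G : BipartiteGraph n) (K V D : ℕ)
  (K≥ : 17 + (n + n) ≤ K) (n≤V : n ≤ V) (nW≤V : n * length (Moments.wedgeList G) ≤ V)
  (W≤V : length (Moments.wedgeList G) ≤ V) (1≤V : 1 ≤ V)
  (degree≤D : ∀ v → degree G v ≤ D) (degree≤n : ∀ v → degree G v ≤ n)
  .{{W≢0 : NonZero (length (Moments.wedgeList G))}} where

  open BipartiteGraph G
  open Moments G
  open Sampler G K V D K≥ n≤V nW≤V W≤V 1≤V degree≤D degree≤n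
  open Logic (storedGraph G) (performDraw (storedGraph G)) K V
  open DecMembership (Fin._≟_ {n}) using (_∈?_)

  value : Fin W → ℕ
  value i = β (lookup wedgeList i) * W

  ends : Fin W → ℕ × ℕ
  ends i = let (a , b) = lookup wedgeList i in toℕ a , toℕ b

  nth-row-pairs : ∀ i v j → j < tri (degree G v) → toℕ i ≡ offset xss (toℕ v) + j →
    nth (0 , 0) (pairs (row v)) j ≡ ends i
  nth-row-pairs i v j j< i≡ = begin
    nth (0 , 0) (pairs (row v)) j
      ≡⟨ cong (λ xs → nth (0 , 0) xs j) at-v ⟨
    nth (0 , 0) (nth [] xss (toℕ v)) j
      ≡⟨ nth-concat (0 , 0) xss (toℕ v) (≤-trans j< (≤-reflexive (sym
           (trans (cong length at-v) (trans (length-pairs (row v)) (cong tri (length-row v))))))) ⟨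
    nth (0 , 0) (concat xss) (offset xss (toℕ v) + j)
      ≡⟨ cong₂ (nth (0 , 0)) concat-xss (sym i≡) ⟩
    nth (0 , 0) (map (λ (a , b) → toℕ a , toℕ b) wedgeList) (toℕ i)
      ≡⟨ nth-map-lookup (0 , 0) _ wedgeList i ⟩
    ends i ∎
    where
    open ≡-Reasoning
    at-v : nth [] xss (toℕ v) ≡ pairs (row v)
    at-v = nth-map-allFin [] (λ v → pairs (row v)) v

  ∑-marks : ∀ {f : ℕ → ℕ} a b → (∀ {x} → x ∈ row b → f x ≡ 1) → (∀ {x} → x ∈ row a → x ∉ row b → f x ≡ 0) →
    ∑ (row a) f ≡ k a b
  ∑-marks {f} a b one zero′ = trans (∑-map f toℕ (Γ a))
    (trans (∑-cong∈ (Γ a) pointwise) (sym (length-filter (_∈? Γ b) (Γ a))))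
    where
    pointwise : ∀ {x} → x ∈ Γ a → f (toℕ x) ≡ 𝟙 (x ∈? Γ b)
    pointwise {x} x∈ with x ∈? Γ b
    ... | yes x∈b = one (∈-map⁺ toℕ x∈b)
    ... | no x∉b = zero′ (∈-map⁺ toℕ x∈) (λ x∈′ → x∉b (unmap x∈′))
      where
      unmap : toℕ x ∈ row b → x ∈ Γ b
      unmap x∈′ with ∈-map⁻ toℕ x∈′
      ... | y , y∈ , e = subst (_∈ Γ b) (sym (Fin.toℕ-injective e)) y∈

  abstract

    -- The costs of the pieces of `wedgeᶜ` in the order in which the triples add them; it is
    -- abstract to keep the numerals folded.
    T₀ : ℕ
    T₀ = 3 + (5 + (100 + ⌈log₂ n ⌉ * 100 + (10 + (3 + (10 + (100 + D * 100 +
      (11 + (16 + (200 + D * 100 + (200 + D * 100 + (200 + D * 100 + 13)))))))))))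

    wedge-correct : ∀ {m} i → Prepared m → m 1 ≡ toℕ i →
      Triple wedgeᶜ m tt T₀ (λ m′ → Prepared m′ × m′ 0 ≡ value i)
    wedge-correct {m} i prep r≡ =
      assign⨾ refl refl literal< z≤n
      (assign⨾ refl refl literal< n≤V
      (search-correct (toℕ i) prep r≡ refl refl (Fin.toℕ<n i) ⨾! λ { {m₁} (prep₁ , r≡₁ , v , u≡ , j , j< , i≡) →
        assign⨾ refl (index {m₁} prep₁ r≡₁ u≡ i≡) literal<
          (≤-trans (≤-trans (m≤n+m j (offset xss (toℕ v))) (≤-reflexive (sym i≡))) (≤-trans (<⇒≤ (Fin.toℕ<n i)) W≤V))
        (assign⨾ refl refl literal< z≤n
        (assign⨾ refl (cong (_∸ 1) (degree-at v u≡)) literal< (≤-trans (m∸n≤m _ 1) (≤-trans (degree≤n v) n≤V))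
        (locate-correct v j prep₁ u≡ refl refl j< refl ⨾! λ { {m₂} (prep₂ , u≡₂ , found) → rest {m₂} v j j< i≡ prep₂ u≡₂ found }))) }))
      where
      a b : Fin n
      a = proj₁ (lookup wedgeList i)
      b = proj₂ (lookup wedgeList i)
      index : ∀ {m} → Prepared m → m 1 ≡ toℕ i → ∀ {v : Fin n} {j} → m 2 ≡ toℕ v → toℕ i ≡ offset xss (toℕ v) + j →
        m 1 ∸ m (16 + m 2) ≡ j
      index {m} prep r≡ {v} {j} u≡ i≡ = trans (cong₂ _∸_ (trans r≡ i≡)
        (trans (prep (m 2) (≤-trans (≤-reflexive u≡) (<⇒≤ (Fin.toℕ<n v)))) (cong (offset xss) u≡)))
        (m+n∸m≡n (offset xss (toℕ v)) j)
      keep : ∀ {m m′} → Keeps m m′ → Prepared m → Prepared m′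
      keep keeps prep j j≤n = trans (keeps (16 + j) (+-monoʳ-≤ 16 j≤n) (λ ())) (prep j j≤n)
      rest : ∀ {m} v j → j < tri (degree G v) → toℕ i ≡ offset xss (toℕ v) + j → Prepared m → m 2 ≡ toℕ v →
        nth (0 , 0) (pairs (row v)) j ≡ (nth 0 (row v) (m 4) , nth 0 (row v) (m 4 + 1 + m 1)) →
        Triple intersectᶜ m tt (11 + (16 + (200 + D * 100 + (200 + D * 100 + (200 + D * 100 + 13)))))
          (λ m′ → Prepared m′ × m′ 0 ≡ value i)
      rest {m} v j j< i≡ prep u≡ found =
        assign⨾ {w = toℕ a} refl (trans (neighbour-at v (m 4) u≡) (sym (cong proj₁ found′))) literal< (≤-trans (<⇒≤ (Fin.toℕ<n a)) n≤V)
        (assign⨾ {w = toℕ b} refl (trans (neighbour-at v (m 4 + 1 + m 1) u≡) (sym (cong proj₂ found′))) literal< (≤-trans (<⇒≤ (Fin.toℕ<n b)) n≤V)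
        (fill-correct 5 0 a refl (λ ()) ≤! z≤n ⨾! λ { {m₁} (keeps₁ , marked₁ , _) →
        fill-correct 6 1 b (keeps₁ 6 (≤-trans (≤! {6} {16}) (m≤m+n 16 n)) (λ ())) (λ ()) ≤! ≤-refl ⨾! λ { {m₂} (keeps₂ , marked₂ , untouched₂) →
        let total≡ = ∑-marks {mark m₂} a b marked₂ (λ x∈a x∉b → trans (untouched₂ x∉b) (marked₁ x∈a)) in
        count-correct a (trans (keeps₂ 5 (≤-trans (≤! {5} {16}) (m≤m+n 16 n)) (λ ())) (keeps₁ 5 (≤-trans (≤! {5} {16}) (m≤m+n 16 n)) (λ ()))) (keep keeps₂ (keep keeps₁ prep))
          (≤-trans (≤-reflexive total≡) (≤-trans (k≤n a b) n≤V)) ⨾! λ { {m₃} (prep₃ , total₃) →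
        assign refl (cong₂ _*_ (cong (_∸ 1) (trans total₃ total≡)) (trans (prep₃ n ≤-refl) offset-n)) literal<
          (≤-trans (*-monoˡ-≤ W (≤-trans (m∸n≤m (k a b) 1) (k≤n a b))) nW≤V) (prep₃ , refl) } } }))
        where
        found′ : ends i ≡ (nth 0 (row v) (m 4) , nth 0 (row v) (m 4 + 1 + m 1))
        found′ = trans (sym (nth-row-pairs i v j j< i≡)) found

    T₀-linear : T₀ ≡ 871 + ⌈log₂ n ⌉ * 100 + D * 400
    T₀-linear = lemma ⌈log₂ n ⌉ D
      where
      lemma : ∀ l d → 3 + (5 + (100 + l * 100 + (10 + (3 + (10 + (100 + d * 100 +
        (11 + (16 + (200 + d * 100 + (200 + d * 100 + (200 + d * 100 + 13))))))))))) ≡ 871 + l * 100 + d * 400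
      lemma = solve-∀

  Sampled : Memory × Usage → Fin W → Set
  Sampled (m , u) i = Prepared m × m 0 ≡ value i × Fits K V (T₀ + 10) 0 u

  sample-Lift : ∀ {m} → Prepared m → Lift Sampled (execDraw (storedGraph G) wsampᶜ m) (uniformFin W)
  sample-Lift {m} prep = Lift->>=-return (λ ((m′ , _) , u) → m′ , u)
    (Lift-extend (Lift->>=-return _ (uniformBelow-Lift W (trans (prep n ≤-refl) offset-n)) (λ {x} {i} x≡ → first x i x≡))
      (λ {s} {i} → second s i)) id
    where
    After : (Memory × ⊤) × Usage → Fin W → Set
    After ((m′ , _) , u) i = Sampled (m′ , u) i
    Drawn : (Memory × ⊤) × Usage → Fin W → Set
    Drawn ((m′ , _) , u) i = Prepared m′ × m′ 1 ≡ toℕ i × Fits K V 10 0 u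
    first : ∀ x (i : Fin W) → x ≡ toℕ i → Drawn ((m [ 1 ↦ x ] , tt) , (steps 7 ⊕ write 1 x)) i
    first x i refl = prep , refl , fits (≤! {8} {10}) refl literal< (≤-trans (<⇒≤ (Fin.toℕ<n i)) W≤V)
    second : ∀ s i → Drawn s i → Lift After (charge (proj₂ s) (exec (storedGraph G) (performDraw (storedGraph G)) wedgeᶜ (proj₁ s))) (return i)
    second ((m′ , tt) , u) i (prep′ , m1≡ , fit) = Det-Lift (holds (wedge-correct i prep′ m1≡))
      (λ { {_} {v} (prep″ , m0≡) cost → prep″ , m0≡ , Fits-mono (≤-reflexive (+-comm 10 T₀)) (Fits-⊕ fit cost) })

  Triple⇒execDraw : ∀ {c m t Q} → Triple c m tt t Q →
    ∃ λ m′ → ∃ λ u → execDraw (storedGraph G) c m ≡ return (m′ , u) × Q m′ × Fits K V t 0 u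
  Triple⇒execDraw (triple (det {m} {u} e cost q)) = m , u , cong (_>>= λ ((m′ , _) , u) → return (m′ , u)) e , q , cost

  setup-cost : ∃ λ m → ∃ λ u → execDraw (storedGraph G) setupᶜ blank ≡ return (m , u) × Prepared m × Fits K V (4 + n * 100) 0 u
  setup-cost = Triple⇒execDraw setup-correct

  implementation : Implementation (storedGraph G) value K V (4 + n * 100) (881 + ⌈log₂ n ⌉ * 100 + D * 400)
  implementation = record
    { Ready = Prepared
    ; setup-runs = proj₁ (proj₂ (proj₂ setup-cost))
    ; setup-ready = proj₁ (proj₂ (proj₂ (proj₂ setup-cost)))
    ; setup-fits = proj₂ (proj₂ (proj₂ (proj₂ setup-cost)))
    ; sample-runs = λ {m} prep → Lift-map (λ (prep′ , m0≡ , fit) → prep′ , m0≡ , Fits-mono T₀+10≤ fit) (sample-Lift {m} prep)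
    }
    where
    lemma : ∀ c x y → c + x + y + 10 ≡ c + 10 + x + y
    lemma = solve-∀
    T₀+10≤ : T₀ + 10 ≤ 881 + ⌈log₂ n ⌉ * 100 + D * 400
    T₀+10≤ = ≤-reflexive (trans (cong (_+ 10) T₀-linear) (lemma 871 (⌈log₂ n ⌉ * 100) (D * 400)))

  module _ (mainᶜ : Cmd Call) where

    private
      𝒜 : Algorithm
      𝒜 = record { setup = setupᶜ ; wsamp = wsampᶜ ; main = mainᶜ }

    reachable⇒prepared : ∀ {m} → Reachable 𝒜 G m → Prepared m
    reachable⇒prepared (prepared o) =
      let (_ , _ , e , prep , _) = setup-cost in subst Prepared (sym (cong proj₁ (return-outcome e o))) prep
    reachable⇒prepared (sampled {m} r o) = proj₁ (proj₂ (Lift-outcome (sample-Lift {m} (reachable⇒prepared r)) o))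

    -- A centre of weight C(d, 2) / ∧ followed by a uniform choice among its C(d, 2) pairs gives
    -- every wedge the weight 1 / ∧, which is the distribution of a uniform index into `wedgeList`.
    implements : ImplementsWSamp 𝒜 G
    implements {m} r x = begin
      Pr (λ (m′ , _) → ratio (m′ 0) 4 ℚ.≟ x) (sample 𝒜 G m)
        ≡⟨ Lift-Pr-≡ (λ (m′ , _) → ratio (m′ 0) 4 ℚ.≟ x) (λ i → ratio (value i) 4 ℚ.≟ x) (λ (_ , m0≡ , _) → cong (λ z → does (ratio z 4 ℚ.≟ x)) m0≡)
             (sample-Lift {m} (reachable⇒prepared r)) ⟩
      ∑ℚ (λ i → ratio 1 W ℚ.* hit (lookup wedgeList i))
        ≡⟨ trans (∑ℚ-*ˡ (ratio 1 W) (λ i → hit (lookup wedgeList i))) (cong (ratio 1 W ℚ.*_) (∑ᴸ-lookup wedgeList hit)) ⟩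
      ratio 1 W ℚ.* ∑ᴸ wedgeList hit
        ≡⟨ cong (ratio 1 W ℚ.*_) (trans (∑ᴸ-concatMap (λ u → pairs (Γ u)) (allFin n) hit) (∑ᴸ-tabulate id (λ u → ∑ᴸ (pairs (Γ u)) hit))) ⟩
      ratio 1 W ℚ.* ∑ℚ (λ u → ∑ᴸ (pairs (Γ u)) hit)
        ≡⟨ ∑ℚ-*ˡ (ratio 1 W) (λ u → ∑ᴸ (pairs (Γ u)) hit) ⟨
      ∑ℚ (λ u → ratio 1 W ℚ.* ∑ᴸ (pairs (Γ u)) hit)
        ≡⟨ ∑ℚ-cong (λ u → centre (pairs (Γ u)) (degree G u C 2) (trans (tri≡C2 (degree G u)) (sym (length-pairs (Γ u))))) ⟩
      Pr (ℚ._≟ x) (WSamp G) ∎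
      where
      open ≡-Reasoning
      hit : Fin n × Fin n → ℚ
      hit w = if does (ratio (β w * W) 4 ℚ.≟ x) then 1ℚ else 0ℚ
      hit′ : Fin n × Fin n → ℚ
      hit′ w = if does (ratio (β w * wedges G) 4 ℚ.≟ x) then 1ℚ else 0ℚ
      hit≡ : ∀ w → hit w ≡ hit′ w
      hit≡ w = cong (λ z → if does (ratio (β w * z) 4 ℚ.≟ x) then 1ℚ else 0ℚ) length-wedgeList
      centre : ∀ ps c → c ≡ length ps → ratio 1 W ℚ.* ∑ᴸ ps hit ≡
        ratio c (wedges G) ℚ.* ∑ℚ (λ i → ratio 1 (length ps) ℚ.* hit′ (lookup ps i))
      -- A centre of degree below 2 leads to a choice without branches, whose probability is the
      -- empty sum, just as it contributes no wedges.
      centre []         _ refl = trans (ℚ.*-zeroʳ (ratio 1 W)) (sym (ℚ.*-zeroʳ (ratio 0 (wedges G))))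
      centre ps@(_ ∷ _) _ refl = begin
        ratio 1 W ℚ.* ∑ᴸ ps hit
          ≡⟨ cong (ratio 1 W ℚ.*_) (trans (sym (∑ᴸ-lookup ps hit)) (∑ℚ-cong (λ i → hit≡ (lookup ps i)))) ⟩
        ratio 1 W ℚ.* ∑ℚ (λ i → hit′ (lookup ps i))
          ≡⟨ cong (ℚ._* ∑ℚ (λ i → hit′ (lookup ps i))) (ratio-*-ratio (length ps) W) ⟨
        ratio (length ps) W ℚ.* ratio 1 (length ps) ℚ.* ∑ℚ (λ i → hit′ (lookup ps i))
          ≡⟨ ℚ.*-assoc (ratio (length ps) W) (ratio 1 (length ps)) (∑ℚ (λ i → hit′ (lookup ps i))) ⟩
        ratio (length ps) W ℚ.* (ratio 1 (length ps) ℚ.* ∑ℚ (λ i → hit′ (lookup ps i)))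
          ≡⟨ cong₂ (λ w s → ratio (length ps) w ℚ.* s) length-wedgeList (sym (∑ℚ-*ˡ (ratio 1 (length ps)) (λ i → hit′ (lookup ps i)))) ⟩
        ratio (length ps) (wedges G) ℚ.* ∑ℚ (λ i → ratio 1 (length ps) ℚ.* hit′ (lookup ps i)) ∎

-- The selected level is accurate up to a factor 1 ± p / q, unless one of the
-- tails of two fixed levels is large.

module Accuracy {W : ℕ} .{{_ : NonZero W}} (Z : Fin W → ℕ) (b₀ M p q N R L : ℕ) .{{p≢0 : NonZero p}} .{{q≢0 : NonZero q}}
  (0<b₀ : 0 < b₀) (1≤M : 1 ≤ M) (p≤q : p ≤ q) (0<N : 0 < N)
  (enough : 64 * (M * (q * q)) * R ≤ p * p * N) (Z≤ : ∀ i → Z i ≤ 2 ^ L)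
  (∑Z : ∑ (allFin W) Z ≡ W * (4 * b₀)) (∑Z² : ∑ (allFin W) (λ i → Z i * Z i) ≤ W * (4 * (M * (b₀ * b₀)))) where

  open Levels Z
  open Tails W Z (4 * b₀) (4 * (M * (b₀ * b₀))) ∑Z ∑Z²

  1≤p : 1 ≤ p
  1≤p = >-nonZero⁻¹ p

  -- Divided by p it is 4 M b₀ / ε, the least θ for which the mean square 4 M b₀² over θ is at most
  -- ε b₀.
  target : ℕ
  target = 4 * (M * (q * b₀))

  p≤target : p ≤ target
  p≤target = ≤-trans p≤q (≤-trans (m≤m*n q b₀ {{>-nonZero 0<b₀}}) (≤-trans (m≤n*m (q * b₀) M {{>-nonZero 1≤M}}) (m≤n*m (M * (q * b₀)) 4)))

  level₀ : ℕ
  level₀ = proj₁ (dyadic-between p target 1≤p p≤target)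

  level₀-lower : target ≤ p * 2 ^ level₀
  level₀-lower = proj₁ (proj₂ (dyadic-between p target 1≤p p≤target))

  level₀-upper : p * 2 ^ level₀ < 2 * target
  level₀-upper = proj₂ (proj₂ (dyadic-between p target 1≤p p≤target))

  Bad : List (Fin W) → Set
  Bad h = q * level h level₀ + 2 * (N * (p * b₀)) ≤ N * (q * (4 * b₀)) ⊎
          N * (q * (4 * b₀)) + 2 * (N * (p * b₀)) ≤ q * level h (3 + level₀)

  bad? : Decidable Bad
  bad? h = (_ ≤? _) ⊎-dec (_ ≤? _)

  2≤θ : 2 ≤ 2 ^ level₀
  2≤θ = ≤-trans (s≤s (s≤s z≤n)) (*-cancelˡ-≤ p (≤-trans (≤-reflexive (*-comm p 4)) (≤-trans (*-monoʳ-≤ 4 p≤Mqb) level₀-lower)))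
    where
    p≤Mqb : p ≤ M * (q * b₀)
    p≤Mqb = ≤-trans p≤q (≤-trans (m≤m*n q b₀ {{>-nonZero 0<b₀}}) (m≤n*m (q * b₀) M {{>-nonZero 1≤M}}))

  θ≤8θ : 2 ^ level₀ ≤ 2 ^ (3 + level₀)
  θ≤8θ = ^-monoʳ-≤ 2 (m≤n+m level₀ 3)

  bias : ∀ {θ} → 2 ^ level₀ ≤ θ → q * (4 * (M * (b₀ * b₀))) ≤ p * b₀ * θ
  bias {θ} θ≥ = begin
    q * (4 * (M * (b₀ * b₀)))     ≡⟨ lemma₁ q M b₀ ⟩
    target * b₀                   ≤⟨ *-monoˡ-≤ b₀ (≤-trans level₀-lower (*-monoʳ-≤ p θ≥)) ⟩
    p * θ * b₀                    ≡⟨ lemma₂ p θ b₀ ⟩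
    p * b₀ * θ ∎
    where
    open ≤-Reasoning
    lemma₁ : ∀ q M b → q * (4 * (M * (b * b))) ≡ 4 * (M * (q * b)) * b
    lemma₁ = solve-∀
    lemma₂ : ∀ p θ b → p * θ * b ≡ p * b * θ
    lemma₂ = solve-∀

  -- The origin of 64 = 8 · 2 · 4: the upper tail sits three levels above `level₀`, dyadic rounding
  -- loses a factor 2, and `target` carries the 4.
  decay : q * 2 ^ (3 + level₀) * R ≤ N * (p * b₀)
  decay = *-cancelˡ-≤ p (begin
    p * (q * 2 ^ (3 + level₀) * R)     ≡⟨ lemma₁ p q (2 ^ level₀) R ⟩
    8 * (p * 2 ^ level₀) * (q * R)     ≤⟨ *-monoˡ-≤ (q * R) (*-monoʳ-≤ 8 (<⇒≤ level₀-upper)) ⟩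
    8 * (2 * target) * (q * R)         ≡⟨ lemma₂ M q b₀ R ⟩
    64 * (M * (q * q)) * R * b₀        ≤⟨ *-monoˡ-≤ b₀ enough ⟩
    p * p * N * b₀                        ≡⟨ lemma₃ p N b₀ ⟩
    p * (N * (p * b₀)) ∎)
    where
    open ≤-Reasoning
    lemma₁ : ∀ p q x t → p * (q * (2 * (2 * (2 * x))) * t) ≡ 8 * (p * x) * (q * t)
    lemma₁ = solve-∀
    lemma₂ : ∀ M q b t → 8 * (2 * (4 * (M * (q * b)))) * (q * t) ≡ 64 * (M * (q * q)) * t * b
    lemma₂ = solve-∀
    lemma₃ : ∀ p N b → p * p * N * b ≡ p * (N * (p * b))
    lemma₃ = solve-∀

  Pr-bad : fromℕ (2 ^ R) ℚ.* Pr bad? (drawsFrom W N []) ℚ.≤ fromℕ 2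
  Pr-bad = tails q (p * b₀) N R (2 ^ level₀) (2 ^ (3 + level₀)) 2≤θ (≤-trans 2≤θ θ≤8θ) 2r≤
    (bias {2 ^ level₀} ≤-refl) (bias {2 ^ (3 + level₀)} θ≤8θ) (≤-trans (*-monoˡ-≤ R (*-monoʳ-≤ q θ≤8θ)) decay) decay bad? (λ h bad → bad)
    where
    lemma : ∀ q b → q * (4 * b) ≡ 2 * (q * b) + 2 * (q * b)
    lemma = solve-∀
    2r≤ : 2 * (p * b₀) ≤ q * (4 * b₀)
    2r≤ = ≤-trans (*-monoʳ-≤ 2 (*-monoˡ-≤ b₀ p≤q)) (≤-trans (m≤m+n _ _) (≤-reflexive (sym (lemma q b₀))))

  good : ∀ {J} h → ¬ Bad h → Selects M N p q L (level h) J →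
    ¬ (ratio p q ℚ.* fromℕ b₀ ℚ.< ℚ.∣ ratio (level h J) (4 * N) ℚ.- fromℕ b₀ ∣)
  good {J} h ¬bad sel = accurate p q b₀ N (level h J) {{q≢0}} {{>-nonZero 0<N}}
      (selected-lower sel (level-mono h) (level-slope h) saturated b₀ level₀ 0<N p≤q level₀-lower level₀-upper lower upper)
      (selected-upper sel (level-mono h) (level-slope h) saturated b₀ level₀ 0<N p≤q level₀-lower level₀-upper lower upper)
    where
    saturated : ∀ {j} → L ≤ j → level h j ≡ level h L
    saturated = level-saturated h L Z≤
    lower : N * (q * (4 * b₀)) < q * level h level₀ + 2 * (N * (p * b₀))
    lower = ≰⇒> (¬bad ∘ inj₁)
    upper : q * level h (3 + level₀) < N * (q * (4 * b₀)) + 2 * (N * (p * b₀))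
    upper = ≰⇒> (¬bad ∘ inj₂)

-- The main program

pᴱ qᴱ Mᴱ n⁴ᴱ : Expr
Mᴱ = input (lit 0) (lit 1)
pᴱ = input (lit 0) (lit 2)
qᴱ = input (lit 0) (lit 3)
n⁴ᴱ = nᴱ ×ᴱ nᴱ ×ᴱ (nᴱ ×ᴱ nᴱ)

levelᴱ : Expr → Expr
levelᴱ j = lit 16 ∔ j

-- Register 5 gets the number of repetitions, 6 the top level, 7 the number of
-- samples; cell 16 + j accumulates the samples truncated at 2 ^ j.
repetitionsᶜ topᶜ initᶜ accumulateᶜ sampleᶜ selectᶜ mainᶜ : Cmd Call
repetitionsᶜ =
    lit 4 ≔ lit 1
  ⨾ lit 5 ≔ lit 0
  -- Stops at the least T with 2 · 2^-T ≤ δ: there are two tails, each of probability at most 2^-T.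
  ⨾ while reg 4 ×ᴱ input (lit 0) (lit 4) <ᴱ lit 2 ×ᴱ input (lit 0) (lit 5) upto lit 2 ×ᴱ input (lit 0) (lit 5) run
      ( lit 4 ≔ reg 4 ∔ reg 4
      ⨾ lit 5 ≔ reg 5 ∔ lit 1)
topᶜ =
    lit 4 ≔ lit 1
  ⨾ lit 6 ≔ lit 0
  -- No sample exceeds n⁴, so truncation at the top level has no effect.
  ⨾ while reg 4 <ᴱ n⁴ᴱ upto lit 4 ×ᴱ n⁴ᴱ run
      ( lit 4 ≔ reg 4 ∔ reg 4
      ⨾ lit 6 ≔ reg 6 ∔ lit 1)
initᶜ =
    repetitionsᶜ
  ⨾ topᶜ
  ⨾ lit 7 ≔ (lit 64 ×ᴱ (Mᴱ ×ᴱ (qᴱ ×ᴱ qᴱ)) ÷ᴱ (pᴱ ×ᴱ pᴱ) ∔ lit 1) ×ᴱ reg 5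
accumulateᶜ =
    lit 3 ≔ lit 0
  ⨾ lit 4 ≔ lit 1
  ⨾ while lit 1 upto reg 6 ∔ lit 1 run
      ( levelᴱ (reg 3) ≔ load (levelᴱ (reg 3)) ∔ (reg 2 ∸ᴱ (reg 2 ∸ᴱ reg 4))
      ⨾ lit 3 ≔ reg 3 ∔ lit 1
      ⨾ lit 4 ≔ reg 4 ∔ reg 4)
sampleᶜ = while lit 1 upto reg 7 run (effect (call (lit 2)) ⨾ accumulateᶜ)
selectᶜ =
    lit 3 ≔ lit 0
  ⨾ lit 4 ≔ lit 1
  ⨾ while reg 4 ×ᴱ (reg 7 ×ᴱ pᴱ) <ᴱ lit 4 ×ᴱ (Mᴱ ×ᴱ (qᴱ ×ᴱ load (levelᴱ (reg 3)))) upto reg 6 run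
      ( lit 3 ≔ reg 3 ∔ lit 1
      ⨾ lit 4 ≔ reg 4 ∔ reg 4)
  ⨾ lit 0 ≔ load (levelᴱ (reg 3))
  -- The factor 4 is there because the samples come in quarters.
  ⨾ lit 1 ≔ lit 4 ×ᴱ reg 7
mainᶜ = initᶜ ⨾ sampleᶜ ⨾ selectᶜ

-- Correctness and cost of the main program

x∸[x∸t]≡x⊓t : ∀ x t → x ∸ (x ∸ t) ≡ x ⊓ t
x∸[x∸t]≡x⊓t x t with ≤-total x t
... | inj₁ x≤t rewrite m≤n⇒m∸n≡0 x≤t = sym (m≤n⇒m⊓n≡m x≤t)
... | inj₂ t≤x = trans (m∸[m∸n]≡n t≤x) (sym (m≥n⇒m⊓n≡n t≤x))

2^suc : ∀ j → 2 ^ j + 2 ^ j ≡ 2 ^ (j + 1)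
2^suc j = trans (cong (λ x → 2 ^ j + x) (sym (+-identityʳ (2 ^ j)))) (cong (2 ^_) (+-comm 1 j))

-- Written with the division of the machine, so that the value computed by `initᶜ` agrees
-- definitionally. The added 1 compensates the rounding of 64 M / ε².
samples : (M p q T : ℕ) → ℕ
samples M p q T = (apply div (64 * (M * (q * q))) (p * p) + 1) * T

samples-lower : ∀ M p q T .{{_ : NonZero p}} → 64 * (M * (q * q)) * T ≤ p * p * samples M p q T
samples-lower M p@(suc _) q T = begin
  X * T                             ≤⟨ *-monoˡ-≤ T (≤-trans (≤-reflexive (m≡m%n+[m/n]*n X (p * p))) (+-monoˡ-≤ (X / (p * p) * (p * p)) (<⇒≤ (m%n<n X (p * p))))) ⟩
  (p * p + X / (p * p) * (p * p)) * T   ≡⟨ lemma (p * p) (X / (p * p)) T ⟩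
  p * p * ((X / (p * p) + 1) * T) ∎
  where
  open ≤-Reasoning
  X = 64 * (M * (q * q))
  lemma : ∀ d x t → (d + x * d) * t ≡ d * ((x + 1) * t)
  lemma = solve-∀

-- 65 = 64 + 1: the rounding term p² is at most M q², since ε ≤ 1 ≤ M.
samples-upper : ∀ M p q T .{{_ : NonZero p}} → 1 ≤ M → p ≤ q → p * p * samples M p q T ≤ 65 * (M * (q * q)) * T
samples-upper M p@(suc _) q T 1≤M p≤q = begin
  p * p * ((X / (p * p) + 1) * T)   ≡⟨ lemma (p * p) (X / (p * p)) T ⟩
  (X / (p * p) * (p * p) + p * p) * T   ≤⟨ *-monoˡ-≤ T (+-mono-≤ (m/n*n≤m X (p * p)) (≤-trans (*-mono-≤ p≤q p≤q) (m≤n*m (q * q) M {{>-nonZero 1≤M}}))) ⟩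
  (X + M * (q * q)) * T             ≡⟨ lemma₂ (M * (q * q)) T ⟩
  65 * (M * (q * q)) * T ∎
  where
  open ≤-Reasoning
  X = 64 * (M * (q * q))
  lemma : ∀ d x t → d * ((x + 1) * t) ≡ (x * d + d) * t
  lemma = solve-∀
  lemma₂ : ∀ y t → (64 * y + y) * t ≡ 65 * y * t
  lemma₂ = solve-∀

T≤samples : ∀ M p q T → T ≤ samples M p q T
T≤samples M p q T = m≤n*m T (apply div (64 * (M * (q * q))) (p * p) + 1) {{>-nonZero (m≤n+m 1 (apply div (64 * (M * (q * q))) (p * p)))}}

fourth : ℕ → ℕ
fourth n = n * n * (n * n)

module Main {n W : ℕ} .{{_ : NonZero W}} (Z : Fin W → ℕ) (Ready : Memory → Set)
  (sampler : Memory → Run Memory) (K V τ M p q a b Tm zmax : ℕ)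
  (sampler-Lift : ∀ {m} → Ready m → Lift (λ (m′ , u) i → Ready m′ × m′ 0 ≡ Z i × Fits K V τ 0 u) (sampler m) (uniformFin W))
  (Z≤ : ∀ i → Z i ≤ zmax) (zmax≤ : zmax ≤ fourth n) (1≤n : 1 ≤ n) (1≤a : 1 ≤ a) (a≤b : a ≤ b)
  (Tm-large : 2 * b ≤ 2 ^ Tm * a) (Tm≤ : Tm ≤ 2 * b)
  (K≥ : 17 + 4 * ⌈log₂ n ⌉ ≤ K) (4b≤V : 4 * b ≤ V) (n⁴≤V : 4 * fourth n ≤ V)
  (total≤V : samples M p q Tm * zmax ≤ V) (4N≤V : 4 * samples M p q Tm ≤ V) where

  I : Input
  I = (n ∷ M ∷ p ∷ q ∷ a ∷ b ∷ []) ∷ []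

  open Logic I (performCall I sampler) K V
  open Levels Z

  l : ℕ
  l = ⌈log₂ n ⌉

  literal< : ∀ {c} → {_ : T (c ≤ᵇ 16)} → c < K
  literal< {c} {p} = ≤-trans (s≤s (≤ᵇ⇒≤ c 16 p)) (≤-trans (m≤m+n 17 (4 * l)) K≥)

  1≤V : 1 ≤ V
  1≤V = ≤-trans (≤-trans 1≤a (≤-trans a≤b (m≤n*m b 4))) 4b≤V

  Fresh : Memory → Set
  Fresh m = ∀ j → m (16 + j) ≡ 0

  record RepetitionsInv (k : ℕ) (m : Memory) : Set where
    field
      fresh   : Fresh m
      counter : m 5 + k ≡ Tm
      power   : m 4 ≡ 2 ^ m 5
      bounded : m 4 ≤ 4 * b

  Repeated : Memory → Set
  Repeated m = Fresh m × m 5 ≤ Tm × 2 * b ≤ 2 ^ m 5 * a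

  repetitions-correct : ∀ {m x} → Fresh m → Triple repetitionsᶜ m x (200 + Tm * 100) Repeated
  repetitions-correct {m} fr = weaken (+-mono-≤ (≤! {3} {50}) (+-mono-≤ (≤! {3} {50}) (linear′ {6} {26} {13} {Tm} {Tm} ≤-refl))) done
    (assign⨾ refl refl literal< 1≤V (assign⨾ refl refl literal< z≤n (while! RepetitionsInv body Tm Tm≤ record
      { fresh = fr ; counter = refl ; power = refl ; bounded = ≤-trans 1≤a (≤-trans a≤b (m≤n*m b 4)) })))
    where
    body : ∀ {k m x} → RepetitionsInv k m → (if m 4 * a <ᵇ 2 * b then 1 else 0) ≢ 0 →
      ∃ λ k′ → k ≡ suc k′ × Triple _ m x _ (RepetitionsInv k′)
    body {zero} {m} record { counter = counter ; power = power } g = contradiction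
      (≤-trans (guard-true g) (≤-trans Tm-large (≤-reflexive (cong (_* a) (sym (trans power (cong (2 ^_) (trans (sym (+-identityʳ (m 5))) counter))))))))
      (<-irrefl refl)
    body {suc k} {m} record { fresh = fresh ; counter = counter ; power = power ; bounded = bounded } g = k , refl ,
      assign⨾ refl refl literal< (≤-trans doubled≤ 4b≤V)
      (assign refl refl literal< (≤-trans suc≤ (≤-trans doubled≤ 4b≤V)) record
        { fresh = fresh
        ; counter = trans (+-assoc (m 5) 1 k) counter
        ; power = trans (cong₂ _+_ power power) (2^suc (m 5))
        ; bounded = doubled≤ })
      where
      doubled≤ : m 4 + m 4 ≤ 4 * b
      doubled≤ = ≤-trans (+-mono-≤ half half) (≤-reflexive (lemma b))
        where
        half : m 4 ≤ 2 * b
        half = ≤-trans (m≤m*n (m 4) a {{>-nonZero 1≤a}}) (<⇒≤ (guard-true g))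
        lemma : ∀ b → 2 * b + 2 * b ≡ 4 * b
        lemma = solve-∀
      suc≤ : m 5 + 1 ≤ m 4 + m 4
      suc≤ = ≤-trans (<⇒≤ (n<2^n (m 5 + 1))) (≤-reflexive (trans (sym (2^suc (m 5))) (cong₂ _+_ (sym power) (sym power))))
    done : ∀ {m} → (∃ λ k → RepetitionsInv k m) × (if m 4 * a <ᵇ 2 * b then 1 else 0) ≡ 0 → Repeated m
    done {m} ((k , record { fresh = fresh ; counter = counter ; power = power }) , g) =
      fresh , ≤-trans (m≤m+n (m 5) k) (≤-reflexive counter) , subst (λ t → 2 * b ≤ t * a) power (guard-false {m 4 * a} g)

  record TopInv (t₀ k : ℕ) (m : Memory) : Set where
    field
      fresh   : Fresh m
      kept    : m 5 ≡ t₀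
      counter : m 6 + k ≡ 4 * l
      power   : m 4 ≡ 2 ^ m 6
      bounded : m 4 ≤ 2 * fourth n

  Topped : ℕ → Memory → Set
  Topped t₀ m = Fresh m × m 5 ≡ t₀ × m 6 ≤ 4 * l × fourth n ≤ 2 ^ m 6 × 2 ^ m 6 ≤ 2 * fourth n

  1≤n⁴ : 1 ≤ fourth n
  1≤n⁴ = *-mono-≤ (*-mono-≤ 1≤n 1≤n) (*-mono-≤ 1≤n 1≤n)

  n≤n⁴ : n ≤ fourth n
  n≤n⁴ = ≤-trans (m≤m*n n n {{>-nonZero 1≤n}}) (m≤m*n (n * n) (n * n) {{>-nonZero (*-mono-≤ 1≤n 1≤n)}})

  log≤n : l ≤ n
  log≤n = ≤-trans (⌈log₂⌉-mono-≤ (<⇒≤ (n<2^n n))) (≤-reflexive (⌈log₂2^n⌉≡n n))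

  n⁴≤2^ : fourth n ≤ 2 ^ (4 * l)
  n⁴≤2^ = ≤-trans (*-mono-≤ (*-mono-≤ n≤ n≤) (*-mono-≤ n≤ n≤)) (≤-reflexive (sym (trans (cong (2 ^_) (lemma l))
    (trans (^-distribˡ-+-* 2 (l + l) (l + l)) (cong₂ _*_ (^-distribˡ-+-* 2 l l) (^-distribˡ-+-* 2 l l))))))
    where
    n≤ = n≤2^⌈log₂n⌉ n
    lemma : ∀ l → 4 * l ≡ l + l + (l + l)
    lemma = solve-∀

  top-correct : ∀ {m x} t₀ → Fresh m → m 5 ≡ t₀ → Triple topᶜ m x (200 + 4 * l * 100) (Topped t₀)
  top-correct {m} t₀ fr kept₀ = weaken (+-mono-≤ (≤! {3} {50}) (+-mono-≤ (≤! {3} {50}) (linear′ {18} {32} {19} {4 * l} {4 * l} ≤-refl))) done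
    (assign⨾ refl refl literal< 1≤V (assign⨾ refl refl literal< z≤n (while! (TopInv t₀) body (4 * l) (*-monoʳ-≤ 4 (≤-trans log≤n n≤n⁴)) record
      { fresh = fr ; kept = kept₀ ; counter = refl ; power = refl ; bounded = ≤-trans 1≤n⁴ (m≤n*m (fourth n) 2) })))
    where
    body : ∀ {k m x} → TopInv t₀ k m → (if m 4 <ᵇ fourth n then 1 else 0) ≢ 0 →
      ∃ λ k′ → k ≡ suc k′ × Triple _ m x _ (TopInv t₀ k′)
    body {zero} {m} record { counter = counter ; power = power } g = contradiction
      (≤-trans (guard-true g) (≤-trans n⁴≤2^ (≤-reflexive (sym (trans power (cong (2 ^_) (trans (sym (+-identityʳ (m 6))) counter)))))))
      (<-irrefl refl)
    body {suc k} {m} record { fresh = fresh ; kept = kept ; counter = counter ; power = power ; bounded = bounded } g = k , refl ,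
      assign⨾ refl refl literal< (≤-trans doubled≤ 2n⁴≤V)
      (assign refl refl literal< (≤-trans suc≤ (≤-trans doubled≤ 2n⁴≤V)) record
        { fresh = fresh
        ; kept = kept
        ; counter = trans (+-assoc (m 6) 1 k) counter
        ; power = trans (cong₂ _+_ power power) (2^suc (m 6))
        ; bounded = doubled≤ })
      where
      2n⁴≤V : 2 * fourth n ≤ V
      2n⁴≤V = ≤-trans (*-monoˡ-≤ (fourth n) {2} {4} ≤!) n⁴≤V
      doubled≤ : m 4 + m 4 ≤ 2 * fourth n
      doubled≤ = ≤-trans (+-mono-≤ below below) (≤-reflexive (cong (fourth n +_) (sym (+-identityʳ (fourth n)))))
        where
        below : m 4 ≤ fourth n
        below = <⇒≤ (guard-true {m 4} {fourth n} g)
      suc≤ : m 6 + 1 ≤ m 4 + m 4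
      suc≤ = ≤-trans (<⇒≤ (n<2^n (m 6 + 1))) (≤-reflexive (trans (sym (2^suc (m 6))) (cong₂ _+_ (sym power) (sym power))))
    done : ∀ {m} → (∃ λ k → TopInv t₀ k m) × (if m 4 <ᵇ fourth n then 1 else 0) ≡ 0 → Topped t₀ m
    done {m} ((k , record { fresh = fresh ; kept = kept ; counter = counter ; power = power ; bounded = bounded }) , g) =
      fresh , kept , ≤-trans (m≤m+n (m 6) k) (≤-reflexive counter) , subst (fourth n ≤_) power (guard-false {m 4} g)
      , subst (_≤ 2 * fourth n) power bounded

  record Initialised (m : Memory) : Set where
    field
      fresh    : Fresh m
      T≤Tm     : m 5 ≤ Tm
      T-large  : 2 * b ≤ 2 ^ m 5 * a
      L≤       : m 6 ≤ 4 * l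
      n⁴≤2^L   : fourth n ≤ 2 ^ m 6
      2^L≤     : 2 ^ m 6 ≤ 2 * fourth n
      count    : m 7 ≡ samples M p q (m 5)

  abstract

    initTime : ℕ
    initTime = 500 + Tm * 100 + 4 * l * 100

    initTime≡ : initTime ≡ 500 + Tm * 100 + 4 * l * 100
    initTime≡ = refl

    init-correct : ∀ {m x} → Fresh m → Triple initᶜ m x initTime Initialised
    init-correct {m} fr = weaken (≤-trans (≤-reflexive (lemma (Tm * 100) (4 * l * 100))) (+-monoˡ-≤ (4 * l * 100) (+-monoˡ-≤ (Tm * 100) (≤! {428} {500})))) id
      (repetitions-correct fr ⨾! λ { {m₁} (fr₁ , T≤ , T-large) →
       top-correct (m₁ 5) fr₁ refl ⨾! λ { {m₂} (fr₂ , kept , L≤ , n⁴≤ , ≤n⁴) →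
       assign refl refl literal< (≤-trans (m≤n*m _ 4) (≤-trans (*-monoʳ-≤ 4 (*-monoʳ-≤ (apply div (64 * (M * (q * q))) (p * p) + 1) (≤-trans (≤-reflexive kept) T≤))) 4N≤V)) record
         { fresh = fr₂ ; T≤Tm = ≤-trans (≤-reflexive kept) T≤ ; T-large = subst (λ t → 2 * b ≤ 2 ^ t * a) (sym kept) T-large
         ; L≤ = L≤ ; n⁴≤2^L = n⁴≤ ; 2^L≤ = ≤n⁴ ; count = refl } } })
      where
      lemma : ∀ x y → 200 + x + (200 + y + 28) ≡ 428 + x + y
      lemma = solve-∀

  abstract

    accumulateTime selectTime sampleTime : ℕ
    accumulateTime = 100 + (4 * l + 1) * 100
    selectTime = 300 + 4 * l * 100
    sampleTime = τ + 10 + accumulateTime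

    accumulateTime≡ : accumulateTime ≡ 100 + (4 * l + 1) * 100
    accumulateTime≡ = refl

    selectTime≡ : selectTime ≡ 300 + 4 * l * 100
    selectTime≡ = refl

    sampleTime≡ : sampleTime ≡ τ + 10 + accumulateTime
    sampleTime≡ = refl

  mainTime : ℕ → ℕ
  mainTime N = initTime + (3 + N * (2 + sampleTime) + selectTime)

  module Sampling (L N : ℕ) (L≤ : L ≤ 4 * l) (n⁴≤2^L : fourth n ≤ 2 ^ L) (2^L≤ : 2 ^ L ≤ 2 * fourth n)
    (N*zmax≤V : N * zmax ≤ V) (4N≤V′ : 4 * N ≤ V) where

    cell< : ∀ {j} → j ≤ L → 16 + j < K
    cell< j≤L = ≤-trans (+-monoʳ-≤ 17 (≤-trans j≤L L≤)) K≥

    2^suc≤V : ∀ {j} → j ≤ L → 2 ^ j + 2 ^ j ≤ V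
    2^suc≤V {j} j≤L = ≤-trans (+-mono-≤ le le) (≤-trans (≤-reflexive (lemma (fourth n))) n⁴≤V)
      where
      le : 2 ^ j ≤ 2 * fourth n
      le = ≤-trans (^-monoʳ-≤ 2 j≤L) 2^L≤
      lemma : ∀ x → 2 * x + 2 * x ≡ 4 * x
      lemma = solve-∀

    suc≤V : ∀ {j} → j ≤ L → j + 1 ≤ V
    suc≤V {j} j≤L = ≤-trans (<⇒≤ (n<2^n (j + 1))) (≤-trans (≤-reflexive (sym (2^suc j))) (2^suc≤V j≤L))

    level≤V : ∀ h j → length h ≤ N → level h j ≤ V
    level≤V h j h≤N = ≤-trans (level-≤ h j zmax Z≤) (≤-trans (*-monoˡ-≤ zmax h≤N) N*zmax≤V)

    record Accumulated (h : List (Fin W)) (m : Memory) : Set where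
      field
        top    : m 6 ≡ L
        count  : m 7 ≡ N
        levels : ∀ j → j ≤ L → m (16 + j) ≡ level h j

    record AccumulateInv (h : List (Fin W)) (i : Fin W) (k : ℕ) (m : Memory) : Set where
      field
        top     : m 6 ≡ L
        count   : m 7 ≡ N
        sample≡ : m 2 ≡ Z i
        counter : m 3 + k ≡ L + 1
        power   : m 4 ≡ 2 ^ m 3
        new     : ∀ j → j < m 3 → m (16 + j) ≡ level (i ∷ h) j
        old     : ∀ j → m 3 ≤ j → j ≤ L → m (16 + j) ≡ level h j

    accumulate-correct : ∀ {m x} h i → length (i ∷ h) ≤ N → Accumulated h m → m 2 ≡ Z i →
      Triple accumulateᶜ m x accumulateTime (Accumulated (i ∷ h))
    accumulate-correct {m} h i h≤N record { top = top ; count = count ; levels = levels } sample≡ =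
      weaken (≤-trans (+-mono-≤ (≤! {3} {50}) (+-mono-≤ (≤! {8} {50}) (*-mono-≤ (+-monoˡ-≤ 1 L≤) (≤! {34} {100})))) (≤-reflexive (sym accumulateTime≡))) done
        (assign⨾ refl refl literal< z≤n (assign⨾ refl refl literal< 1≤V (for! (AccumulateInv h i) body (cong (_+ 1) top) record
          { top = top ; count = count ; sample≡ = sample≡ ; counter = refl ; power = refl
          ; new = λ _ () ; old = λ j _ → levels j })))
      where
      body : ∀ {k m x} → AccumulateInv h i (suc k) m → Triple _ m x _ (AccumulateInv h i k)
      body {k} {m} record { top = top ; count = count ; sample≡ = sample≡ ; counter = counter ; power = power ; new = new ; old = old } =
        assign⨾ refl value (cell< j≤L) (level≤V (i ∷ h) (m 3) h≤N)
        (assign⨾ refl refl literal< (suc≤V j≤L)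
        (assign refl refl literal< (≤-trans (≤-reflexive (cong₂ _+_ power power)) (2^suc≤V j≤L)) record
          { top = top ; count = count ; sample≡ = sample≡
          ; counter = trans (+-assoc (m 3) 1 k) counter
          ; power = trans (cong₂ _+_ power power) (2^suc (m 3))
          ; new = new′
          ; old = λ j j≥ j≤ → trans ([↦]-other m {16 + m 3} _ (λ e → <⇒≢ (≤-trans (≤-reflexive (+-comm 1 (m 3))) j≥) (+-cancelˡ-≡ 16 _ _ e)))
                    (old j (≤-trans (m≤m+n (m 3) 1) j≥) j≤) }))
        where
        j≤L : m 3 ≤ L
        j≤L = s≤s⁻¹ (≤-trans (m<m+n (m 3) {suc k} z<s) (≤-reflexive (trans counter (+-comm L 1))))
        value : m (16 + m 3) + (m 2 ∸ (m 2 ∸ m 4)) ≡ level (i ∷ h) (m 3)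
        value = trans (cong₂ _+_ (old (m 3) ≤-refl j≤L) (trans (x∸[x∸t]≡x⊓t (m 2) (m 4)) (cong₂ _⊓_ sample≡ power)))
          (+-comm (level h (m 3)) _)
        m₁ = m [ 16 + m 3 ↦ level (i ∷ h) (m 3) ]
        new′ : ∀ j → j < m 3 + 1 → m₁ (16 + j) ≡ level (i ∷ h) j
        new′ j j< with m≤n⇒m<n∨m≡n (s≤s⁻¹ (≤-trans j< (≤-reflexive (+-comm (m 3) 1))))
        ... | inj₁ j<m3 = trans ([↦]-other m {16 + m 3} _ (λ e → <⇒≢ j<m3 (sym (+-cancelˡ-≡ 16 _ _ e)))) (new j j<m3)
        ... | inj₂ refl = [↦]-same m (16 + m 3) _
      done : ∀ {m} → AccumulateInv h i 0 m → Accumulated (i ∷ h) m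
      done {m} record { top = top ; count = count ; counter = counter ; new = new } = record
        { top = top ; count = count
        ; levels = λ j j≤L → new j (≤-trans (s≤s j≤L) (≤-reflexive (trans (+-comm 1 L) (trans (sym counter) (+-identityʳ (m 3)))))) }

    Step : List (Fin W) → (Memory × Memory) × Usage → Fin W → Set
    Step h ((m , bank) , u) i = Accumulated (i ∷ h) m × Ready bank × Fits K V sampleTime 1 u

    step-Lift : ∀ {m bank} h → suc (length h) ≤ N → Accumulated h m → Ready bank →
      Lift (Step h) (exec I (performCall I sampler) (effect (call (lit 2)) ⨾ accumulateᶜ) (m , bank)) (uniformFin W)
    step-Lift {m} {bank} h h<N acc ready = Lift-extend
      (Lift->>=-return _ (sampler-Lift ready) (λ {s} {i} → called s i)) (λ {s} {i} → continued s i)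
      where
      Called : (Memory × Memory) × Usage → Fin W → Set
      Called ((m′ , bank′) , u) i = Accumulated h m′ × m′ 2 ≡ Z i × Ready bank′ × Fits K V (τ + 10) 1 u
      called : ∀ s i → Ready (proj₁ s) × proj₁ s 0 ≡ Z i × Fits K V τ 0 (proj₂ s) →
        Called ((m [ 2 ↦ proj₁ s 0 ] , proj₁ s) , (proj₂ s ⊕ (usage 1 1 0 0 ⊕ write 2 (proj₁ s 0)))) i
      called (bank′ , u) i (ready′ , z≡ , fit) =
        record { top = Accumulated.top acc ; count = Accumulated.count acc ; levels = Accumulated.levels acc } , z≡ , ready′ ,
        Fits-⊕ fit (fits ≤! refl literal< (≤-trans (≤-reflexive z≡) (≤-trans (Z≤ i) (≤-trans zmax≤ (≤-trans (m≤n*m (fourth n) 4) n⁴≤V)))))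
      continued : ∀ s i → Called s i → Lift (Step h)
        (charge (proj₂ s) (exec I (performCall I sampler) accumulateᶜ (proj₁ s))) (return i)
      continued ((m′ , bank′) , u) i (acc′ , z≡ , ready′ , fit) =
        Det-Lift (holds (accumulate-correct {x = bank′} h i h<N acc′ z≡)) (λ acc″ cost → acc″ , ready′ , Fits-mono (≤-reflexive (sym sampleTime≡)) (Fits-⊕ fit cost))

    Done : ℕ → (Memory × Memory) × Usage → List (Fin W) → Set
    Done k ((m , _) , u) h = Accumulated h m × length h ≡ N × Fits K V (k * (2 + sampleTime)) k u

    -- The loop is unfolded directly because its body is random; each pass matches one draw of
    -- `drawsFrom`, and the history `h` lists the samples summed up so far.
    loop-Lift : ∀ k {m bank} h → length h + k ≡ N → Accumulated h m → Ready bank →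
      Lift (Done k) (iterate I (performCall I sampler) (lit 1)
        (exec I (performCall I sampler) (effect (call (lit 2)) ⨾ accumulateᶜ)) k (m , bank)) (drawsFrom W k h)
    loop-Lift zero h h≡N acc ready = return (acc , trans (sym (+-identityʳ (length h))) h≡N , Fits-steps)
    loop-Lift (suc k) {m} {bank} h h≡N acc ready = Lift->>=-return _
      (Lift->>= (step-Lift h (≤-trans (s≤s (m≤m+n (length h) k)) (≤-reflexive h+)) acc ready) (λ {s} {i} → rest s i))
      (λ { {_ , u} (acc′ , l≡ , fit) → acc′ , l≡ , Fits-⊕ (Fits-steps {t = 2}) fit })
      where
      h+ : suc (length h + k) ≡ N
      h+ = trans (sym (+-suc (length h) k)) h≡N
      Later : (Memory × Memory) × Usage → List (Fin W) → Set
      Later ((m , _) , u) h = Accumulated h m × length h ≡ N × Fits K V (sampleTime + k * (2 + sampleTime)) (suc k) u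
      rest : ∀ s i → Step h s i → Lift Later
        (charge (proj₂ s) (iterate I (performCall I sampler) (lit 1)
          (exec I (performCall I sampler) (effect (call (lit 2)) ⨾ accumulateᶜ)) k (proj₁ s)))
        (drawsFrom W k (i ∷ h))
      rest (_ , u) i (acc′ , ready′ , fit) = Lift->>=-return _ (loop-Lift k (i ∷ h) h+ acc′ ready′)
        (λ { {_ , u′} (acc″ , l≡ , fit′) → acc″ , l≡ , Fits-⊕ fit fit′ })

    record SelectInv (h : List (Fin W)) (k : ℕ) (m : Memory) : Set where
      field
        accumulated : Accumulated h m
        counter     : m 3 + k ≡ L
        power       : m 4 ≡ 2 ^ m 3
        passed      : ∀ {j} → j < m 3 → 2 ^ j * (N * p) < 4 * (M * (q * level h j))

    Selected : List (Fin W) → Memory → Set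
    Selected h m = Σ[ J ∈ ℕ ] Selects M N p q L (level h) J × m 0 ≡ level h J × m 1 ≡ 4 * N

    select-correct : ∀ {m x} h → length h ≤ N → Accumulated h m → Triple selectᶜ m x selectTime (Selected h)
    select-correct {m₀} h h≤N acc₀ = weaken (≤-trans (≤-reflexive (lemma (L * 39))) (≤-trans (+-mono-≤ (≤! {22} {300}) (*-mono-≤ L≤ (≤! {39} {100}))) (≤-reflexive (sym selectTime≡)))) id
      (assign⨾ refl refl literal< z≤n (assign⨾ refl refl literal< 1≤V
        (upto! (SelectInv h) body (Accumulated.top acc₀) record
          { accumulated = record { top = Accumulated.top acc₀ ; count = Accumulated.count acc₀ ; levels = Accumulated.levels acc₀ }
          ; counter = refl ; power = refl ; passed = λ () }
        ⨾! λ { {m} (k , inv , halted) → finish {m} k inv halted })))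
      where
      lemma : ∀ x → 3 + (3 + (3 + x + (7 + 6))) ≡ 22 + x
      lemma = solve-∀
      guard : Memory → ℕ
      guard m = if m 4 * (m 7 * p) <ᵇ 4 * (M * (q * m (16 + m 3))) then 1 else 0
      rewriteᵍ : ∀ {k m} → SelectInv h k m → guard m ≡ (if 2 ^ m 3 * (N * p) <ᵇ 4 * (M * (q * level h (m 3))) then 1 else 0)
      rewriteᵍ {k} {m} record { accumulated = acc ; counter = counter ; power = power }
        rewrite power | Accumulated.count acc | Accumulated.levels acc (m 3) (≤-trans (m≤m+n (m 3) k) (≤-reflexive counter)) = refl
      body : ∀ {k m x} → SelectInv h (suc k) m → guard m ≢ 0 → Triple _ m x _ (SelectInv h k)
      body {k} {m} inv@record { accumulated = acc ; counter = counter ; power = power ; passed = passed } g =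
        assign⨾ refl refl literal< (suc≤V j≤L)
        (assign refl refl literal< (≤-trans (≤-reflexive (cong₂ _+_ power power)) (2^suc≤V j≤L)) record
          { accumulated = record { top = Accumulated.top acc ; count = Accumulated.count acc ; levels = Accumulated.levels acc }
          ; counter = trans (+-assoc (m 3) 1 k) counter
          ; power = trans (cong₂ _+_ power power) (2^suc (m 3))
          ; passed = passed′ })
        where
        j≤L : m 3 ≤ L
        j≤L = ≤-trans (m≤m+n (m 3) (suc k)) (≤-reflexive counter)
        passed′ : ∀ {j} → j < m 3 + 1 → 2 ^ j * (N * p) < 4 * (M * (q * level h j))
        passed′ {j} j< with m≤n⇒m<n∨m≡n (s≤s⁻¹ (≤-trans j< (≤-reflexive (+-comm (m 3) 1))))
        ... | inj₁ j<m3 = passed j<m3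
        ... | inj₂ refl = guard-true (subst (_≢ 0) (rewriteᵍ inv) g)
      finish : ∀ {m x} k → SelectInv h k m → k ≡ 0 ⊎ guard m ≡ 0 → Triple _ m x _ (Selected h)
      finish {m} k inv@record { accumulated = acc ; counter = counter ; passed = passed } halted =
        assign⨾ refl level≡ literal< (level≤V h (m 3) h≤N)
        (assign refl (cong (4 *_) (Accumulated.count acc)) literal< 4N≤V′
          (m 3 , record { J≤L = J≤L ; continue = passed ; halt = stopped halted } , refl , refl))
        where
        J≤L : m 3 ≤ L
        J≤L = ≤-trans (m≤m+n (m 3) k) (≤-reflexive counter)
        level≡ : m (16 + m 3) ≡ level h (m 3)
        level≡ = Accumulated.levels acc (m 3) J≤L
        stopped : k ≡ 0 ⊎ guard m ≡ 0 → m 3 < L → 4 * (M * (q * level h (m 3))) ≤ 2 ^ m 3 * (N * p)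
        -- An exhausted bound means that J is the top level L, where no test is required.
        stopped (inj₁ refl) J<L = contradiction (trans (sym (+-identityʳ (m 3))) counter) (<⇒≢ J<L)
        stopped (inj₂ g) _ = guard-false {2 ^ m 3 * (N * p)} (trans (sym (rewriteᵍ inv)) g)

    Final : (Memory × Memory) × Usage → List (Fin W) → Set
    Final ((m , _) , u) h = Selected h m × Fits K V (3 + N * (2 + sampleTime) + selectTime) N u

    sample-select-Lift : ∀ {m bank} → Accumulated [] m → Ready bank →
      Lift Final (exec I (performCall I sampler) (sampleᶜ ⨾ selectᶜ) (m , bank)) (drawsFrom W N [])
    sample-select-Lift {m} {bank} acc ready = Lift-extend
      (Lift->>=-return _ (subst (λ k → Lift (Done N) (iterate I (performCall I sampler) (lit 1)
          (exec I (performCall I sampler) (effect (call (lit 2)) ⨾ accumulateᶜ)) k (m , bank)) (drawsFrom W N []))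
          (sym (Accumulated.count acc)) (loop-Lift N [] refl acc ready))
        (λ { {_ , u} (acc′ , l≡ , fit) → acc′ , l≡ , Fits-⊕ (Fits-steps {t = 3}) fit }))
      (λ {s} {h} → selected s h)
      where
      Looped : (Memory × Memory) × Usage → List (Fin W) → Set
      Looped ((m , _) , u) h = Accumulated h m × length h ≡ N × Fits K V (3 + N * (2 + sampleTime)) N u
      selected : ∀ s h → Looped s h → Lift Final
        (charge (proj₂ s) (exec I (performCall I sampler) selectᶜ (proj₁ s))) (return h)
      selected ((m′ , bank′) , u) h (acc′ , l≡ , fit) = Det-Lift (holds (select-correct {x = bank′} h (≤-reflexive l≡) acc′))
        (λ {_} {v} sel cost → sel , subst (λ c → Fits K V (3 + N * (2 + sampleTime) + selectTime) c (u ⊕ v)) (+-identityʳ N) (Fits-⊕ fit cost))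

  record MainFinal (L N : ℕ) (s : (Memory × Memory) × Usage) (h : List (Fin W)) : Set where
    field
      level#   : ℕ
      selects  : Selects M N p q L (level h) level#
      result₀  : proj₁ (proj₁ s) 0 ≡ level h level#
      result₁  : proj₁ (proj₁ s) 1 ≡ 4 * N
      cost     : Fits K V (mainTime N) N (proj₂ s)

  -- `reps` and `top` are the values that initialisation leaves in registers 5 and 6; they are known
  -- through these inequalities.
  record MainRun (bank : Memory) : Set where
    field
      reps top   : ℕ
      reps≤      : reps ≤ Tm
      reps-large : 2 * b ≤ 2 ^ reps * a
      top-large  : fourth n ≤ 2 ^ top
      simulates  : Lift (MainFinal top (samples M p q reps))
                     (exec I (performCall I sampler) mainᶜ (blank , bank)) (drawsFrom W (samples M p q reps) [])

  after-init : ∀ {bank r} → Ready bank → Det r bank initTime Initialised →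
    Σ[ R ∈ ℕ ] Σ[ L ∈ ℕ ] R ≤ Tm × 2 * b ≤ 2 ^ R * a × fourth n ≤ 2 ^ L ×
      Lift (MainFinal L (samples M p q R)) (r ▹ exec I (performCall I sampler) (sampleᶜ ⨾ selectᶜ)) (drawsFrom W (samples M p q R) [])
  after-init {bank} ready (det {m} {u₀} refl c record { fresh = fresh ; T≤Tm = T≤Tm ; T-large = T-large ; L≤ = L≤ ; n⁴≤2^L = n⁴≤2^L ; 2^L≤ = 2^L≤ ; count = count }) =
    m 5 , m 6 , T≤Tm , T-large , n⁴≤2^L , Lift->>=-return (λ (s , u) → s , u₀ ⊕ u) (S.sample-select-Lift {m} {bank}
      (record { top = refl ; count = count ; levels = λ j _ → fresh j }) ready)
      (λ { {_ , u} ((J , sel , r₀ , r₁) , fit) → record { level# = J ; selects = sel ; result₀ = r₀ ; result₁ = r₁ ; cost = Fits-⊕ c fit } })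
    where
    samples≤ : samples M p q (m 5) ≤ samples M p q Tm
    samples≤ = *-monoʳ-≤ (apply div (64 * (M * (q * q))) (p * p) + 1) T≤Tm
    module S = Sampling (m 6) (samples M p q (m 5)) L≤ n⁴≤2^L 2^L≤
      (≤-trans (*-monoˡ-≤ zmax samples≤) total≤V) (≤-trans (*-monoʳ-≤ 4 samples≤) 4N≤V)

  main-Lift : ∀ {bank} → Ready bank → MainRun bank
  main-Lift {bank} ready with after-init ready (holds (init-correct {blank} {bank} (λ _ → refl)))
  ... | R , L , R≤ , R-large , L-large , sim = record
    { reps = R ; top = L ; reps≤ = R≤ ; reps-large = R-large ; top-large = L-large ; simulates = sim }

  output : (Memory × Memory) × Usage → ℚ
  output ((m , _) , _) = ratio (m 0) (m 1)

  mainTime≡ : ∀ N → mainTime N ≡ 500 + Tm * 100 + 4 * l * 100 +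
    (3 + N * (2 + (τ + 10 + (100 + (4 * l + 1) * 100))) + (300 + 4 * l * 100))
  mainTime≡ N = cong₂ _+_ initTime≡ (cong₂ (λ s e → 3 + N * (2 + s) + e)
    (trans sampleTime≡ (cong (τ + 10 +_) accumulateTime≡)) selectTime≡)

  -- An inaccurate output is coupled with a bad history, which has probability at most 2 / 2^reps ≤
  -- a/b = δ; denominators are cleared throughout.
  main-estimates : ∀ {bank} b₀ .{{_ : NonZero p}} .{{_ : NonZero q}} → Ready bank → 0 < b₀ → 1 ≤ M → p ≤ q →
    ∑ (allFin W) Z ≡ W * (4 * b₀) → ∑ (allFin W) (λ i → Z i * Z i) ≤ W * (4 * (M * (b₀ * b₀))) →
    Σ[ N ∈ ℕ ] N ≤ samples M p q Tm ×
      fromℕ b ℚ.* Pr (λ s → ratio p q ℚ.* fromℕ b₀ ℚ.<? ℚ.∣ output s ℚ.- fromℕ b₀ ∣)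
        (execCall I sampler mainᶜ (blank , bank)) ℚ.≤ fromℕ a ×
      (∀ {s} → s outcomeOf execCall I sampler mainᶜ (blank , bank) →
        Fits K V (500 + Tm * 100 + 4 * l * 100 + (3 + N * (2 + (τ + 10 + (100 + (4 * l + 1) * 100))) + (300 + 4 * l * 100))) N (proj₂ s))
  main-estimates {bank} b₀ ready 0<b₀ 1≤M p≤q ∑Z ∑Z² = N , *-monoʳ-≤ (apply div (64 * (M * (q * q))) (p * p) + 1) reps≤ , Pr≤ ,
    λ o → Fits-mono (≤-reflexive (mainTime≡ N)) (MainFinal.cost (proj₂ (Lift-outcome simulates o)))
    where
    open MainRun (main-Lift ready)
    N : ℕ
    N = samples M p q reps
    1≤b : 1 ≤ b
    1≤b = ≤-trans 1≤a a≤b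
    1≤reps : 1 ≤ reps
    1≤reps = n≢0⇒n>0 λ reps≡0 → <-irrefl refl (≤-trans (m<m+n b {b} 1≤b)
      (≤-trans (≤-reflexive (cong (b +_) (sym (+-identityʳ b))))
        (≤-trans reps-large (≤-trans (≤-reflexive (trans (cong (λ r → 2 ^ r * a) reps≡0) (+-identityʳ a))) a≤b))))
    open Accuracy Z b₀ M p q N reps top 0<b₀ 1≤M p≤q (≤-trans 1≤reps (T≤samples M p q reps)) (samples-lower M p q reps)
      (λ i → ≤-trans (Z≤ i) (≤-trans zmax≤ top-large)) ∑Z ∑Z²
    far? : Decidable (λ s → ratio p q ℚ.* fromℕ b₀ ℚ.< ℚ.∣ output s ℚ.- fromℕ b₀ ∣)
    far? s = ratio p q ℚ.* fromℕ b₀ ℚ.<? ℚ.∣ output s ℚ.- fromℕ b₀ ∣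
    Far : ℚ → Set
    Far z = ratio p q ℚ.* fromℕ b₀ ℚ.< ℚ.∣ z ℚ.- fromℕ b₀ ∣
    far⇒bad : ∀ {s h} → MainFinal top N s h → Far (output s) → Bad h
    far⇒bad {h = h} final far = decidable-stable (bad? h) (λ ¬bad → good h ¬bad (MainFinal.selects final)
      (subst Far (cong₂ ratio (MainFinal.result₀ final) (MainFinal.result₁ final)) far))
    Pr≤ : fromℕ b ℚ.* Pr far? (execCall I sampler mainᶜ (blank , bank)) ℚ.≤ fromℕ a
    Pr≤ = *-cancelˡ-fromℕ (2 ^ reps) {{m^n≢0 2 reps}} (begin
      fromℕ (2 ^ reps) ℚ.* (fromℕ b ℚ.* π)
        ≤⟨ *-monoˡ-0≤ (0≤fromℕ (2 ^ reps)) (*-monoˡ-0≤ (0≤fromℕ b) (Lift-Pr-≤ far? bad? far⇒bad simulates)) ⟩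
      fromℕ (2 ^ reps) ℚ.* (fromℕ b ℚ.* π′)
        ≡⟨ swap (fromℕ (2 ^ reps)) (fromℕ b) π′ ⟩
      fromℕ b ℚ.* (fromℕ (2 ^ reps) ℚ.* π′)
        ≤⟨ *-monoˡ-0≤ (0≤fromℕ b) Pr-bad ⟩
      fromℕ b ℚ.* fromℕ 2
        ≡⟨ trans (ℚ.*-comm (fromℕ b) (fromℕ 2)) (sym (fromℕ-* 2 b)) ⟩
      fromℕ (2 * b)
        ≤⟨ fromℕ-mono reps-large ⟩
      fromℕ (2 ^ reps * a)
        ≡⟨ fromℕ-* (2 ^ reps) a ⟩
      fromℕ (2 ^ reps) ℚ.* fromℕ a ∎)
      where
      open ℚ.≤-Reasoning
      π = Pr far? (execCall I sampler mainᶜ (blank , bank))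
      π′ = Pr bad? (drawsFrom W N [])
      open ℚSolver.+-*-Solver
      swap : ∀ x y z → x ℚ.* (y ℚ.* z) ≡ y ℚ.* (x ℚ.* z)
      swap = solve 3 (λ x y z → x :* (y :* z) := y :* (x :* z)) refl

-- Numerical bounds

ratio-numerator : ∀ ε .{{_ : ℚ.Positive ε}} → ratio (numerator ε) (ℚ.↧ₙ ε) ≡ ε
ratio-numerator ε@(mkℚ +[1+ _ ] _ _) = ℚ.↥p/↧p≡p ε

numerator-pos : ∀ ε .{{_ : ℚ.Positive ε}} → 0 < numerator ε
numerator-pos (mkℚ +[1+ _ ] _ _) = z<s

numerator≤ : ∀ ε .{{_ : ℚ.Positive ε}} → ε ℚ.≤ 1ℚ → numerator ε ≤ ℚ.↧ₙ ε
numerator≤ ε ε≤1 = fromℕ-cancel (begin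
  fromℕ (numerator ε)                                ≡⟨ ratio-*-fromℕ (numerator ε) (ℚ.↧ₙ ε) ⟨
  ratio (numerator ε) (ℚ.↧ₙ ε) ℚ.* fromℕ (ℚ.↧ₙ ε)    ≡⟨ cong (ℚ._* fromℕ (ℚ.↧ₙ ε)) (ratio-numerator ε) ⟩
  ε ℚ.* fromℕ (ℚ.↧ₙ ε)                               ≤⟨ *-monoʳ-0≤ (0≤fromℕ (ℚ.↧ₙ ε)) ε≤1 ⟩
  1ℚ ℚ.* fromℕ (ℚ.↧ₙ ε)                              ≡⟨ ℚ.*-identityˡ _ ⟩
  fromℕ (ℚ.↧ₙ ε) ∎)
  where open ℚ.≤-Reasoning

inverse-* : ∀ ε .{{_ : ℚ.Positive ε}} → (ℚ.1/ ε) {{ℚ.pos⇒nonZero ε}} ℚ.* fromℕ (numerator ε) ≡ fromℕ (ℚ.↧ₙ ε)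
inverse-* ε = begin
  1/ε ℚ.* fromℕ p                          ≡⟨ cong (1/ε ℚ.*_) (ratio-*-fromℕ p q) ⟨
  1/ε ℚ.* (ratio p q ℚ.* fromℕ q)          ≡⟨ cong (λ x → 1/ε ℚ.* (x ℚ.* fromℕ q)) (ratio-numerator ε) ⟩
  1/ε ℚ.* (ε ℚ.* fromℕ q)                  ≡⟨ ℚ.*-assoc 1/ε ε (fromℕ q) ⟨
  1/ε ℚ.* ε ℚ.* fromℕ q                    ≡⟨ cong (ℚ._* fromℕ q) (ℚ.*-inverseˡ ε {{ℚ.pos⇒nonZero ε}}) ⟩
  1ℚ ℚ.* fromℕ q                           ≡⟨ ℚ.*-identityˡ _ ⟩
  fromℕ q ∎
  where
  open ≡-Reasoning
  1/ε = (ℚ.1/ ε) {{ℚ.pos⇒nonZero ε}}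
  p = numerator ε
  q = ℚ.↧ₙ ε

⌈1/_⌉ : (δ : ℚ) .{{_ : ℚ.Positive δ}} → ℕ
⌈1/ δ ⌉ = ∣ ℚ.ceiling ((ℚ.1/ δ) {{ℚ.pos⇒nonZero δ}}) ∣

-- The ceiling is minus the floor of the negative, and floor division of a negative integer treats
-- remainder 0 apart. The absolute value here is the quotient (b + 1) / d rounded up.
∣-/ℕ∣ : ∀ b d .{{_ : NonZero d}} → suc b ≤ ∣ -[1+ b ] ℤ./ℕ d ∣ * d × ∣ -[1+ b ] ℤ./ℕ d ∣ ≤ suc b
∣-/ℕ∣ b d with suc b % d in e
... | zero  rewrite ℤ.∣-i∣≡∣i∣ (ℤ.+ (suc b / d)) =
  ≤-reflexive (trans (m≡m%n+[m/n]*n (suc b) d) (cong (_+ suc b / d * d) e)) , m/n≤m (suc b) d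
... | suc r = ≤-trans (≤-reflexive (m≡m%n+[m/n]*n (suc b) d)) (+-monoˡ-≤ (suc b / d * d) (<⇒≤ (m%n<n (suc b) d))) ,
  ≤-trans (s≤s (m≤m*n (suc b / d) d)) (≤-trans (s≤s (m≤n+m _ r))
    (≤-reflexive (sym (trans (m≡m%n+[m/n]*n (suc b) d) (cong (_+ suc b / d * d) e)))))

⌈1/⌉-bounds : ∀ δ .{{_ : ℚ.Positive δ}} → ℚ.↧ₙ δ ≤ ⌈1/ δ ⌉ * numerator δ × ⌈1/ δ ⌉ ≤ ℚ.↧ₙ δ
⌈1/⌉-bounds δ@(mkℚ +[1+ a ] b _) = subst (λ c → suc b ≤ c * suc a × c ≤ suc b) (sym c≡) (∣-/ℕ∣ b (suc a))
  where
  c≡ : ⌈1/ δ ⌉ ≡ ∣ -[1+ b ] ℤ./ℕ suc a ∣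
  c≡ = trans (ℤ.∣-i∣≡∣i∣ (ℤ.+ 1 ℤ.* (-[1+ b ] ℤ./ℕ suc a))) (cong ∣_∣ (ℤ.*-identityˡ (-[1+ b ] ℤ./ℕ suc a)))

2xy≤x²+y² : ∀ x y → 2 * (x * y) ≤ x * x + y * y
2xy≤x²+y² x y with ≤-total x y
... | inj₁ x≤y = subst (λ y → 2 * (x * y) ≤ x * x + y * y) (m+[n∸m]≡n x≤y) (go x (y ∸ x))
  where
  go : ∀ x d → 2 * (x * (x + d)) ≤ x * x + (x + d) * (x + d)
  go x d = ≤-trans (m≤m+n _ (d * d)) (≤-reflexive (lemma x d))
    where
    lemma : ∀ x d → 2 * (x * (x + d)) + d * d ≡ x * x + (x + d) * (x + d)
    lemma = solve-∀
... | inj₂ y≤x = subst (λ x → 2 * (x * y) ≤ x * x + y * y) (m+[n∸m]≡n y≤x) (go y (x ∸ y))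
  where
  go : ∀ y d → 2 * ((y + d) * y) ≤ (y + d) * (y + d) + y * y
  go y d = ≤-trans (m≤m+n _ (d * d)) (≤-reflexive (lemma y d))
    where
    lemma : ∀ y d → 2 * ((y + d) * y) + d * d ≡ (y + d) * (y + d) + y * y
    lemma = solve-∀

-- Bounds on the graph parameters

module GraphBounds {n : ℕ} (G : BipartiteGraph n) (B>0 : B G > 0) where

  open BipartiteGraph G
  open Moments G

  private
    V = allFin n
    W = length wedgeList

  degree≤maxDegree : ∀ v → degree G v ≤ maxDegree G
  degree≤maxDegree v = go (allFin n) (∈-allFin v)
    where
    go : ∀ xs → v ∈ xs → degree G v ≤ foldr _⊔_ 0 (map (degree G) xs)
    go (x ∷ xs) (here refl) = m≤m⊔n (degree G x) _
    go (x ∷ xs) (there v∈)  = ≤-trans (go xs v∈) (m≤n⊔m (degree G x) _)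

  degree≤n : ∀ v → degree G v ≤ n
  degree≤n v = begin
    length (Γ v)                  ≡⟨ trans (∑-const 1 (Γ v)) (*-identityʳ _) ⟨
    ∑ (Γ v) (λ _ → 1)             ≡⟨ ∑-Γ v (λ _ → 1) ⟩
    ∑ V (λ x → adj x v * 1)       ≤⟨ ∑-mono V (λ x → 𝟙*1≤1 (x ∈? Γ v)) ⟩
    ∑ V (λ _ → 1)                 ≡⟨ trans (∑-const 1 V) (trans (*-identityʳ _) (length-tabulate {n = n} id)) ⟩
    n ∎
    where
    open ≤-Reasoning
    open DecMembership (Fin._≟_ {n}) using (_∈?_)
    𝟙*1≤1 : {P : Set} (P? : Dec P) → 𝟙 P? * 1 ≤ 1
    𝟙*1≤1 P? with does P?
    ... | true  = ≤-refl
    ... | false = z≤n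

  W≤ : ∀ d → (∀ v → degree G v ≤ d) → W ≤ n * (d * d)
  W≤ d degree≤d = begin
    W                                   ≡⟨ length-wedgeList ⟩
    wedges G                            ≤⟨ ∑-mono V (λ v → ≤-trans (≤-reflexive (tri≡C2 (degree G v))) (≤-trans (tri-≤ (degree G v)) (*-mono-≤ (degree≤d v) (degree≤d v)))) ⟩
    ∑ V (λ _ → d * d)                   ≡⟨ trans (∑-const (d * d) V) (cong (_* (d * d)) (length-tabulate {n = n} id)) ⟩
    n * (d * d) ∎
    where open ≤-Reasoning

  W>0 : 0 < W
  W>0 = n≢0⇒n>0 (λ W≡0 → <-irrefl refl (≤-trans B>0 (≤-trans (m≤n*m (B G) 4) (≤-reflexive (trans (sym first-moment) (empty wedgeList W≡0))))))
    where
    empty : ∀ ws → length ws ≡ 0 → ∑ ws β ≡ 0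
    empty [] _ = refl

  n>0 : 0 < n
  n>0 = n≢0⇒n>0 (λ n≡0 → <-irrefl refl (≤-trans W>0 (≤-trans (W≤ n degree≤n) (≤-reflexive (cong (_* (n * n)) n≡0)))))

  maxDegree>0 : 0 < maxDegree G
  maxDegree>0 = n≢0⇒n>0 (λ D≡0 → <-irrefl refl (≤-trans W>0 (≤-trans (W≤ 0 (λ v → ≤-trans (degree≤maxDegree v) (≤-reflexive D≡0))) (≤-reflexive (*-zeroʳ n)))))

  nW≤n⁴ : n * W ≤ fourth n
  nW≤n⁴ = ≤-trans (*-monoʳ-≤ n (W≤ n degree≤n)) (≤-reflexive (sym (*-assoc n n (n * n))))

  -- Cauchy–Schwarz for β: the spread is bounded below.
  B²≤W[B+p] : B G * B G ≤ W * (B G + p₁w G)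
  B²≤W[B+p] = *-cancelˡ-≤ (16 * W) {{m*n≢0 16 W {{_}} {{>-nonZero W>0}}}} (begin
    16 * W * (b * b)                          ≤⟨ +-cancelʳ-≤ (W * (4 * b * (4 * b))) _ _ quadratic ⟩
    W * W * ∑ wedgeList (λ w → β w * β w)     ≤⟨ *-monoʳ-≤ (W * W) second-moment ⟩
    W * W * (4 * (b + p₁w G))                 ≤⟨ m≤n*m _ 4 ⟩
    4 * (W * W * (4 * (b + p₁w G)))           ≡⟨ lemma₃ W (b + p₁w G) ⟩
    16 * W * (W * (b + p₁w G)) ∎)
    where
    open ≤-Reasoning
    b = B G
    lemma₁ : ∀ W b → 16 * W * (b * b) + W * (4 * b * (4 * b)) ≡ 2 * W * (4 * b) * (4 * b)
    lemma₁ = solve-∀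
    lemma₂ : ∀ W x y → 2 * W * y * x ≡ 2 * (W * x * y)
    lemma₂ = solve-∀
    lemma₃ : ∀ W y → 4 * (W * W * (4 * y)) ≡ 16 * W * (W * y)
    lemma₃ = solve-∀
    lemma₄ : ∀ W x → W * x * (W * x) ≡ W * W * (x * x)
    lemma₄ = solve-∀
    -- Nonnegativity of the variance: 2 x y ≤ x² + y² is summed over the wedges with x = W β and y =
    -- 4 B, the mean of x.
    quadratic : 16 * W * (b * b) + W * (4 * b * (4 * b)) ≤ W * W * ∑ wedgeList (λ w → β w * β w) + W * (4 * b * (4 * b))
    quadratic = begin
      16 * W * (b * b) + W * (4 * b * (4 * b))
        ≡⟨ lemma₁ W b ⟩
      2 * W * (4 * b) * (4 * b)
        ≡⟨ cong (2 * W * (4 * b) *_) first-moment ⟨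
      2 * W * (4 * b) * ∑ wedgeList β
        ≡⟨ ∑-*ˡ (2 * W * (4 * b)) β wedgeList ⟨
      ∑ wedgeList (λ w → 2 * W * (4 * b) * β w)
        ≤⟨ ∑-mono wedgeList (λ w → ≤-trans (≤-reflexive (lemma₂ W (β w) (4 * b))) (2xy≤x²+y² (W * β w) (4 * b))) ⟩
      ∑ wedgeList (λ w → W * β w * (W * β w) + 4 * b * (4 * b))
        ≡⟨ trans (∑-+ (λ w → W * β w * (W * β w)) _ wedgeList) (cong₂ _+_
             (trans (∑-cong wedgeList (λ w → lemma₄ W (β w))) (∑-*ˡ (W * W) _ wedgeList)) (∑-const (4 * b * (4 * b)) wedgeList)) ⟩
      W * W * ∑ wedgeList (λ w → β w * β w) + W * (4 * b * (4 * b)) ∎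

  private
    instance
      B≢0 : NonZero (B G)
      B≢0 = >-nonZero B>0

  spread-* : spread G ℚ.* fromℕ (B G * B G) ≡ fromℕ (W * (B G + p₁w G))
  spread-* = begin
    ratio (wedges G) b ℚ.* (1ℚ ℚ.+ ratio (p₁w G) b) ℚ.* fromℕ (b * b)
      ≡⟨ cong (ratio (wedges G) b ℚ.* (1ℚ ℚ.+ ratio (p₁w G) b) ℚ.*_) (fromℕ-* b b) ⟩
    ratio (wedges G) b ℚ.* (1ℚ ℚ.+ ratio (p₁w G) b) ℚ.* (fromℕ b ℚ.* fromℕ b)
      ≡⟨ swap (ratio (wedges G) b) (ratio (p₁w G) b) (fromℕ b) 1ℚ ⟩
    ratio (wedges G) b ℚ.* fromℕ b ℚ.* (1ℚ ℚ.* fromℕ b ℚ.+ ratio (p₁w G) b ℚ.* fromℕ b)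
      ≡⟨ cong₂ ℚ._*_ (ratio-*-fromℕ (wedges G) b) (cong₂ ℚ._+_ (ℚ.*-identityˡ (fromℕ b)) (ratio-*-fromℕ (p₁w G) b)) ⟩
    fromℕ (wedges G) ℚ.* (fromℕ b ℚ.+ fromℕ (p₁w G))
      ≡⟨ cong₂ ℚ._*_ (cong fromℕ (sym length-wedgeList)) (sym (fromℕ-+ b (p₁w G))) ⟩
    fromℕ W ℚ.* fromℕ (b + p₁w G)
      ≡⟨ fromℕ-* W (b + p₁w G) ⟨
    fromℕ (W * (b + p₁w G)) ∎
    where
    open ≡-Reasoning
    open ℚSolver.+-*-Solver
    b = B G
    swap : ∀ w r b o → w ℚ.* (o ℚ.+ r) ℚ.* (b ℚ.* b) ≡ w ℚ.* b ℚ.* (o ℚ.* b ℚ.+ r ℚ.* b)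
    swap = solve 4 (λ w r b o → w :* (o :+ r) :* (b :* b) := w :* b :* (o :* b :+ r :* b)) refl

  private
    instance
      B²≢0 : NonZero (B G * B G)
      B²≢0 = m*n≢0 (B G) (B G)

  -- Absorbs the additive 1 in the range of M, so that M is at most three times the spread, and
  -- makes M positive.
  1≤spread : 1ℚ ℚ.≤ spread G
  1≤spread = *-cancelʳ-fromℕ (B G * B G) (subst₂ ℚ._≤_ (sym (ℚ.*-identityˡ _)) (sym spread-*) (fromℕ-mono B²≤W[B+p]))

  W[B+p]≤MB² : ∀ M → spread G ℚ.≤ fromℕ M → W * (B G + p₁w G) ≤ M * (B G * B G)
  W[B+p]≤MB² M le = fromℕ-cancel (subst₂ ℚ._≤_ spread-* (sym (fromℕ-* M (B G * B G))) (*-monoʳ-0≤ (0≤fromℕ (B G * B G)) le))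

∑-lookup : ∀ {A : Set} (ws : List A) (f : A → ℕ) → ∑ (allFin (length ws)) (λ i → f (lookup ws i)) ≡ ∑ ws f
∑-lookup ws f = cong sum (trans (map-tabulate id (f ∘ lookup ws))
  (trans (sym (map-tabulate (lookup ws) f)) (cong (map f) (tabulate-lookup ws))))

-- Bounds on words and running time

apply-div-≤ : ∀ x y → apply div x y ≤ x
apply-div-≤ x zero    = z≤n
apply-div-≤ x (suc y) = m/n≤m x (suc y)

-- The exponent is 13 = 9 + 4, for a sum of all samples, each at most n⁴. Their number takes 4 for
-- the constant 65 ≤ 4⁴, 1 for M, 2 for q² and 2 for `Tm`.
module WordBounds (X n M p q b Tm z : ℕ) (4≤X : 4 ≤ X) (n≤X : n ≤ X) (M≤X : M ≤ X) (q≤X : q ≤ X) (b≤X : b ≤ X)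
  (1≤M : 1 ≤ M) (1≤q : 1 ≤ q) (Tm≤ : Tm ≤ 2 * b) (z≤ : z ≤ fourth n) where

  private
    infixl 7 _⊗_
    _⊗_ : ∀ {x y i j} → x ≤ X ^ i → y ≤ X ^ j → x * y ≤ X ^ (i + j)
    _⊗_ {i = i} {j} x≤ y≤ = ≤-trans (*-mono-≤ x≤ y≤) (≤-reflexive (sym (^-distribˡ-+-* X i j)))

    ¹ : ∀ {x} → x ≤ X → x ≤ X ^ 1
    ¹ x≤ = ≤-trans x≤ (≤-reflexive (sym (*-identityʳ X)))

    up : ∀ {x i} → {_ : T (i ≤ᵇ 13)} → x ≤ X ^ i → x ≤ X ^ 13
    up {i = i} {p} x≤ = ≤-trans x≤ (^-monoʳ-≤ X {{>-nonZero (≤-trans (s≤s z≤n) 4≤X)}} (≤ᵇ⇒≤ i 13 p))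

    n⁴ : fourth n ≤ X ^ 4
    n⁴ = _⊗_ {i = 2} {2} (_⊗_ {i = 1} {1} (¹ n≤X) (¹ n≤X)) (_⊗_ {i = 1} {1} (¹ n≤X) (¹ n≤X))

    Tm≤X² : Tm ≤ X ^ 2
    Tm≤X² = ≤-trans Tm≤ (_⊗_ {i = 1} {1} (¹ (≤-trans (≤! {2} {4}) 4≤X)) (¹ b≤X))

    65≤X⁴ : 65 ≤ X ^ 4
    65≤X⁴ = ≤-trans (≤! {65} {256}) (^-monoˡ-≤ 4 4≤X)

    samples≤ : samples M p q Tm ≤ X ^ 9
    samples≤ = _⊗_ {i = 7} {2} (begin
      apply div (64 * y) (p * p) + 1     ≤⟨ +-mono-≤ (apply-div-≤ (64 * y) (p * p)) (*-mono-≤ 1≤M (*-mono-≤ 1≤q 1≤q)) ⟩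
      64 * y + y                         ≡⟨ +-comm (64 * y) y ⟩
      65 * y                             ≤⟨ _⊗_ {i = 4} {3} 65≤X⁴ (_⊗_ {i = 1} {2} (¹ M≤X) (_⊗_ {i = 1} {1} (¹ q≤X) (¹ q≤X))) ⟩
      X ^ 7 ∎) Tm≤X²
      where
      open ≤-Reasoning
      y = M * (q * q)

  n-word : n ≤ X ^ 13
  n-word = up {i = 1} (¹ n≤X)

  z-word : z ≤ X ^ 13
  z-word = up {i = 4} (≤-trans z≤ n⁴)

  1-word : 1 ≤ X ^ 13
  1-word = m^n>0 X {{>-nonZero (≤-trans (s≤s z≤n) 4≤X)}} 13

  4b-word : 4 * b ≤ X ^ 13
  4b-word = up {i = 2} (_⊗_ {i = 1} {1} (¹ 4≤X) (¹ b≤X))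

  n⁴-word : 4 * fourth n ≤ X ^ 13
  n⁴-word = up {i = 5} (_⊗_ {i = 1} {4} (¹ 4≤X) n⁴)

  total-word : samples M p q Tm * z ≤ X ^ 13
  total-word = _⊗_ {i = 9} {4} samples≤ (≤-trans z≤ n⁴)

  samples-word : 4 * samples M p q Tm ≤ X ^ 13
  samples-word = up {i = 10} (_⊗_ {i = 1} {9} (¹ 4≤X) samples≤)

-- The numerals of the running time are variables here, which keeps them folded.
time-bound : ∀ h c N Nm Tm l d → N ≤ Nm → Tm ≤ Nm → 1 ≤ Nm → 1 ≤ d →
  5 * h + Tm * h + 4 * l * h + (3 + N * (2 + (c + l * h + d * (4 * h) + 10 + (h + (4 * l + 1) * h))) + (3 * h + 4 * l * h)) ≤
  Nm * ((28 * h + c + 15) * (d + l))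
time-bound h c N Nm Tm l d N≤ Tm≤ 1≤Nm 1≤d = begin
  5 * h + Tm * h + 4 * l * h + (3 + N * (2 + (c + l * h + d * (4 * h) + 10 + (h + (4 * l + 1) * h))) + (3 * h + 4 * l * h))
    ≤⟨ +-mono-≤ (+-monoˡ-≤ (4 * l * h) (+-monoʳ-≤ (5 * h) (*-monoˡ-≤ h Tm≤)))
         (+-monoˡ-≤ (3 * h + 4 * l * h) (+-monoʳ-≤ 3 (*-monoˡ-≤ _ N≤))) ⟩
  5 * h + Nm * h + 4 * l * h + (3 + Nm * (2 + (c + l * h + d * (4 * h) + 10 + (h + (4 * l + 1) * h))) + (3 * h + 4 * l * h))
    ≡⟨ lemma₁ h c Nm l d ⟩
  8 * h + 3 + 8 * h * l + Nm * (c + 12 + 3 * h + 5 * h * l + 4 * h * d)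
    ≤⟨ +-monoˡ-≤ _ (m≤n*m (8 * h + 3 + 8 * h * l) Nm {{>-nonZero 1≤Nm}}) ⟩
  Nm * (8 * h + 3 + 8 * h * l) + Nm * (c + 12 + 3 * h + 5 * h * l + 4 * h * d)
    ≡⟨ lemma₂ h c Nm l d ⟩
  Nm * ((11 * h + c + 15) * 1 + (13 * h * l + 4 * h * d))
    ≤⟨ *-monoʳ-≤ Nm (+-monoˡ-≤ (13 * h * l + 4 * h * d) (*-monoʳ-≤ (11 * h + c + 15) 1≤d)) ⟩
  Nm * ((11 * h + c + 15) * d + (13 * h * l + 4 * h * d))
    ≤⟨ *-monoʳ-≤ Nm (m≤m+n _ (13 * h * d + (15 * h + c + 15) * l)) ⟩
  Nm * ((11 * h + c + 15) * d + (13 * h * l + 4 * h * d) + (13 * h * d + (15 * h + c + 15) * l))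
    ≡⟨ cong (Nm *_) (lemma₃ h c l d) ⟩
  Nm * ((28 * h + c + 15) * (d + l)) ∎
  where
  open ≤-Reasoning
  lemma₁ : ∀ h c x l d → 5 * h + x * h + 4 * l * h + (3 + x * (2 + (c + l * h + d * (4 * h) + 10 + (h + (4 * l + 1) * h))) + (3 * h + 4 * l * h)) ≡
    8 * h + 3 + 8 * h * l + x * (c + 12 + 3 * h + 5 * h * l + 4 * h * d)
  lemma₁ = solve-∀
  lemma₂ : ∀ h c x l d → x * (8 * h + 3 + 8 * h * l) + x * (c + 12 + 3 * h + 5 * h * l + 4 * h * d) ≡
    x * ((11 * h + c + 15) * 1 + (13 * h * l + 4 * h * d))
  lemma₂ = solve-∀
  lemma₃ : ∀ h c l d → (11 * h + c + 15) * d + (13 * h * l + 4 * h * d) + (13 * h * d + (15 * h + c + 15) * l) ≡ (28 * h + c + 15) * (d + l)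
  lemma₃ = solve-∀

abstract

  -- The product of 390, which relates the samples to Õ, and 3696 = 28 · 100 + 881 + 15 from
  -- `time-bound`. It is abstract so that powers with this exponent are never evaluated.
  constant : ℕ
  constant = 1441440

  104≤constant : 104 ≤ constant
  104≤constant = ≤! {104} {1441440}

  390≤constant : 390 ≤ constant
  390≤constant = ≤! {390} {1441440}

  390*3696≤constant : 390 * 3696 ≤ constant
  390*3696≤constant = ≤! {390 * 3696} {1441440}

algorithm : Algorithm
algorithm = record { setup = setupᶜ ; wsamp = wsampᶜ ; main = mainᶜ }

-- Assembly of the guarantees

module Guarantee {n : ℕ} (G : BipartiteGraph n) (B>0 : B G > 0) where

  open Moments G
  open GraphBounds G B>0

  W D l : ℕ
  W = length wedgeList
  D = maxDegree G
  l = ⌈log₂ n ⌉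

  instance
    W≢0 : NonZero W
    W≢0 = >-nonZero W>0

  -- Covers both memories: 17 + 2 n cells for the sampler (registers, prefix sums, marks) and 17 + 4
  -- ⌈log₂ n⌉ for the sums of the main program.
  K : ℕ
  K = 17 + 4 * n

  K≥ : 17 + (n + n) ≤ K
  K≥ = +-monoʳ-≤ 17 (≤-trans (≤-reflexive (cong (n +_) (sym (+-identityʳ n)))) (*-monoˡ-≤ n (≤! {2} {4})))

  K≥log : 17 + 4 * l ≤ K
  K≥log = +-monoʳ-≤ 17 (*-monoʳ-≤ 4 (≤-trans (⌈log₂⌉-mono-≤ (<⇒≤ (n<2^n n))) (≤-reflexive (⌈log₂2^n⌉≡n n))))

  K≤ : K ≤ 21 * n
  K≤ = ≤-trans (+-monoˡ-≤ (4 * n) (*-monoʳ-≤ 17 n>0)) (≤-reflexive (sym (*-distribʳ-+ n 17 4)))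

  W≤nW : W ≤ n * W
  W≤nW = m≤n*m W n {{>-nonZero n>0}}

  implementsWSamp : ImplementsWSamp algorithm G
  -- Neither ε and δ nor M is in scope here, so n + n W serves as an ad hoc bound on the words.
  implementsWSamp = WSampCorrect.implements G K (n + n * W) D K≥ (m≤m+n n (n * W)) (m≤n+m (n * W) n)
    (≤-trans W≤nW (m≤n+m (n * W) n)) (≤-trans n>0 (m≤m+n n (n * W))) degree≤maxDegree degree≤n mainᶜ

  module Parameters (ε δ : ℚ) .{{_ : ℚ.Positive ε}} .{{_ : ℚ.Positive δ}} (ε≤1 : ε ℚ.≤ 1ℚ) (δ≤1 : δ ℚ.≤ 1ℚ)
    (M : ℕ) (M≥ : spread G ℚ.≤ fromℕ M) (M≤ : fromℕ M ℚ.≤ fromℕ 2 ℚ.* spread G ℚ.+ 1ℚ) where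

    p q a b Λ Tm X V : ℕ
    p = numerator ε
    q = ℚ.↧ₙ ε
    a = numerator δ
    b = ℚ.↧ₙ δ
    Λ = 1 ⊔ ⌈log₂ ⌈1/ δ ⌉ ⌉
    -- The 1 pays for the two tails: 2 · 2^-Tm ≤ δ. It is an a priori bound on the number of
    -- repetitions that the program finds by doubling.
    Tm = 1 + ⌈log₂ ⌈1/ δ ⌉ ⌉
    X = n + M + q + b
    V = X ^ 13

    instance
      p≢0 : NonZero p
      p≢0 = >-nonZero (numerator-pos ε)

    M>0 : 1 ≤ M
    M>0 = fromℕ-cancel (ℚ.≤-trans 1≤spread M≥)

    Tm≤2Λ : Tm ≤ 2 * Λ
    Tm≤2Λ = ≤-trans (+-mono-≤ (m≤m⊔n 1 ⌈log₂ ⌈1/ δ ⌉ ⌉) (m≤n⊔m 1 ⌈log₂ ⌈1/ δ ⌉ ⌉)) (≤-reflexive (cong (Λ +_) (sym (+-identityʳ Λ))))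

    Tm≤2b : Tm ≤ 2 * b
    Tm≤2b = ≤-trans (+-mono-≤ {1} {b} (s≤s z≤n) (≤-trans (⌈log₂⌉-mono-≤ (<⇒≤ (n<2^n ⌈1/ δ ⌉)))
      (≤-trans (≤-reflexive (⌈log₂2^n⌉≡n ⌈1/ δ ⌉)) (proj₂ (⌈1/⌉-bounds δ))))) (≤-reflexive (cong (b +_) (sym (+-identityʳ b))))

    Tm-large : 2 * b ≤ 2 ^ Tm * a
    Tm-large = ≤-trans (*-monoʳ-≤ 2 (≤-trans (proj₁ (⌈1/⌉-bounds δ)) (*-monoˡ-≤ a (n≤2^⌈log₂n⌉ ⌈1/ δ ⌉))))
      (≤-reflexive (sym (*-assoc 2 (2 ^ ⌈log₂ ⌈1/ δ ⌉ ⌉) a)))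

    n≤X : n ≤ X
    n≤X = ≤-trans (m≤m+n n M) (≤-trans (m≤m+n (n + M) q) (m≤m+n (n + M + q) b))

    4≤X : 4 ≤ X
    4≤X = +-mono-≤ (+-mono-≤ (+-mono-≤ n>0 M>0) (s≤s z≤n)) (s≤s z≤n)

    module Words = WordBounds X n M p q b Tm (n * W) 4≤X n≤X
      (≤-trans (m≤n+m M n) (≤-trans (m≤m+n (n + M) q) (m≤m+n (n + M + q) b)))
      (≤-trans (m≤n+m q (n + M)) (m≤m+n (n + M + q) b)) (m≤n+m b (n + M + q)) M>0 (s≤s z≤n) Tm≤2b nW≤n⁴

    z : Fin W → ℕ
    z i = β (lookup wedgeList i) * W

    b₀ : ℕ
    b₀ = B G

    ∑z : ∑ (allFin W) z ≡ W * (4 * b₀)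
    ∑z = trans (∑-lookup wedgeList (λ w → β w * W)) (trans (∑-*ʳ W β wedgeList) (trans (cong (_* W) first-moment) (*-comm (4 * b₀) W)))

    ∑z² : ∑ (allFin W) (λ i → z i * z i) ≤ W * (4 * (M * (b₀ * b₀)))
    ∑z² = begin
      ∑ (allFin W) (λ i → z i * z i)                     ≡⟨ ∑-lookup wedgeList (λ w → β w * W * (β w * W)) ⟩
      ∑ wedgeList (λ w → β w * W * (β w * W))            ≡⟨ ∑-cong wedgeList (λ w → lemma₁ (β w) W) ⟩
      ∑ wedgeList (λ w → W * W * (β w * β w))            ≡⟨ ∑-*ˡ (W * W) _ wedgeList ⟩
      W * W * ∑ wedgeList (λ w → β w * β w)              ≤⟨ *-monoʳ-≤ (W * W) second-moment ⟩
      W * W * (4 * (b₀ + p₁w G))                         ≡⟨ lemma₂ W (b₀ + p₁w G) ⟩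
      W * (4 * (W * (b₀ + p₁w G)))                       ≤⟨ *-monoʳ-≤ W (*-monoʳ-≤ 4 (W[B+p]≤MB² M M≥)) ⟩
      W * (4 * (M * (b₀ * b₀))) ∎
      where
      open ≤-Reasoning
      lemma₁ : ∀ x W → x * W * (x * W) ≡ W * W * (x * x)
      lemma₁ = solve-∀
      lemma₂ : ∀ W y → W * W * (4 * y) ≡ W * (4 * (W * y))
      lemma₂ = solve-∀

    Nm : ℕ
    Nm = samples M p q Tm

    M≤3spread : fromℕ M ℚ.≤ fromℕ 3 ℚ.* spread G
    M≤3spread = ℚ.≤-trans M≤ (ℚ.≤-trans (ℚ.+-monoʳ-≤ (fromℕ 2 ℚ.* spread G) 1≤spread) (ℚ.≤-reflexive
      (trans (cong (fromℕ 2 ℚ.* spread G ℚ.+_) (sym (ℚ.*-identityˡ (spread G)))) (sym (ℚ.*-distribʳ-+ (spread G) (fromℕ 2) 1ℚ)))))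

    1/ε : ℚ
    1/ε = (ℚ.1/ ε) {{ℚ.pos⇒nonZero ε}}

    0≤1/ε : 0ℚ ℚ.≤ 1/ε
    0≤1/ε = *-cancelʳ-fromℕ p (subst₂ ℚ._≤_ (sym (ℚ.*-zeroˡ (fromℕ p))) (sym (inverse-* ε)) (0≤fromℕ q))

    -- 390 = 65 · 2 · 3, from `samples-upper`, from Tm ≤ 2 Λ and from M being at most three times
    -- the spread.
    Nm≤Õ : fromℕ Nm ℚ.≤ fromℕ 390 ℚ.* Õ ε δ (spread G)
    Nm≤Õ = *-cancelʳ-fromℕ (p * p) {{m*n≢0 p p}} (begin
      fromℕ Nm ℚ.* fromℕ (p * p)
        ≡⟨ trans (sym (fromℕ-* Nm (p * p))) (cong fromℕ (*-comm Nm (p * p))) ⟩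
      fromℕ (p * p * Nm)
        ≤⟨ fromℕ-mono (≤-trans (samples-upper M p q Tm M>0 (numerator≤ ε ε≤1)) (*-monoʳ-≤ (65 * (M * (q * q))) Tm≤2Λ)) ⟩
      fromℕ (65 * (M * (q * q)) * (2 * Λ))
        ≡⟨ cong fromℕ (lemma M (q * q) Λ) ⟩
      fromℕ (130 * (M * (Λ * (q * q))))
        ≡⟨ trans (fromℕ-* 130 (M * (Λ * (q * q)))) (cong (fromℕ 130 ℚ.*_) (trans (fromℕ-* M (Λ * (q * q))) (cong (fromℕ M ℚ.*_) (fromℕ-* Λ (q * q))))) ⟩
      fromℕ 130 ℚ.* (fromℕ M ℚ.* (fromℕ Λ ℚ.* fromℕ (q * q)))
        ≤⟨ *-monoˡ-0≤ (0≤fromℕ 130) (*-monoʳ-0≤ (0≤* (0≤fromℕ Λ) (0≤fromℕ (q * q))) M≤3spread) ⟩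
      fromℕ 130 ℚ.* (fromℕ 3 ℚ.* spread G ℚ.* (fromℕ Λ ℚ.* fromℕ (q * q)))
        ≡⟨ cong (λ x → fromℕ 130 ℚ.* (fromℕ 3 ℚ.* spread G ℚ.* (fromℕ Λ ℚ.* x)))
             (trans (fromℕ-* q q) (sym (cong₂ ℚ._*_ (inverse-* ε) (inverse-* ε)))) ⟩
      fromℕ 130 ℚ.* (fromℕ 3 ℚ.* spread G ℚ.* (fromℕ Λ ℚ.* (1/ε ℚ.* fromℕ p ℚ.* (1/ε ℚ.* fromℕ p))))
        ≡⟨ regroup (fromℕ 130) (fromℕ 3) (spread G) (fromℕ Λ) 1/ε (fromℕ p) ⟩
      fromℕ 130 ℚ.* fromℕ 3 ℚ.* (spread G ℚ.* fromℕ Λ ℚ.* (1/ε ℚ.* 1/ε)) ℚ.* (fromℕ p ℚ.* fromℕ p)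
        ≡⟨ cong₂ (λ x y → x ℚ.* (spread G ℚ.* fromℕ Λ ℚ.* (1/ε ℚ.* 1/ε)) ℚ.* y) (fromℕ-* 130 3) (fromℕ-* p p) ⟨
      fromℕ 390 ℚ.* (spread G ℚ.* fromℕ Λ ℚ.* (1/ε ℚ.* 1/ε)) ℚ.* fromℕ (p * p) ∎)
      where
      open ℚ.≤-Reasoning
      lemma : ∀ M y Λ → 65 * (M * y) * (2 * Λ) ≡ 130 * (M * (Λ * y))
      lemma = solve-∀
      open ℚSolver.+-*-Solver
      regroup : ∀ c d s l e p → c ℚ.* (d ℚ.* s ℚ.* (l ℚ.* (e ℚ.* p ℚ.* (e ℚ.* p)))) ≡ c ℚ.* d ℚ.* (s ℚ.* l ℚ.* (e ℚ.* e)) ℚ.* (p ℚ.* p)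
      regroup = solve 6 (λ c d s l e p → c :* (d :* s :* (l :* (e :* p :* (e :* p)))) := c :* d :* (s :* l :* (e :* e)) :* (p :* p)) refl

    0≤spread : 0ℚ ℚ.≤ spread G
    0≤spread = ℚ.≤-trans (fromℕ-mono {0} {1} z≤n) 1≤spread

    0≤Õ : ∀ {f} → 0ℚ ℚ.≤ f → 0ℚ ℚ.≤ Õ ε δ f
    0≤Õ 0≤f = 0≤* (0≤* 0≤f (0≤fromℕ Λ)) (0≤* 0≤1/ε 0≤1/ε)

    Õ-* : ∀ e f → Õ ε δ (e ℚ.* f) ≡ e ℚ.* Õ ε δ f
    Õ-* e f = regroup e f (fromℕ Λ) (1/ε ℚ.* 1/ε)
      where
      open ℚSolver.+-*-Solver
      regroup : ∀ e f l x → e ℚ.* f ℚ.* l ℚ.* x ≡ e ℚ.* (f ℚ.* l ℚ.* x)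
      regroup = solve 4 (λ e f l x → e :* f :* l :* x := e :* (f :* l :* x)) refl

    mainTime : ℕ → ℕ
    mainTime N = 500 + Tm * 100 + 4 * l * 100 + (3 + N * (2 + (881 + l * 100 + D * 400 + 10 + (100 + (4 * l + 1) * 100))) + (300 + 4 * l * 100))

    mainTime≤ : ∀ {N} → N ≤ Nm → mainTime N ≤ Nm * (3696 * (D + l))
    mainTime≤ {N} N≤Nm = time-bound 100 881 N Nm Tm l D N≤Nm (T≤samples M p q Tm) (≤-trans (s≤s z≤n) (T≤samples M p q Tm)) maxDegree>0

    time≤Õ : ∀ {N t} → N ≤ Nm → t ≤ mainTime N → fromℕ t ℚ.≤ fromℕ constant ℚ.* Õ ε δ (fromℕ (D + l) ℚ.* spread G)
    time≤Õ {N} {t} N≤Nm t≤ = begin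
      fromℕ t
        ≤⟨ fromℕ-mono (≤-trans t≤ (mainTime≤ N≤Nm)) ⟩
      fromℕ (Nm * (3696 * (D + l)))
        ≡⟨ trans (fromℕ-* Nm (3696 * (D + l))) (cong (fromℕ Nm ℚ.*_) (fromℕ-* 3696 (D + l))) ⟩
      fromℕ Nm ℚ.* (fromℕ 3696 ℚ.* fromℕ (D + l))
        ≤⟨ *-monoʳ-0≤ (0≤* (0≤fromℕ 3696) (0≤fromℕ (D + l))) Nm≤Õ ⟩
      fromℕ 390 ℚ.* Õ ε δ (spread G) ℚ.* (fromℕ 3696 ℚ.* fromℕ (D + l))
        ≡⟨ regroup (fromℕ 390) (Õ ε δ (spread G)) (fromℕ 3696) (fromℕ (D + l)) ⟩
      fromℕ 390 ℚ.* fromℕ 3696 ℚ.* (fromℕ (D + l) ℚ.* Õ ε δ (spread G))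
        ≡⟨ cong₂ ℚ._*_ (fromℕ-* 390 3696) (Õ-* (fromℕ (D + l)) (spread G)) ⟨
      fromℕ (390 * 3696) ℚ.* Õ ε δ (fromℕ (D + l) ℚ.* spread G)
        ≤⟨ *-monoʳ-0≤ (0≤Õ (0≤* (0≤fromℕ (D + l)) 0≤spread)) (fromℕ-mono 390*3696≤constant) ⟩
      fromℕ constant ℚ.* Õ ε δ (fromℕ (D + l) ℚ.* spread G) ∎
      where
      open ℚ.≤-Reasoning
      open ℚSolver.+-*-Solver
      regroup : ∀ a o b e → a ℚ.* o ℚ.* (b ℚ.* e) ≡ a ℚ.* b ℚ.* (e ℚ.* o)
      regroup = solve 4 (λ a o b e → a :* o :* (b :* e) := a :* b :* (e :* o)) refl

    calls≤Õ : ∀ {N} → N ≤ Nm → fromℕ N ℚ.≤ fromℕ constant ℚ.* Õ ε δ (spread G)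
    calls≤Õ N≤Nm = ℚ.≤-trans (fromℕ-mono N≤Nm) (ℚ.≤-trans Nm≤Õ (*-monoʳ-0≤ (0≤Õ 0≤spread) (fromℕ-mono 390≤constant)))

    Costs : Usage → Usage → Set
    Costs u v =
      time u ≤ constant * n ×
      fromℕ (calls v) ℚ.≤ fromℕ constant ℚ.* Õ ε δ (spread G) ×
      fromℕ (time v) ℚ.≤ fromℕ constant ℚ.* Õ ε δ (fromℕ (maxDegree G + ⌈log₂ n ⌉) ℚ.* spread G) ×
      cells u ⊔ cells v ≤ constant * n ×
      word u ⊔ word v ≤ (n + M + ℚ.↧ₙ ε + ℚ.↧ₙ δ) ^ constant

    setup-time : ∀ {t} → t ≤ 4 + n * 100 → t ≤ constant * n
    setup-time {t} t≤ = begin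
      t                  ≤⟨ t≤ ⟩
      4 + n * 100        ≤⟨ +-monoˡ-≤ (n * 100) (m≤m*n 4 n {{>-nonZero n>0}}) ⟩
      4 * n + n * 100    ≡⟨ lemma n ⟩
      104 * n            ≤⟨ *-monoˡ-≤ n 104≤constant ⟩
      constant * n ∎
      where
      open ≤-Reasoning
      lemma : ∀ n → 4 * n + n * 100 ≡ 104 * n
      lemma = solve-∀

    cell-bound : K ≤ constant * n
    cell-bound = ≤-trans K≤ (*-monoˡ-≤ n (≤-trans (≤! {21} {104}) 104≤constant))

    word-bound : V ≤ X ^ constant
    word-bound = ^-monoʳ-≤ X {{>-nonZero (≤-trans (s≤s z≤n) 4≤X)}} (≤-trans (≤! {13} {104}) 104≤constant)

    cost-bounds : ∀ {N u v} → N ≤ Nm → Fits K V (4 + n * 100) 0 u → Fits K V (mainTime N) N v → Costs u v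
    cost-bounds {N} {u} {v} N≤Nm (fits t c s w) (fits t′ c′ s′ w′) =
      setup-time t ,
      subst (λ k → fromℕ k ℚ.≤ fromℕ constant ℚ.* Õ ε δ (spread G)) (sym c′) (calls≤Õ N≤Nm) ,
      time≤Õ N≤Nm t′ ,
      ≤-trans (⊔-lub s s′) cell-bound ,
      ≤-trans (⊔-lub w w′) word-bound

    -- As a parameter the sampler stays opaque, and only its interface enters the estimate and the
    -- costs.
    module _ (impl : Implementation (storedGraph G) z K V (4 + n * 100) (881 + l * 100 + D * 400)) where

      open Implementation impl

      runMain : Run (Memory × Memory)
      runMain = execCall (parameters n M ε δ) (execDraw (storedGraph G) wsampᶜ) mainᶜ (blank , initial)

      output′ : (Memory × Memory) × Usage → ℚ
      output′ ((m , _) , _) = ratio (m 0) (m 1)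

      estimates : Σ[ N ∈ ℕ ] N ≤ Nm ×
        fromℕ b ℚ.* Pr (λ s → ratio p q ℚ.* fromℕ b₀ ℚ.<? ℚ.∣ output′ s ℚ.- fromℕ b₀ ∣) runMain ℚ.≤ fromℕ a ×
        (∀ {s} → s outcomeOf runMain → Fits K V (mainTime N) N (proj₂ s))
      estimates = Main.main-estimates z Ready (execDraw (storedGraph G) wsampᶜ) K V (881 + l * 100 + D * 400) M p q a b Tm (n * W)
        sample-runs (λ i → *-monoˡ-≤ W (≤-trans (m∸n≤m _ 1) (k≤n _ _))) nW≤n⁴ n>0 (numerator-pos δ) (numerator≤ δ δ≤1)
        Tm-large Tm≤2b K≥log Words.4b-word Words.n⁴-word Words.total-word Words.samples-word
        b₀ setup-ready B>0 M>0 (numerator≤ ε ε≤1) ∑z ∑z²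

      after : Memory × Usage → Rand Outcome
      after (bank , u) = execCall (parameters n M ε δ) (execDraw (storedGraph G) wsampᶜ) mainᶜ (blank , bank) >>= λ ((m , _) , v) →
        return (outcome (ratio (m 0) (m 1)) u v)

      isEstimator : IsEstimator ε δ (fromℕ b₀) (estimator algorithm G M ε δ)
      isEstimator = subst (λ r → Pr far? (r >>= after >>= λ o → return (estimate o)) ℚ.≤ δ) (sym setup-runs)
        (subst (ℚ._≤ δ) (sym (trans (Pr-map far? estimate (after (initial , used)))
            (Pr-map (far? ∘ estimate) (λ s → outcome (output′ s) used (proj₂ s)) runMain)))
          (*-cancelˡ-fromℕ b (begin
            fromℕ b ℚ.* Pr (far? ∘ output′) runMain
              ≡⟨ cong (λ e → fromℕ b ℚ.* Pr (λ s → e ℚ.* fromℕ b₀ ℚ.<? ℚ.∣ output′ s ℚ.- fromℕ b₀ ∣) runMain) (ratio-numerator ε) ⟨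
            fromℕ b ℚ.* Pr (λ s → ratio p q ℚ.* fromℕ b₀ ℚ.<? ℚ.∣ output′ s ℚ.- fromℕ b₀ ∣) runMain
              ≤⟨ proj₁ (proj₂ (proj₂ estimates)) ⟩
            fromℕ a
              ≡⟨ ratio-*-fromℕ a b ⟨
            ratio a b ℚ.* fromℕ b
              ≡⟨ trans (cong (ℚ._* fromℕ b) (ratio-numerator δ)) (ℚ.*-comm δ (fromℕ b)) ⟩
            fromℕ b ℚ.* δ ∎)))
        where
        open ℚ.≤-Reasoning
        far? : Decidable (λ z → ε ℚ.* fromℕ b₀ ℚ.< ℚ.∣ z ℚ.- fromℕ b₀ ∣)
        far? z = ε ℚ.* fromℕ b₀ ℚ.<? ℚ.∣ z ℚ.- fromℕ b₀ ∣

      costs : ∀ o → o outcomeOf execution algorithm G M ε δ → Costs (setupCost o) (mainCost o)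
      costs o out = conclude (>>=-return-outcome {r = runMain} (subst (λ r → o outcomeOf (r >>= after)) setup-runs out))
        where
        conclude : ∀ {o} → (∃ λ s → s outcomeOf runMain × o ≡ outcome (output′ s) used (proj₂ s)) → Costs (setupCost o) (mainCost o)
        conclude (s , out′ , refl) = cost-bounds (proj₁ (proj₂ estimates)) setup-fits (proj₂ (proj₂ (proj₂ estimates)) out′)

    implementation : Implementation (storedGraph G) z K V (4 + n * 100) (881 + l * 100 + D * 400)
    implementation = WSampCorrect.implementation G K V D K≥ Words.n-word Words.z-word (≤-trans W≤nW Words.z-word) Words.1-word degree≤maxDegree degree≤n

lemma12 :
    Σ[ 𝒜 ∈ Algorithm ] Σ[ c ∈ ℕ ]
    ∀ {n} (G : BipartiteGraph n) → B G > 0 →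
    ImplementsWSamp 𝒜 G ×
    (∀ (ε δ : ℚ) .{{_ : ℚ.Positive ε}} .{{_ : ℚ.Positive δ}} → ε ℚ.≤ 1ℚ → δ ℚ.≤ 1ℚ →
     ∀ (M : ℕ) → spread G ℚ.≤ fromℕ M → fromℕ M ℚ.≤ fromℕ 2 ℚ.* spread G ℚ.+ 1ℚ →
     IsEstimator ε δ (fromℕ (B G)) (estimator 𝒜 G M ε δ) ×
     (∀ o → o outcomeOf execution 𝒜 G M ε δ →
      time (setupCost o) ≤ c * n ×
      fromℕ (calls (mainCost o)) ℚ.≤ fromℕ c ℚ.* Õ ε δ (spread G) ×
      fromℕ (time (mainCost o)) ℚ.≤
        fromℕ c ℚ.* Õ ε δ (fromℕ (maxDegree G + ⌈log₂ n ⌉) ℚ.* spread G) ×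
      cells (setupCost o) ⊔ cells (mainCost o) ≤ c * n ×
      word (setupCost o) ⊔ word (mainCost o) ≤ (n + M + ℚ.↧ₙ ε + ℚ.↧ₙ δ) ^ c))
lemma12 = algorithm , constant , λ G B>0 → Guarantee.implementsWSamp G B>0 , λ ε δ ε≤1 δ≤1 M M≥ M≤ →
  let impl = Guarantee.Parameters.implementation G B>0 ε δ ε≤1 δ≤1 M M≥ M≤ in
  Guarantee.Parameters.isEstimator G B>0 ε δ ε≤1 δ≤1 M M≥ M≤ impl , Guarantee.Parameters.costs G B>0 ε δ ε≤1 δ≤1 M M≥ M≤ impl
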